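{- Let $p<q<r$ be odd primes, $l,s,t\ge 1$ integers, $n=p^lq^sr^t$ and $m=\phi(n)$. Then $$\mathrm{Cond}(V_{\Phi_n})\le 2\,\phi(\mathrm{rad}(n))^2\,m^2.$$
   Context: $\phi$ is Euler's totient, $\mathrm{rad}(n)$ is the product of the distinct primes dividing $n$, $\Phi_n$ is the $n$-th cyclotomic polynomial, of degree $m=\phi(n)$, and $\zeta_1,\dots,\zeta_m\in\mathbb{C}$ are the primitive $n$-th roots of unity (in any fixed order). $V_{\Phi_n}$ is the $m\times m$ Vandermonde matrix whose $(i,j)$ entry is $\zeta_i^{\,j-1}$, $1\le i,j\le m$. For a complex matrix $A=(a_{ij})$, $\|A\|=\sqrt{\sum_{i,j}|a_{ij}|^2}$ is the Frobenius norm, and for invertible $A$, $\mathrm{Cond}(A)=\|A\|\,\|A^{ -1}\|$. -}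

module Defs where

open import Algebra.Bundles.Raw using (RawRing)
import Algebra.Definitions.RawMonoid as RawMonoidDefs
import Algebra.Definitions.RawSemiring as RawSemiringDefs
open import Data.Fin.Base using (Fin; toℕ)
import Data.Fin.Properties as Fin
open import Data.Integer.Base as ℤ using (+_; +[1+_])
import Data.Integer.Properties as ℤ
open import Data.List.Base using (filter; length; map; upTo)
open import Data.Nat.Base as ℕ using (ℕ; zero; suc; z≤n; s≤s)
open import Data.Nat.ListAction using (product)
import Data.Nat.Properties as ℕ
open import Data.Nat.Coprimality using (coprime?)
open import Data.Nat.Divisibility using (_∣_; _∣?_)
open import Data.Nat.Primality using (Prime; prime?)
open import Data.Product.Base using (∃-syntax; _×_; _,_; proj₁; proj₂)
open import Data.Rational.Base as ℚ using (ℚ; mkℚ; 0ℚ; 1ℚ; ½)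
import Data.Rational.Properties as ℚ
open import Data.Rational.Solver using (module +-*-Solver)
import Data.Rational.Unnormalised.Base as ℚᵘ
import Data.Rational.Unnormalised.Properties as ℚᵘ
open import Data.Sum.Base using (_⊎_; inj₁; inj₂)
open import Function.Definitions using (Injective)
open import Level using (0ℓ)
open import Relation.Binary.PropositionalEquality
  using (_≡_; refl; sym; trans; cong; cong₂; subst; subst₂)
open import Relation.Nullary using (¬_; yes; no; contradiction)
open import Relation.Nullary.Decidable using (_×-dec_; does)
open import Data.Bool.Base using (if_then_else_)

------------------------------------------------------------------------
-- Arithmetic functions

OddPrime : ℕ → Set
OddPrime p = Prime p × ¬ (2 ∣ p)

φ : ℕ → ℕ
φ n = length (filter (λ k → coprime? k n) (map suc (upTo n)))

-- For n ≥ 1 every divisor of n is at most n, so searching 0, …, n suffices.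
rad : ℕ → ℕ
rad n = product (filter (λ p → prime? p ×-dec p ∣? n) (upTo (suc n)))

------------------------------------------------------------------------
-- Rational auxiliaries

private
  module Q where
    open ℚ.≤-Reasoning public
    open +-*-Solver public

  pos : ∀ {p} → 0ℚ ℚ.< p → ℚ.Positive p
  pos = ℚ.positive

  nonneg : ∀ {p} → 0ℚ ℚ.≤ p → ℚ.NonNegative p
  nonneg = ℚ.nonNegative

  *-mono : ∀ {a b c d} → 0ℚ ℚ.≤ c → 0ℚ ℚ.≤ b → a ℚ.≤ b → c ℚ.≤ d →
           a ℚ.* c ℚ.≤ b ℚ.* d
  *-mono {a} {b} {c} {d} 0≤c 0≤b a≤b c≤d =
    ℚ.≤-trans (ℚ.*-monoʳ-≤-nonNeg c {{nonneg 0≤c}} a≤b)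
              (ℚ.*-monoˡ-≤-nonNeg b {{nonneg 0≤b}} c≤d)

  *-pos : ∀ {a b} → 0ℚ ℚ.< a → 0ℚ ℚ.< b → 0ℚ ℚ.< a ℚ.* b
  *-pos {a} {b} 0<a 0<b =
    ℚ.positive⁻¹ _ {{ℚ.pos*pos⇒pos a {{pos 0<a}} b {{pos 0<b}}}}

  *-nonneg : ∀ {a b} → 0ℚ ℚ.≤ a → 0ℚ ℚ.≤ b → 0ℚ ℚ.≤ a ℚ.* b
  *-nonneg {a} {b} 0≤a 0≤b =
    ℚ.nonNegative⁻¹ _ {{ℚ.nonNeg*nonNeg⇒nonNeg a {{nonneg 0≤a}} b {{nonneg 0≤b}}}}

  +-nonneg : ∀ {a b} → 0ℚ ℚ.≤ a → 0ℚ ℚ.≤ b → 0ℚ ℚ.≤ a ℚ.+ b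
  +-nonneg 0≤a 0≤b = ℚ.+-mono-≤ 0≤a 0≤b

  +-pos : ∀ {a b} → 0ℚ ℚ.≤ a → 0ℚ ℚ.< b → 0ℚ ℚ.< a ℚ.+ b
  +-pos 0≤a 0<b = ℚ.+-mono-≤-< 0≤a 0<b

  half : ℚ → ℚ
  half ε = ½ ℚ.* ε

  half-pos : ∀ {ε} → 0ℚ ℚ.< ε → 0ℚ ℚ.< half ε
  half-pos = *-pos (ℚ.positive⁻¹ ½)

  half+half : ∀ ε → half ε ℚ.+ half ε ≡ ε
  half+half ε = trans (sym (ℚ.*-distribʳ-+ ε ½ ½)) (ℚ.*-identityˡ ε)

  -- For C ≥ 0, a positive η with C η ≤ ε.
  scaled : ∀ {C ε} → 0ℚ ℚ.≤ C → 0ℚ ℚ.< ε →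
           ∃[ η ] 0ℚ ℚ.< η × C ℚ.* η ℚ.≤ ε
  scaled {C} {ε} 0≤C 0<ε = η , 0<η , Cη≤ε
    where
    D = C ℚ.+ 1ℚ
    0<D : 0ℚ ℚ.< D
    0<D = +-pos 0≤C (ℚ.positive⁻¹ 1ℚ)
    instance
      _ = pos 0<D
      _ = ℚ.pos⇒nonZero D
    η = ε ℚ.* ℚ.1/ D
    0<η : 0ℚ ℚ.< η
    0<η = *-pos 0<ε (ℚ.positive⁻¹ _ {{ℚ.1/pos⇒pos D}})
    Cη≤ε : C ℚ.* η ℚ.≤ ε
    Cη≤ε = Q.begin
      C ℚ.* η               Q.≤⟨ ℚ.*-monoʳ-≤-nonNeg η {{nonneg (ℚ.<⇒≤ 0<η)}}
                                   (subst (ℚ._≤ D) (ℚ.+-identityʳ C)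
                                     (ℚ.+-monoʳ-≤ C (ℚ.nonNegative⁻¹ 1ℚ))) ⟩
      D ℚ.* (ε ℚ.* ℚ.1/ D)  Q.≡⟨ Q.solve 3 (λ d e i → d Q.:* (e Q.:* i) Q.:= e Q.:* (d Q.:* i))
                                   refl D ε (ℚ.1/ D) ⟩
      ε ℚ.* (D ℚ.* ℚ.1/ D)  Q.≡⟨ cong (ε ℚ.*_) (ℚ.*-inverseʳ D) ⟩
      ε ℚ.* 1ℚ              Q.≡⟨ ℚ.*-identityʳ ε ⟩
      ε                     Q.∎

  abs≤ : ∀ {p q} → p ℚ.≤ q → ℚ.- p ℚ.≤ q → ℚ.∣ p ∣ ℚ.≤ q
  abs≤ {p} p≤q -p≤q with ℚ.∣p∣≡p∨∣p∣≡-p p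
  ... | inj₁ e = subst (ℚ._≤ _) (sym e) p≤q
  ... | inj₂ e = subst (ℚ._≤ _) (sym e) -p≤q

  p≤∣p∣ : ∀ p → p ℚ.≤ ℚ.∣ p ∣
  p≤∣p∣ p with ℚ.≤-total 0ℚ p
  ... | inj₁ 0≤p = ℚ.≤-reflexive (sym (ℚ.0≤p⇒∣p∣≡p 0≤p))
  ... | inj₂ p≤0 = ℚ.≤-trans p≤0 (ℚ.0≤∣p∣ p)

  ≤+⇒-≤ : ∀ {a b c} → a ℚ.≤ b ℚ.+ c → a ℚ.- b ℚ.≤ c
  ≤+⇒-≤ {a} {b} {c} h = subst (a ℚ.- b ℚ.≤_)
    (Q.solve 2 (λ b c → (b Q.:+ c) Q.:- b Q.:= c) refl b c)
    (ℚ.+-monoˡ-≤ (ℚ.- b) h)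

  -≤⇒≤+ : ∀ {a b c} → a ℚ.- b ℚ.≤ c → a ℚ.≤ b ℚ.+ c
  -≤⇒≤+ {a} {b} {c} h = subst₂ ℚ._≤_
    (Q.solve 2 (λ a b → b Q.:+ (a Q.:- b) Q.:= a) refl a b) refl
    (ℚ.+-monoʳ-≤ b h)

  dist≤ : ∀ {a b c} → a ℚ.≤ b ℚ.+ c → b ℚ.≤ a ℚ.+ c → ℚ.∣ a ℚ.- b ∣ ℚ.≤ c
  dist≤ {a} {b} {c} a≤ b≤ = abs≤ (≤+⇒-≤ a≤)
    (subst (ℚ._≤ c) (Q.solve 2 (λ a b → b Q.:- a Q.:= Q.:- (a Q.:- b)) refl a b) (≤+⇒-≤ b≤))

  dist≤⇒≤+ : ∀ {a b c} → ℚ.∣ a ℚ.- b ∣ ℚ.≤ c → a ℚ.≤ b ℚ.+ c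
  dist≤⇒≤+ {a} {b} h = -≤⇒≤+ (ℚ.≤-trans (p≤∣p∣ (a ℚ.- b)) h)

  sq-cancel-≤ : ∀ {a b} → 0ℚ ℚ.≤ b → a ℚ.* a ℚ.≤ b ℚ.* b → a ℚ.≤ b
  sq-cancel-≤ {a} {b} 0≤b a²≤b² with a ℚ.≤? b
  ... | yes a≤b = a≤b
  ... | no a≰b = contradiction a²≤b² (λ h → ℚ.<-irrefl refl (ℚ.<-≤-trans b²<a² h))
    where
    b<a = ℚ.≰⇒> a≰b
    b²<a² : b ℚ.* b ℚ.< a ℚ.* a
    b²<a² = ℚ.≤-<-trans
      (ℚ.*-monoˡ-≤-nonNeg b {{nonneg 0≤b}} (ℚ.<⇒≤ b<a))
      (ℚ.*-monoˡ-<-pos a {{pos (ℚ.≤-<-trans 0≤b b<a)}} b<a)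

------------------------------------------------------------------------
-- Real numbers: Cauchy sequences of rationals, with pointwise operations.
-- The underlying type is a setoid under _≈ᴿ_, not a quotient.

IsCauchy : (ℕ → ℚ) → Set
IsCauchy x = ∀ ε → 0ℚ ℚ.< ε →
  ∃[ N ] (∀ m n → N ℕ.≤ m → N ℕ.≤ n → ℚ.∣ x m ℚ.- x n ∣ ℚ.≤ ε)

record ℝ : Set where
  constructor mkℝ
  field
    seq    : ℕ → ℚ
    cauchy : IsCauchy seq

open ℝ public

infix 4 _≈ᴿ_ _≤ᴿ_

_≈ᴿ_ : ℝ → ℝ → Set
x ≈ᴿ y = ∀ ε → 0ℚ ℚ.< ε →
  ∃[ N ] (∀ n → N ℕ.≤ n → ℚ.∣ seq x n ℚ.- seq y n ∣ ℚ.≤ ε)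

_≤ᴿ_ : ℝ → ℝ → Set
x ≤ᴿ y = ∀ ε → 0ℚ ℚ.< ε →
  ∃[ N ] (∀ n → N ℕ.≤ n → seq x n ℚ.≤ seq y n ℚ.+ ε)

fromℚ : ℚ → ℝ
fromℚ p = mkℝ (λ _ → p) λ ε 0<ε → 0 , λ _ _ _ _ →
  subst (λ d → ℚ.∣ d ∣ ℚ.≤ ε) (sym (ℚ.+-inverseʳ p)) (ℚ.<⇒≤ 0<ε)

fromℕ : ℕ → ℝ
fromℕ n = fromℚ (+ n ℚ./ 1)

0ᴿ 1ᴿ : ℝ
0ᴿ = fromℚ 0ℚ
1ᴿ = fromℚ 1ℚ

infixl 6 _+ᴿ_
infixl 7 _*ᴿ_
infix  8 -ᴿ_

private
  +-dist : ∀ {a b c d ε} → ℚ.∣ a ℚ.- c ∣ ℚ.≤ half ε → ℚ.∣ b ℚ.- d ∣ ℚ.≤ half ε →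
           ℚ.∣ (a ℚ.+ b) ℚ.- (c ℚ.+ d) ∣ ℚ.≤ ε
  +-dist {a} {b} {c} {d} {ε} h₁ h₂ = Q.begin
    ℚ.∣ (a ℚ.+ b) ℚ.- (c ℚ.+ d) ∣          Q.≡⟨ cong ℚ.∣_∣ (Q.solve 4
      (λ a b c d → (a Q.:+ b) Q.:- (c Q.:+ d) Q.:= (a Q.:- c) Q.:+ (b Q.:- d)) refl a b c d) ⟩
    ℚ.∣ (a ℚ.- c) ℚ.+ (b ℚ.- d) ∣          Q.≤⟨ ℚ.∣p+q∣≤∣p∣+∣q∣ (a ℚ.- c) (b ℚ.- d) ⟩
    ℚ.∣ a ℚ.- c ∣ ℚ.+ ℚ.∣ b ℚ.- d ∣        Q.≤⟨ ℚ.+-mono-≤ h₁ h₂ ⟩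
    half ε ℚ.+ half ε                      Q.≡⟨ half+half ε ⟩
    ε                                      Q.∎

  neg-dist : ∀ a b → ℚ.∣ (ℚ.- a) ℚ.- (ℚ.- b) ∣ ≡ ℚ.∣ a ℚ.- b ∣
  neg-dist a b = trans
    (cong ℚ.∣_∣ (Q.solve 2 (λ a b → (Q.:- a) Q.:- (Q.:- b) Q.:= Q.:- (a Q.:- b)) refl a b))
    (ℚ.∣-p∣≡∣p∣ (a ℚ.- b))

  near-bound : ∀ {a b c} → ℚ.∣ a ℚ.- b ∣ ℚ.≤ c → ℚ.∣ a ∣ ℚ.≤ ℚ.∣ b ∣ ℚ.+ c
  near-bound {a} {b} {c} h = Q.begin
    ℚ.∣ a ∣                       Q.≡⟨ cong ℚ.∣_∣ (Q.solve 2
      (λ a b → a Q.:= b Q.:+ (a Q.:- b)) refl a b) ⟩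
    ℚ.∣ b ℚ.+ (a ℚ.- b) ∣         Q.≤⟨ ℚ.∣p+q∣≤∣p∣+∣q∣ b (a ℚ.- b) ⟩
    ℚ.∣ b ∣ ℚ.+ ℚ.∣ a ℚ.- b ∣     Q.≤⟨ ℚ.+-monoʳ-≤ ℚ.∣ b ∣ h ⟩
    ℚ.∣ b ∣ ℚ.+ c                 Q.∎

  *-dist : ∀ {a b c d B₁ B₂ η₁ η₂ ε} → 0ℚ ℚ.≤ B₁ → 0ℚ ℚ.≤ B₂ →
           ℚ.∣ a ∣ ℚ.≤ B₁ → ℚ.∣ d ∣ ℚ.≤ B₂ →
           ℚ.∣ b ℚ.- d ∣ ℚ.≤ η₁ → ℚ.∣ a ℚ.- c ∣ ℚ.≤ η₂ →
           B₁ ℚ.* η₁ ℚ.≤ half ε → B₂ ℚ.* η₂ ℚ.≤ half ε →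
           ℚ.∣ a ℚ.* b ℚ.- c ℚ.* d ∣ ℚ.≤ ε
  *-dist {a} {b} {c} {d} {B₁} {B₂} {η₁} {η₂} {ε} 0≤B₁ 0≤B₂ a≤ d≤ h₁ h₂ k₁ k₂ = Q.begin
    ℚ.∣ a ℚ.* b ℚ.- c ℚ.* d ∣
      Q.≡⟨ cong ℚ.∣_∣ (Q.solve 4 (λ a b c d →
             a Q.:* b Q.:- c Q.:* d Q.:= a Q.:* (b Q.:- d) Q.:+ d Q.:* (a Q.:- c)) refl a b c d) ⟩
    ℚ.∣ a ℚ.* (b ℚ.- d) ℚ.+ d ℚ.* (a ℚ.- c) ∣
      Q.≤⟨ ℚ.∣p+q∣≤∣p∣+∣q∣ (a ℚ.* (b ℚ.- d)) (d ℚ.* (a ℚ.- c)) ⟩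
    ℚ.∣ a ℚ.* (b ℚ.- d) ∣ ℚ.+ ℚ.∣ d ℚ.* (a ℚ.- c) ∣
      Q.≡⟨ cong₂ ℚ._+_ (ℚ.∣p*q∣≡∣p∣*∣q∣ a (b ℚ.- d)) (ℚ.∣p*q∣≡∣p∣*∣q∣ d (a ℚ.- c)) ⟩
    ℚ.∣ a ∣ ℚ.* ℚ.∣ b ℚ.- d ∣ ℚ.+ ℚ.∣ d ∣ ℚ.* ℚ.∣ a ℚ.- c ∣
      Q.≤⟨ ℚ.+-mono-≤ (*-mono (ℚ.0≤∣p∣ (b ℚ.- d)) 0≤B₁ a≤ h₁) (*-mono (ℚ.0≤∣p∣ (a ℚ.- c)) 0≤B₂ d≤ h₂) ⟩
    B₁ ℚ.* η₁ ℚ.+ B₂ ℚ.* η₂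
      Q.≤⟨ ℚ.+-mono-≤ k₁ k₂ ⟩
    half ε ℚ.+ half ε
      Q.≡⟨ half+half ε ⟩
    ε Q.∎

EventuallyBounded : (ℕ → ℚ) → Set
EventuallyBounded x = ∃[ B ] 0ℚ ℚ.≤ B × (∃[ N ] (∀ n → N ℕ.≤ n → ℚ.∣ x n ∣ ℚ.≤ B))

abstract
  +-cauchy : ∀ {x y} → IsCauchy x → IsCauchy y → IsCauchy (λ n → x n ℚ.+ y n)
  +-cauchy {x} {y} cx cy ε 0<ε with cx (half ε) (half-pos 0<ε) | cy (half ε) (half-pos 0<ε)
  ... | N₁ , h₁ | N₂ , h₂ = N₁ ℕ.⊔ N₂ , λ m n N≤m N≤n → +-dist {x m} {y m} {x n} {y n}
    (h₁ m n (ℕ.m⊔n≤o⇒m≤o N₁ N₂ N≤m) (ℕ.m⊔n≤o⇒m≤o N₁ N₂ N≤n))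
    (h₂ m n (ℕ.m⊔n≤o⇒n≤o N₁ N₂ N≤m) (ℕ.m⊔n≤o⇒n≤o N₁ N₂ N≤n))

  neg-cauchy : ∀ {x} → IsCauchy x → IsCauchy (λ n → ℚ.- x n)
  neg-cauchy {x} cx ε 0<ε with cx ε 0<ε
  ... | N , h = N , λ m n N≤m N≤n →
    subst (ℚ._≤ ε) (sym (neg-dist (x m) (x n))) (h m n N≤m N≤n)

  cauchy⇒bounded : ∀ {x} → IsCauchy x → EventuallyBounded x
  cauchy⇒bounded {x} cx with cx 1ℚ (ℚ.positive⁻¹ 1ℚ)
  ... | N , h = ℚ.∣ x N ∣ ℚ.+ 1ℚ
    , +-nonneg (ℚ.0≤∣p∣ (x N)) (ℚ.nonNegative⁻¹ 1ℚ)
    , N , λ n N≤n → near-bound {x n} {x N} (h n N N≤n ℕ.≤-refl)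

  *-cauchy : ∀ {x y} → IsCauchy x → IsCauchy y → IsCauchy (λ n → x n ℚ.* y n)
  *-cauchy {x} {y} cx cy ε 0<ε = go (cauchy⇒bounded {x} cx) (cauchy⇒bounded {y} cy)
    where
    Goal : Set
    Goal = ∃[ N ] (∀ m n → N ℕ.≤ m → N ℕ.≤ n → ℚ.∣ x m ℚ.* y m ℚ.- x n ℚ.* y n ∣ ℚ.≤ ε)

    Scaled : ℚ → Set
    Scaled B = ∃[ η ] 0ℚ ℚ.< η × B ℚ.* η ℚ.≤ half ε

    go : EventuallyBounded x → EventuallyBounded y → Goal
    go (B₁ , 0≤B₁ , N₁ , b₁) (B₂ , 0≤B₂ , N₂ , b₂) =
      go′ (scaled {B₁} {half ε} 0≤B₁ (half-pos 0<ε)) (scaled {B₂} {half ε} 0≤B₂ (half-pos 0<ε))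
      where
      go′ : Scaled B₁ → Scaled B₂ → Goal
      go′ (η₁ , 0<η₁ , k₁) (η₂ , 0<η₂ , k₂) = N₁₂ ℕ.⊔ N₃₄ , λ m n N≤m N≤n →
        *-dist {x m} {y m} {x n} {y n} {B₁} {B₂} {η₁} {η₂} {ε} 0≤B₁ 0≤B₂
          (b₁ m (ℕ.m⊔n≤o⇒m≤o N₁ N₂ (l N≤m)))
          (b₂ n (ℕ.m⊔n≤o⇒n≤o N₁ N₂ (l N≤n)))
          (proj₂ (cy η₁ 0<η₁) m n (ℕ.m⊔n≤o⇒m≤o N₃ N₄ (r N≤m)) (ℕ.m⊔n≤o⇒m≤o N₃ N₄ (r N≤n)))
          (proj₂ (cx η₂ 0<η₂) m n (ℕ.m⊔n≤o⇒n≤o N₃ N₄ (r N≤m)) (ℕ.m⊔n≤o⇒n≤o N₃ N₄ (r N≤n)))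
          k₁ k₂
        where
        N₃ N₄ N₁₂ N₃₄ : ℕ
        N₃ = proj₁ (cy η₁ 0<η₁)
        N₄ = proj₁ (cx η₂ 0<η₂)
        N₁₂ = N₁ ℕ.⊔ N₂
        N₃₄ = N₃ ℕ.⊔ N₄
        l : ∀ {k} → N₁₂ ℕ.⊔ N₃₄ ℕ.≤ k → N₁₂ ℕ.≤ k
        l = ℕ.m⊔n≤o⇒m≤o N₁₂ N₃₄
        r : ∀ {k} → N₁₂ ℕ.⊔ N₃₄ ℕ.≤ k → N₃₄ ℕ.≤ k
        r = ℕ.m⊔n≤o⇒n≤o N₁₂ N₃₄

_+ᴿ_ : ℝ → ℝ → ℝ
x +ᴿ y = mkℝ (λ n → seq x n ℚ.+ seq y n) (+-cauchy {seq x} {seq y} (cauchy x) (cauchy y))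

-ᴿ_ : ℝ → ℝ
-ᴿ x = mkℝ (λ n → ℚ.- seq x n) (neg-cauchy {seq x} (cauchy x))

_*ᴿ_ : ℝ → ℝ → ℝ
x *ᴿ y = mkℝ (λ n → seq x n ℚ.* seq y n) (*-cauchy {seq x} {seq y} (cauchy x) (cauchy y))

ℝ-rawRing : RawRing 0ℓ 0ℓ
ℝ-rawRing = record
  { Carrier = ℝ
  ; _≈_ = _≈ᴿ_
  ; _+_ = _+ᴿ_
  ; _*_ = _*ᴿ_
  ; -_  = -ᴿ_
  ; 0#  = 0ᴿ
  ; 1#  = 1ᴿ
  }

------------------------------------------------------------------------
-- Square root

open RawMonoidDefs ℚ.+-0-rawMonoid using () renaming (_×_ to _·_)

mesh : ℕ → ℚ
mesh k = + 1 ℚ./ suc k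

-- The largest multiple j δ of δ with j ≤ M and (j δ)² ≤ p; it is 0 if p < 0.
sqrtOnGrid : (δ p : ℚ) (M : ℕ) → ℚ
sqrtOnGrid δ p zero = 0ℚ
sqrtOnGrid δ p (suc j) with (suc j · δ) ℚ.* (suc j · δ) ℚ.≤? p
... | yes _ = suc j · δ
... | no  _ = sqrtOnGrid δ p j

-- The grid of step 1/(k+1) is searched up to |numerator of p| ≥ √p, so for
-- p ≥ 0 the result is the largest multiple of 1/(k+1) not exceeding √p.
sqrtApprox : ℕ → ℚ → ℚ
sqrtApprox k p = sqrtOnGrid (mesh k) p (ℤ.∣ ℚ.↥ p ∣ ℕ.* suc k)

private
  toℚ : ℕ → ℚ
  toℚ n = + n ℚ./ 1

  toℚ-suc : ∀ n → toℚ (suc n) ≡ 1ℚ ℚ.+ toℚ n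
  toℚ-suc n = ℚ.toℚᵘ-injective (ℚᵘ.≃-trans (ℚ.toℚᵘ-fromℚᵘ (ℚᵘ.mkℚᵘ (+ suc n) 0))
    (ℚᵘ.≃-trans
      (ℚᵘ.*≡* (trans (ℤ.*-identityʳ (+ suc n))
        (sym (trans (ℤ.*-identityʳ _) (cong (λ i → + 1 ℤ.+ i) (ℤ.*-identityʳ (+ n)))))))
      (ℚᵘ.≃-sym (ℚᵘ.≃-trans (ℚ.toℚᵘ-homo-+ 1ℚ (toℚ n))
        (ℚᵘ.+-congʳ ℚᵘ.1ℚᵘ (ℚ.toℚᵘ-fromℚᵘ (ℚᵘ.mkℚᵘ (+ n) 0)))))))

  ·-toℚ : ∀ n p → n · p ≡ toℚ n ℚ.* p
  ·-toℚ zero p = sym (ℚ.*-zeroˡ p)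
  ·-toℚ (suc n) p = trans (cong (p ℚ.+_) (·-toℚ n p))
    (sym (trans (cong (ℚ._* p) (toℚ-suc n))
      (trans (ℚ.*-distribʳ-+ p 1ℚ (toℚ n)) (cong (ℚ._+ toℚ n ℚ.* p) (ℚ.*-identityˡ p)))))

  ·-* : ∀ m n p → (m ℕ.* n) · p ≡ m · (n · p)
  ·-* zero n p = refl
  ·-* (suc m) n p = trans (·-+ n (m ℕ.* n)) (cong (n · p ℚ.+_) (·-* m n p))
    where
    ·-+ : ∀ a b → (a ℕ.+ b) · p ≡ a · p ℚ.+ b · p
    ·-+ zero b = sym (ℚ.+-identityˡ (b · p))
    ·-+ (suc a) b = trans (cong (p ℚ.+_) (·-+ a b)) (sym (ℚ.+-assoc p (a · p) (b · p)))

  mesh-inverse : ∀ k → suc k · mesh k ≡ 1ℚ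
  mesh-inverse k = trans (·-toℚ (suc k) (mesh k)) (ℚ.toℚᵘ-injective
    (ℚᵘ.≃-trans (ℚ.toℚᵘ-homo-* (toℚ (suc k)) (mesh k))
    (ℚᵘ.≃-trans (ℚᵘ.*-cong (ℚ.toℚᵘ-fromℚᵘ (ℚᵘ.mkℚᵘ (+ suc k) 0)) (ℚ.toℚᵘ-fromℚᵘ (ℚᵘ.mkℚᵘ (+ 1) k)))
      (ℚᵘ.*≡* (trans (ℤ.*-identityʳ _) (trans (ℤ.*-identityʳ (+ suc k))
        (trans (cong ℤ.+_ (sym (ℕ.+-identityʳ (suc k)))) (sym (ℤ.*-identityˡ _)))))))))

  mesh-pos : ∀ k → 0ℚ ℚ.< mesh k
  mesh-pos k = ℚ.positive⁻¹ _ {{ℚ.normalize-pos 1 (suc k)}}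

  mesh-anti : ∀ {j k} → j ℕ.≤ k → mesh k ℚ.≤ mesh j
  mesh-anti {j} {k} j≤k = ℚ.toℚᵘ-cancel-≤ (ℚᵘ.≤-respˡ-≃
    (ℚᵘ.≃-sym (ℚ.toℚᵘ-fromℚᵘ (ℚᵘ.mkℚᵘ (+ 1) k))) (ℚᵘ.≤-respʳ-≃
    (ℚᵘ.≃-sym (ℚ.toℚᵘ-fromℚᵘ (ℚᵘ.mkℚᵘ (+ 1) j)))
    (ℚᵘ.*≤* (ℤ.*-monoˡ-≤-nonNeg (+ 1) (ℤ.+≤+ (s≤s j≤k))))))

mesh→0 : ∀ ε → 0ℚ ℚ.< ε → ∃[ N ] (∀ n → N ℕ.≤ n → mesh n ℚ.≤ ε)
mesh→0 ε 0<ε with ε in eq | pos 0<ε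
... | mkℚ +[1+ a ] d _ | _ = d , λ n d≤n → ℚ.≤-trans (mesh-anti d≤n)
  (ℚ.toℚᵘ-cancel-≤ (ℚᵘ.≤-respˡ-≃ (ℚᵘ.≃-sym (ℚ.toℚᵘ-fromℚᵘ (ℚᵘ.mkℚᵘ (+ 1) d)))
    (ℚᵘ.*≤* (ℤ.*-monoʳ-≤-nonNeg (+ suc d) (ℤ.+≤+ {1} {suc a} (s≤s z≤n))))))

private
  ·-nonneg : ∀ j {δ} → 0ℚ ℚ.≤ δ → 0ℚ ℚ.≤ j · δ
  ·-nonneg zero 0≤δ = ℚ.≤-refl
  ·-nonneg (suc j) 0≤δ = +-nonneg 0≤δ (·-nonneg j 0≤δ)

  grid-nonneg : ∀ {δ} p M → 0ℚ ℚ.≤ δ → 0ℚ ℚ.≤ sqrtOnGrid δ p M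
  grid-nonneg p zero 0≤δ = ℚ.≤-refl
  grid-nonneg {δ} p (suc j) 0≤δ with (suc j · δ) ℚ.* (suc j · δ) ℚ.≤? p
  ... | yes _ = ·-nonneg (suc j) 0≤δ
  ... | no _ = grid-nonneg p j 0≤δ

  grid-lower : ∀ δ p M → sqrtOnGrid δ p M ≡ 0ℚ ⊎ sqrtOnGrid δ p M ℚ.* sqrtOnGrid δ p M ℚ.≤ p
  grid-lower δ p zero = inj₁ refl
  grid-lower δ p (suc j) with (suc j · δ) ℚ.* (suc j · δ) ℚ.≤? p
  ... | yes h = inj₂ h
  ... | no _ = grid-lower δ p j

  grid-upper : ∀ δ p M → p ℚ.< (suc M · δ) ℚ.* (suc M · δ) →
    p ℚ.< (δ ℚ.+ sqrtOnGrid δ p M) ℚ.* (δ ℚ.+ sqrtOnGrid δ p M)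
  grid-upper δ p zero h = h
  grid-upper δ p (suc j) h with (suc j · δ) ℚ.* (suc j · δ) ℚ.≤? p
  ... | yes _ = h
  ... | no ¬h = grid-upper δ p j (ℚ.≰⇒> ¬h)

  ≤toℚ∣↥∣ : ∀ p → p ℚ.≤ toℚ ℤ.∣ ℚ.↥ p ∣
  ≤toℚ∣↥∣ p@(mkℚ n d _) = ℚ.toℚᵘ-cancel-≤ (ℚᵘ.≤-respʳ-≃
    (ℚᵘ.≃-sym (ℚ.toℚᵘ-fromℚᵘ (ℚᵘ.mkℚᵘ (+ ℤ.∣ n ∣) 0)))
    (ℚᵘ.*≤* (ℤ.≤-trans (ℤ.≤-reflexive (ℤ.*-identityʳ n))
      (ℤ.≤-trans (i≤∣i∣ n) (subst (+ ℤ.∣ n ∣ ℤ.≤_) (ℤ.pos-* ℤ.∣ n ∣ (suc d))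
        (ℤ.+≤+ (ℕ.m≤m*n ℤ.∣ n ∣ (suc d))))))))
    where
    i≤∣i∣ : ∀ i → i ℤ.≤ + ℤ.∣ i ∣
    i≤∣i∣ (+ _) = ℤ.≤-refl
    i≤∣i∣ ℤ.-[1+ _ ] = ℤ.-≤+

  toℚ≤sq : ∀ n → toℚ n ℚ.≤ toℚ n ℚ.* toℚ n
  toℚ≤sq zero = ℚ.≤-refl
  toℚ≤sq (suc n) = Q.begin
    toℚ (suc n)                      Q.≡⟨ ℚ.*-identityˡ (toℚ (suc n)) ⟨
    1ℚ ℚ.* toℚ (suc n)               Q.≤⟨ ℚ.*-monoʳ-≤-nonNeg (toℚ (suc n)) {{ℚ.normalize-nonNeg (suc n) 1}} 1≤ ⟩
    toℚ (suc n) ℚ.* toℚ (suc n)      Q.∎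
    where
    1≤ : 1ℚ ℚ.≤ toℚ (suc n)
    1≤ = subst₂ ℚ._≤_ (ℚ.+-identityʳ 1ℚ) (sym (toℚ-suc n))
      (ℚ.+-monoʳ-≤ 1ℚ (ℚ.nonNegative⁻¹ (toℚ n) {{ℚ.normalize-nonNeg n 1}}))

sqrtApprox-nonneg : ∀ k p → 0ℚ ℚ.≤ sqrtApprox k p
sqrtApprox-nonneg k p = grid-nonneg p (ℤ.∣ ℚ.↥ p ∣ ℕ.* suc k) (ℚ.<⇒≤ (mesh-pos k))

sqrtApprox-lower : ∀ k p →
  sqrtApprox k p ≡ 0ℚ ⊎ sqrtApprox k p ℚ.* sqrtApprox k p ℚ.≤ p
sqrtApprox-lower k p = grid-lower (mesh k) p (ℤ.∣ ℚ.↥ p ∣ ℕ.* suc k)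

sqrtApprox-upper : ∀ k p →
  p ℚ.< (mesh k ℚ.+ sqrtApprox k p) ℚ.* (mesh k ℚ.+ sqrtApprox k p)
sqrtApprox-upper k p = grid-upper (mesh k) p (a ℕ.* suc k)
  (subst (λ v → p ℚ.< (mesh k ℚ.+ v) ℚ.* (mesh k ℚ.+ v)) (sym top) p<)
  where
  a = ℤ.∣ ℚ.↥ p ∣
  A = toℚ a
  0≤A : 0ℚ ℚ.≤ A
  0≤A = ℚ.nonNegative⁻¹ A {{ℚ.normalize-nonNeg a 1}}
  top : (a ℕ.* suc k) · mesh k ≡ A
  top = trans (·-* a (suc k) (mesh k)) (trans (cong (a ·_) (mesh-inverse k))
    (trans (·-toℚ a 1ℚ) (ℚ.*-identityʳ A)))
  δ = mesh k
  p< : p ℚ.< (δ ℚ.+ A) ℚ.* (δ ℚ.+ A)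
  p< = Q.begin-strict
    p                                              Q.≤⟨ ≤toℚ∣↥∣ p ⟩
    A                                              Q.≤⟨ toℚ≤sq a ⟩
    A ℚ.* A                                        Q.≡⟨ ℚ.+-identityʳ (A ℚ.* A) ⟨
    A ℚ.* A ℚ.+ 0ℚ                                 Q.<⟨ ℚ.+-monoʳ-< (A ℚ.* A)
        (+-pos (*-nonneg (+-nonneg 0≤A 0≤A) (ℚ.<⇒≤ (mesh-pos k))) (*-pos (mesh-pos k) (mesh-pos k))) ⟩
    A ℚ.* A ℚ.+ ((A ℚ.+ A) ℚ.* δ ℚ.+ δ ℚ.* δ)      Q.≡⟨ Q.solve 2
        (λ A δ → A Q.:* A Q.:+ ((A Q.:+ A) Q.:* δ Q.:+ δ Q.:* δ) Q.:= (δ Q.:+ A) Q.:* (δ Q.:+ A))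
        refl A δ ⟩
    (δ ℚ.+ A) ℚ.* (δ ℚ.+ A)                        Q.∎

private
  sqrt-close : ∀ {η} k x y f → 0ℚ ℚ.< η → mesh k ℚ.≤ η →
    f ≡ 0ℚ ⊎ f ℚ.* f ℚ.≤ x → x ℚ.≤ y ℚ.+ η ℚ.* η →
    f ℚ.≤ sqrtApprox k y ℚ.+ (η ℚ.+ η)
  sqrt-close {η} k x y f 0<η δ≤η low x≤ = go low
    where
    g = sqrtApprox k y
    0≤g = sqrtApprox-nonneg k y
    0≤η = ℚ.<⇒≤ 0<η
    s = (η ℚ.+ g) ℚ.* (η ℚ.+ g) ℚ.+ η ℚ.* η
    0≤g+2η : 0ℚ ℚ.≤ g ℚ.+ (η ℚ.+ η)
    0≤g+2η = +-nonneg 0≤g (+-nonneg 0≤η 0≤η)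
    δ+g≤ : mesh k ℚ.+ g ℚ.≤ η ℚ.+ g
    δ+g≤ = ℚ.+-monoˡ-≤ g δ≤η
    go : f ≡ 0ℚ ⊎ f ℚ.* f ℚ.≤ x → f ℚ.≤ g ℚ.+ (η ℚ.+ η)
    go (inj₁ refl) = 0≤g+2η
    go (inj₂ f²≤x) = sq-cancel-≤ 0≤g+2η (Q.begin
      f ℚ.* f                                        Q.≤⟨ f²≤x ⟩
      x                                              Q.≤⟨ x≤ ⟩
      y ℚ.+ η ℚ.* η                                  Q.≤⟨ ℚ.+-monoˡ-≤ (η ℚ.* η)
        (ℚ.≤-trans (ℚ.<⇒≤ (sqrtApprox-upper k y))
          (*-mono (+-nonneg (ℚ.<⇒≤ (mesh-pos k)) 0≤g) (+-nonneg 0≤η 0≤g) δ+g≤ δ+g≤)) ⟩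
      (η ℚ.+ g) ℚ.* (η ℚ.+ g) ℚ.+ η ℚ.* η            Q.≡⟨ ℚ.+-identityʳ s ⟨
      (η ℚ.+ g) ℚ.* (η ℚ.+ g) ℚ.+ η ℚ.* η ℚ.+ 0ℚ     Q.≤⟨ ℚ.+-monoʳ-≤ s
        (*-nonneg (+-nonneg 0≤η 0≤η) (+-nonneg 0≤η 0≤g)) ⟩
      (η ℚ.+ g) ℚ.* (η ℚ.+ g) ℚ.+ η ℚ.* η ℚ.+ (η ℚ.+ η) ℚ.* (η ℚ.+ g)
        Q.≡⟨ Q.solve 2 (λ η g →
              (η Q.:+ g) Q.:* (η Q.:+ g) Q.:+ η Q.:* η Q.:+ (η Q.:+ η) Q.:* (η Q.:+ g)
              Q.:= (g Q.:+ (η Q.:+ η)) Q.:* (g Q.:+ (η Q.:+ η))) refl η g ⟩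
      (g ℚ.+ (η ℚ.+ η)) ℚ.* (g ℚ.+ (η ℚ.+ η))        Q.∎)

  square-upper : ∀ {f δ η x B ε} → 0ℚ ℚ.≤ B → 0ℚ ℚ.≤ δ → f ℚ.≤ B → δ ℚ.≤ 1ℚ → δ ℚ.≤ η →
    (B ℚ.+ B ℚ.+ 1ℚ) ℚ.* η ℚ.≤ ε → x ℚ.< (δ ℚ.+ f) ℚ.* (δ ℚ.+ f) → x ℚ.≤ f ℚ.* f ℚ.+ ε
  square-upper {f} {δ} {η} {x} {B} {ε} 0≤B 0≤δ f≤B δ≤1 δ≤η C≤ε x< = Q.begin
    x                                          Q.≤⟨ ℚ.<⇒≤ x< ⟩
    (δ ℚ.+ f) ℚ.* (δ ℚ.+ f)                    Q.≡⟨ Q.solve 2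
      (λ δ f → (δ Q.:+ f) Q.:* (δ Q.:+ f) Q.:= f Q.:* f Q.:+ (f Q.:+ f Q.:+ δ) Q.:* δ) refl δ f ⟩
    f ℚ.* f ℚ.+ (f ℚ.+ f ℚ.+ δ) ℚ.* δ          Q.≤⟨ ℚ.+-monoʳ-≤ (f ℚ.* f)
      (ℚ.≤-trans (*-mono 0≤δ (+-nonneg (+-nonneg 0≤B 0≤B) (ℚ.nonNegative⁻¹ 1ℚ))
        (ℚ.+-mono-≤ (ℚ.+-mono-≤ f≤B f≤B) δ≤1) δ≤η) C≤ε) ⟩
    f ℚ.* f ℚ.+ ε                              Q.∎

  square-lower : ∀ {f x ε} → 0ℚ ℚ.< ε → f ≡ 0ℚ ⊎ f ℚ.* f ℚ.≤ x → 0ℚ ℚ.≤ x ℚ.+ ε →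
    f ℚ.* f ℚ.≤ x ℚ.+ ε
  square-lower 0<ε (inj₁ refl) h = h
  square-lower {f} {x} {ε} 0<ε (inj₂ f²≤) h = subst (ℚ._≤ x ℚ.+ ε) (ℚ.+-identityʳ (f ℚ.* f))
    (ℚ.+-mono-≤ f²≤ (ℚ.<⇒≤ 0<ε))

abstract
  √-cauchy : ∀ {x} → IsCauchy x → IsCauchy (λ k → sqrtApprox k (x k))
  √-cauchy {x} cx ε 0<ε = N , λ m n N≤m N≤n →
    dist≤ {sqrtApprox m (x m)} {sqrtApprox n (x n)} {ε}
      (one-sided m n N≤m N≤n) (one-sided n m N≤n N≤m)
    where
    η : ℚ
    η = half ε
    0<η : 0ℚ ℚ.< η
    0<η = half-pos 0<ε
    0<η² : 0ℚ ℚ.< η ℚ.* η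
    0<η² = *-pos 0<η 0<η
    N₁ N₂ N : ℕ
    N₁ = proj₁ (cx (η ℚ.* η) 0<η²)
    N₂ = proj₁ (mesh→0 η 0<η)
    N = N₁ ℕ.⊔ N₂
    one-sided : ∀ m n → N ℕ.≤ m → N ℕ.≤ n →
      sqrtApprox m (x m) ℚ.≤ sqrtApprox n (x n) ℚ.+ ε
    one-sided m n N≤m N≤n = subst
      (λ e → sqrtApprox m (x m) ℚ.≤ sqrtApprox n (x n) ℚ.+ e) (half+half ε)
      (sqrt-close {η} n (x m) (x n) (sqrtApprox m (x m)) 0<η
        (proj₂ (mesh→0 η 0<η) n (ℕ.m⊔n≤o⇒n≤o N₁ N₂ N≤n))
        (sqrtApprox-lower m (x m))
        (dist≤⇒≤+ {x m} {x n} {η ℚ.* η} (proj₂ (cx (η ℚ.* η) 0<η²) m n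
          (ℕ.m⊔n≤o⇒m≤o N₁ N₂ N≤m) (ℕ.m⊔n≤o⇒m≤o N₁ N₂ N≤n))))

infix 8 √_

-- Total square root; a negative argument is sent to 0.
√_ : ℝ → ℝ
√ x = mkℝ (λ k → sqrtApprox k (seq x k)) (√-cauchy {seq x} (cauchy x))

√-nonneg : ∀ x → 0ᴿ ≤ᴿ √ x
√-nonneg x ε 0<ε = 0 , λ n _ → +-nonneg (sqrtApprox-nonneg n (seq x n)) (ℚ.<⇒≤ 0<ε)

abstract
  √-square : ∀ x → 0ᴿ ≤ᴿ x → √ x *ᴿ √ x ≈ᴿ x
  √-square x 0≤x ε 0<ε = go (cauchy⇒bounded {seq (√ x)} (cauchy (√ x)))
    where
    f : ℕ → ℚ
    f n = sqrtApprox n (seq x n)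

    Goal : Set
    Goal = ∃[ N ] (∀ n → N ℕ.≤ n → ℚ.∣ f n ℚ.* f n ℚ.- seq x n ∣ ℚ.≤ ε)

    go : EventuallyBounded f → Goal
    go (B , 0≤B , N₁ , b) = go′ (scaled {C} {ε}
        (+-nonneg {B ℚ.+ B} (+-nonneg {B} 0≤B 0≤B) (ℚ.nonNegative⁻¹ 1ℚ)) 0<ε)
      where
      C : ℚ
      C = B ℚ.+ B ℚ.+ 1ℚ

      go′ : (∃[ η ] 0ℚ ℚ.< η × C ℚ.* η ℚ.≤ ε) → Goal
      go′ (η , 0<η , Cη≤ε) = N₁₂ ℕ.⊔ N₃₄ , λ n N≤n →
        dist≤ {f n ℚ.* f n} {seq x n} {ε}
          (square-lower {f n} {seq x n} {ε} 0<ε (sqrtApprox-lower n (seq x n))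
            (proj₂ (0≤x ε 0<ε) n (ℕ.m⊔n≤o⇒n≤o N₃ N₄ (r N≤n))))
          (square-upper {f n} {mesh n} {η} {seq x n} {B} {ε} 0≤B (ℚ.<⇒≤ (mesh-pos n))
            (ℚ.≤-trans (p≤∣p∣ (f n)) (b n (ℕ.m⊔n≤o⇒m≤o N₁ N₂ (l N≤n))))
            (proj₂ (mesh→0 1ℚ (ℚ.positive⁻¹ 1ℚ)) n (ℕ.m⊔n≤o⇒m≤o N₃ N₄ (r N≤n)))
            (proj₂ (mesh→0 η 0<η) n (ℕ.m⊔n≤o⇒n≤o N₁ N₂ (l N≤n)))
            Cη≤ε (sqrtApprox-upper n (seq x n)))
        where
        N₂ N₃ N₄ N₁₂ N₃₄ : ℕ
        N₂ = proj₁ (mesh→0 η 0<η)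
        N₃ = proj₁ (mesh→0 1ℚ (ℚ.positive⁻¹ 1ℚ))
        N₄ = proj₁ (0≤x ε 0<ε)
        N₁₂ = N₁ ℕ.⊔ N₂
        N₃₄ = N₃ ℕ.⊔ N₄
        l : ∀ {k} → N₁₂ ℕ.⊔ N₃₄ ℕ.≤ k → N₁₂ ℕ.≤ k
        l = ℕ.m⊔n≤o⇒m≤o N₁₂ N₃₄
        r : ∀ {k} → N₁₂ ℕ.⊔ N₃₄ ℕ.≤ k → N₃₄ ℕ.≤ k
        r = ℕ.m⊔n≤o⇒n≤o N₁₂ N₃₄

------------------------------------------------------------------------
-- Complex numbers

record ℂ : Set where
  constructor _+i_
  field
    re : ℝ
    im : ℝ

open ℂ public

infix 4 _≈ᶜ_

_≈ᶜ_ : ℂ → ℂ → Set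
z ≈ᶜ w = re z ≈ᴿ re w × im z ≈ᴿ im w

0ᶜ 1ᶜ : ℂ
0ᶜ = 0ᴿ +i 0ᴿ
1ᶜ = 1ᴿ +i 0ᴿ

infixl 6 _+ᶜ_
infixl 7 _*ᶜ_
infix  8 -ᶜ_

_+ᶜ_ _*ᶜ_ : ℂ → ℂ → ℂ
z +ᶜ w = (re z +ᴿ re w) +i (im z +ᴿ im w)
z *ᶜ w = (re z *ᴿ re w +ᴿ -ᴿ (im z *ᴿ im w)) +i (re z *ᴿ im w +ᴿ im z *ᴿ re w)

-ᶜ_ : ℂ → ℂ
-ᶜ z = (-ᴿ re z) +i (-ᴿ im z)

∣_∣ᶜ : ℂ → ℝ
∣ z ∣ᶜ = √ (re z *ᴿ re z +ᴿ im z *ᴿ im z)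

ℂ-rawRing : RawRing 0ℓ 0ℓ
ℂ-rawRing = record
  { Carrier = ℂ
  ; _≈_ = _≈ᶜ_
  ; _+_ = _+ᶜ_
  ; _*_ = _*ᶜ_
  ; -_  = -ᶜ_
  ; 0#  = 0ᶜ
  ; 1#  = 1ᶜ
  }

open RawSemiringDefs (RawRing.rawSemiring ℝ-rawRing) public
  using () renaming (sum to sumᴿ; _^_ to _^ᴿ_)
open RawSemiringDefs (RawRing.rawSemiring ℂ-rawRing) public
  using () renaming (sum to sumᶜ; _^_ to _^ᶜ_)

------------------------------------------------------------------------
-- Complex matrices

Matrix : ℕ → ℕ → Set
Matrix m n = Fin m → Fin n → ℂ

infix 4 _≈ᴹ_

_≈ᴹ_ : ∀ {m n} → Matrix m n → Matrix m n → Set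
A ≈ᴹ B = ∀ i j → A i j ≈ᶜ B i j

identity : ∀ m → Matrix m m
identity m i j = if does (i Fin.≟ j) then 1ᶜ else 0ᶜ

infixl 7 _*ᴹ_

_*ᴹ_ : ∀ {m n o} → Matrix m n → Matrix n o → Matrix m o
(A *ᴹ B) i k = sumᶜ λ j → A i j *ᶜ B j k

record Invertible {m : ℕ} (A : Matrix m m) : Set where
  field
    inverse  : Matrix m m
    inverseˡ : inverse *ᴹ A ≈ᴹ identity m
    inverseʳ : A *ᴹ inverse ≈ᴹ identity m

‖_‖ : ∀ {m n} → Matrix m n → ℝ
‖ A ‖ = √ (sumᴿ λ i → sumᴿ λ j → ∣ A i j ∣ᶜ ^ᴿ 2)

Cond : ∀ {m} (A : Matrix m m) → Invertible A → ℝ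
Cond A A-inv = ‖ A ‖ *ᴿ ‖ Invertible.inverse A-inv ‖

-- Column indices start at 0, so the exponent j - 1 of the usual 1-based
-- indexing is toℕ j.
vandermonde : ∀ {m} → (Fin m → ℂ) → Matrix m m
vandermonde ζ i j = ζ i ^ᶜ toℕ j

------------------------------------------------------------------------
-- Primitive roots of unity

IsPrimitiveRoot : ℕ → ℂ → Set
IsPrimitiveRoot n z =
  z ^ᶜ n ≈ᶜ 1ᶜ × (∀ k → 0 ℕ.< k → k ℕ.< n → ¬ (z ^ᶜ k ≈ᶜ 1ᶜ))

-- ζ lists the primitive n-th roots of unity, each exactly once.
record ArePrimitiveRoots (n : ℕ) {m : ℕ} (ζ : Fin m → ℂ) : Set where
  field
    isPrimitive : ∀ i → IsPrimitiveRoot n (ζ i)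
    distinct    : Injective _≡_ _≈ᶜ_ ζ
    complete    : ∀ z → IsPrimitiveRoot n z → ∃[ i ] z ≈ᶜ ζ i

{-# OPTIONS --safe #-}

-- Put N = pqr, d = n/N, M = φ(N), and let Ψ be (1 − x^N)/Φ_N, which is explicit
-- once Φ_pq is (Lam–Leung), vanishes at the non-primitive N-th roots of unity and
-- has degree N − M.  Let Υ be a power series inverse of Ψ.  For j < M the product
-- of Ψ with the terms of Υ of degree ≤ j is 1 plus terms of degree between j + 1
-- and N − M + j, so summing (Ψ Υ_{≤ j₁})(z^d) z^(l−j), where j₁ = ⌊j/d⌋, over all
-- n-th roots of unity z picks out [j = l] for j, l < φ(n), and only primitive z
-- contribute.  Hence V⁻¹ has the entries (Ψ Υ_{≤ j₁})(ζ^d) ζ^(−j) / n.  As |ζ| = 1,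
-- they are bounded by the product of the ℓ¹-norms of Ψ and Υ over n.  Factoring Υ
-- as Φ_pq(x^r) (1 + … + x^(p−1)) (1 − x^q) (1 + x^pq + … + x^((r−1)pq)) modulo x^N,
-- this is crude but enough to give ‖V⁻¹‖ ≤ 2 M² m, while ‖V‖ ≤ m.
--
-- Constructively, the nodes ζ must be apart and not merely distinct: for z^n = 1
-- either z = 1 or 1 − z is cancellable, since 1 + z + … + z^(n−1) differs from n
-- by a multiple of 1 − z.

module Submission where

open import Defs
open import Algebra.Bundles using (CommutativeRing)
open import Level using (0ℓ)

-- Classically the coefficient of x^j in the Lagrange polynomial at a root ζ of Φ is -ζ^(-j-1) Φ_{≤
-- j}(ζ) / Φ′(ζ), where Φ_{≤ j} collects the terms of degree at most j. Differentiating Ψ Φ_N = 1 -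
-- x^N at ζ gives Ψ(ζ) Φ_N′(ζ) = -N ζ^(N-1). So multiplying by Ψ replaces the inversion of Φ_N′(ζ),
-- and the only division left is by an integer. Modulo x^N the series Υ is Φ_N itself, whose
-- coefficients are not bounded uniformly; its factorised form bounds their absolute sum without
-- computing any of them. The bounds are 2 p² q for Ψ and 2 p² q r for Υ, and p ≥ 3 together with
-- the order of the primes turns their product into at most M² p q r. The factor 2 of the theorem is
-- the price for bounding real and imaginary parts separately, which spares the triangle inequality
-- for the modulus.

-- Polynomial expressions, their degrees and ℓ¹-bounds.

module Polynomials where
  open import Data.Nat.Base using (ℕ; zero; suc; _+_; _*_; _⊔_; _≤_; _<_; s≤s; z≤n)
  import Data.Nat.Properties as ℕ
  open import Relation.Binary.PropositionalEquality using (_≡_; refl; sym; trans; cong; cong₂; subst)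

  open import Algebra.Properties.CommutativeSemigroup ℕ.+-commutativeSemigroup using (interchange)
  open import Data.Nat.Solver using (module +-*-Solver)
  open +-*-Solver using (solve; _:=_; _:+_; _:*_; con)
  open ℕ.≤-Reasoning

  infixl 6 _⊞_
  infixl 7 _⊡_
  infix  8 ⊖_
  infix  9 x^_

  -- Expressions rather than coefficient lists: `degree` and `weight` are read off a factorised
  -- form, ignoring cancellation, and no coefficient is ever computed.
  data Poly : Set where
    x^_     : ℕ → Poly
    𝟎       : Poly
    ⊖_      : Poly → Poly
    _⊞_ _⊡_ : Poly → Poly → Poly

  degree : Poly → ℕ
  degree (x^ e)  = e
  degree 𝟎       = 0
  degree (⊖ P)   = degree P
  degree (P ⊞ Q) = degree P ⊔ degree Q
  degree (P ⊡ Q) = degree P + degree Q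

  -- The number of monomials, hence a bound for the ℓ¹-norm of the coefficients.
  weight : Poly → ℕ
  weight (x^ e)  = 1
  weight 𝟎       = 0
  weight (⊖ P)   = weight P
  weight (P ⊞ Q) = weight P + weight Q
  weight (P ⊡ Q) = weight P * weight Q

  Δ : ℕ → Poly
  Δ a = x^ 0 ⊞ ⊖ x^ a

  -- The geometric sum (1 - x^(s t)) / (1 - x^s), with t terms.
  G : ℕ → ℕ → Poly
  G s zero    = 𝟎
  G s (suc t) = G s t ⊞ x^ (s * t)

  -- `ρ` inverts p modulo q and `σ` inverts q modulo p. In the Lam-Leung formula the positive block
  -- has the exponents p i + q j with i < ρ and j < σ. The negative block has those with ρ ≤ i < q
  -- and σ ≤ j < p, lowered by p q, so that it starts at p ρ + q σ - p q = 1. Positivity serves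
  -- `degree-G`.
  record Cofactors (p q : ℕ) : Set where
    field
      ρ ρ′ σ σ′ : ℕ
      0<ρ : 0 < ρ
      0<ρ′ : 0 < ρ′
      0<σ : 0 < σ
      0<σ′ : 0 < σ′
      ρ+ρ′≡q : ρ + ρ′ ≡ q
      σ+σ′≡p : σ + σ′ ≡ p
      bezout : p * ρ + q * σ ≡ suc (p * q)

    pρ≡ : p * ρ ≡ suc (q * σ′)
    pρ≡ = ℕ.+-cancelʳ-≡ (q * σ) _ _ (trans bezout (cong suc
      (trans (cong (_* q) (sym σ+σ′≡p)) (trans (ℕ.*-comm (σ + σ′) q)
        (trans (ℕ.*-distribˡ-+ q σ σ′) (ℕ.+-comm (q * σ) _))))))

    qσ≡ : q * σ ≡ suc (p * ρ′)
    qσ≡ = ℕ.+-cancelˡ-≡ (p * ρ) _ _ (trans bezout (trans (cong suc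
      (trans (cong (p *_) (sym ρ+ρ′≡q)) (ℕ.*-distribˡ-+ p ρ ρ′)))
      (sym (ℕ.+-suc (p * ρ) _))))

    pρ+pρ′≡ : p * ρ + p * ρ′ ≡ p * q
    pρ+pρ′≡ = trans (sym (ℕ.*-distribˡ-+ p ρ ρ′)) (cong (p *_) ρ+ρ′≡q)

    pρ′+qσ′≤ : p * ρ′ + q * σ′ ≤ p * q
    pρ′+qσ′≤ = ℕ.≤-trans (ℕ.+-monoʳ-≤ (p * ρ′) (ℕ.≤-trans (ℕ.n≤1+n _) (ℕ.≤-reflexive (sym pρ≡))))
      (ℕ.≤-reflexive (trans (ℕ.+-comm (p * ρ′) _) pρ+pρ′≡))

  weight-G : ∀ s t → weight (G s t) ≡ t
  weight-G s zero = refl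
  weight-G s (suc t) = trans (cong (_+ 1) (weight-G s t)) (ℕ.+-comm t 1)

  -- The degree is s (t - 1), and adding s avoids truncated subtraction. The empty sum is excluded
  -- because its `degree` is 0 and not -s.
  degree-G : ∀ s {t} → 0 < t → degree (G s t) + s ≤ s * t
  degree-G s {suc zero} _ = ℕ.≤-reflexive (trans (cong (_+ s) (ℕ.*-zeroʳ s)) (sym (ℕ.*-identityʳ s)))
  degree-G s {suc t@(suc _)} _ = subst (degree (G s (suc t)) + s ≤_)
    (trans (ℕ.+-comm _ s) (sym (ℕ.*-suc s t)))
    (ℕ.+-monoˡ-≤ s (ℕ.⊔-lub (ℕ.m+n≤o⇒m≤o _ (degree-G s (s≤s z≤n))) ℕ.≤-refl))

  module _ {p q : ℕ} (W : Cofactors p q) where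
    open Cofactors W

    -- Φ_pq(x^s), by the formula of Lam and Leung.
    Φ : ℕ → Poly
    Φ s = G (s * p) ρ ⊡ G (s * q) σ ⊞ ⊖ (x^ s ⊡ (G (s * p) ρ′ ⊡ G (s * q) σ′))

    -- Up to sign, Ψ is (x^(pqr) − 1) / Φ_pqr.
    Ψ : ℕ → Poly
    Ψ r = Φ 1 ⊡ (G r p ⊡ Δ (r * q))

    -- Modulo x^(pqr) this is the power series inverse of Ψ.
    Υ : ℕ → Poly
    Υ r = (Φ r ⊡ (G 1 p ⊡ Δ (1 * q))) ⊡ G (p * q) r

    -- Crude: the second sum of either block is completed to all σ + σ′ terms.
    weight-Φ : ∀ s → weight (Φ s) ≤ p * q
    weight-Φ s = begin
      weight (Φ s)                        ≡⟨ cong₂ _+_ (cong₂ _*_ (weight-G (s * p) ρ) (weight-G (s * q) σ))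
        (trans (ℕ.*-identityˡ _) (cong₂ _*_ (weight-G (s * p) ρ′) (weight-G (s * q) σ′))) ⟩
      ρ * σ + ρ′ * σ′                     ≤⟨ ℕ.+-mono-≤ (ℕ.*-monoʳ-≤ ρ (ℕ.m≤m+n σ σ′)) (ℕ.*-monoʳ-≤ ρ′ (ℕ.m≤n+m σ′ σ)) ⟩
      ρ * (σ + σ′) + ρ′ * (σ + σ′)        ≡⟨ ℕ.*-distribʳ-+ (σ + σ′) ρ ρ′ ⟨
      (ρ + ρ′) * (σ + σ′)                 ≡⟨ cong₂ _*_ ρ+ρ′≡q σ+σ′≡p ⟩
      q * p                               ≡⟨ ℕ.*-comm q p ⟩
      p * q                               ∎

    weight-Ψ : ∀ r → weight (Ψ r) ≤ p * q * (p * 2)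
    weight-Ψ r = ℕ.*-mono-≤ (weight-Φ 1) (ℕ.≤-reflexive (cong (_* 2) (weight-G r p)))

    weight-Υ : ∀ r → weight (Υ r) ≤ p * q * (p * 2) * r
    weight-Υ r = ℕ.*-mono-≤ (ℕ.*-mono-≤ (weight-Φ r) (ℕ.≤-reflexive (cong (_* 2) (weight-G 1 p))))
      (ℕ.≤-reflexive (weight-G (p * q) r))

    -- This is degree ≤ (p - 1)(q - 1). Restoring the last step of each geometric sum turns the
    -- degree of the positive block into p ρ + q σ = p q + 1, and that of the negative block, with
    -- its extra factor x, into at most the same number.
    degree-Φ : degree (Φ 1) + (p + q) ≤ suc (p * q)
    degree-Φ = subst (_≤ suc (p * q)) (sym (ℕ.+-distribʳ-⊔ (p + q)
        (degree (G (1 * p) ρ ⊡ G (1 * q) σ)) (degree (x^ 1 ⊡ (G (1 * p) ρ′ ⊡ G (1 * q) σ′))))) (ℕ.⊔-lub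
      (ℕ.≤-trans (block 0<ρ 0<σ) (ℕ.≤-reflexive bezout))
      (s≤s (ℕ.≤-trans (block 0<ρ′ 0<σ′) pρ′+qσ′≤)))
      where
      block : ∀ {i j} → 0 < i → 0 < j →
        degree (G (1 * p) i) + degree (G (1 * q) j) + (p + q) ≤ p * i + q * j
      block {i} {j} 0<i 0<j = begin
        degree (G (1 * p) i) + degree (G (1 * q) j) + (p + q)
          ≡⟨ cong₂ (λ a b → degree (G a i) + degree (G b j) + (p + q)) (ℕ.*-identityˡ p) (ℕ.*-identityˡ q) ⟩
        degree (G p i) + degree (G q j) + (p + q)
          ≡⟨ interchange (degree (G p i)) (degree (G q j)) p q ⟩
        degree (G p i) + p + (degree (G q j) + q)
          ≤⟨ ℕ.+-mono-≤ (degree-G p 0<i) (degree-G q 0<j) ⟩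
        p * i + q * j ∎

    degree-Ψ : ∀ r → 0 < p → degree (Ψ r) + (p + q + r) ≤ suc (p * q) + (r * p + r * q)
    degree-Ψ r 0<p = begin
      degree (Φ 1) + (degree (G r p) + r * q) + (p + q + r)
        ≡⟨ solve 5 (λ a b c d e → a :+ (b :+ c) :+ (d :+ e) := (a :+ d) :+ ((b :+ e) :+ c))
             refl (degree (Φ 1)) (degree (G r p)) (r * q) (p + q) r ⟩
      degree (Φ 1) + (p + q) + (degree (G r p) + r + r * q)
        ≤⟨ ℕ.+-mono-≤ degree-Φ (ℕ.+-monoˡ-≤ (r * q) (degree-G r 0<p)) ⟩
      suc (p * q) + (r * p + r * q) ∎

    -- With predecessors in place of p - 1, q - 1 and r - 1 the count becomes an identity without
    -- subtraction. The room of length p′ q′ r′ left above Ψ is what later keeps exponents from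
    -- wrapping around modulo n.
    degree-Ψ+φ : ∀ {p′ q′ r′} → p ≡ suc p′ → q ≡ suc q′ →
      degree (Ψ (suc r′)) + p′ * q′ * r′ ≤ p * q * suc r′
    degree-Ψ+φ {p′} {q′} {r′} refl refl = ℕ.+-cancelʳ-≤ (p + q + r) _ _ (begin
      degree (Ψ r) + p′ * q′ * r′ + (p + q + r)
        ≡⟨ solve 3 (λ a b c → a :+ b :+ c := a :+ c :+ b) refl (degree (Ψ r)) (p′ * q′ * r′) (p + q + r) ⟩
      degree (Ψ r) + (p + q + r) + p′ * q′ * r′
        ≤⟨ ℕ.+-monoˡ-≤ _ (degree-Ψ r (s≤s z≤n)) ⟩
      suc (p * q) + (r * p + r * q) + p′ * q′ * r′
        ≡⟨ solve 3 (λ a b c → let 1+ = λ x → con 1 :+ x in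
             con 1 :+ 1+ a :* 1+ b :+ (1+ c :* 1+ a :+ 1+ c :* 1+ b) :+ a :* b :* c :=
             1+ a :* 1+ b :* 1+ c :+ (1+ a :+ 1+ b :+ 1+ c)) refl p′ q′ r′ ⟩
      p * q * r + (p + q + r) ∎)
      where
      r = suc r′

-- Polynomials as functionals on sequences, and the product of Ψ and Υ.

module Functionals (R : CommutativeRing 0ℓ 0ℓ) where
  open Polynomials
  open CommutativeRing R renaming (Carrier to C)
  open import Algebra.Properties.Ring ring
    using (-0#≈0#; -‿distribʳ-*; -‿+-comm)
  open import Algebra.Properties.CommutativeSemigroup +-commutativeSemigroup using (interchange)
  open import Algebra.Properties.Semiring.Sum semiring using (sum)
  open import Data.Fin.Base using (Fin; zero; suc)
  open import Data.Nat.Base as ℕ using (ℕ; zero; suc; _≤_)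
  import Data.Nat.Properties as ℕ
  open import Relation.Binary.PropositionalEquality as ≡ using (_≡_)

  -- The polynomial Σ ± x^e acts on sequences φ by Σ ± φ(e); evaluation at z
  -- is the case φ(e) = z^e, and the product of polynomials is convolution.
  ⟦_⟧ : Poly → (ℕ → C) → C
  ⟦ x^ e ⟧  φ = φ e
  ⟦ 𝟎 ⟧     φ = 0#
  ⟦ ⊖ P ⟧   φ = - ⟦ P ⟧ φ
  ⟦ P ⊞ Q ⟧ φ = ⟦ P ⟧ φ + ⟦ Q ⟧ φ
  ⟦ P ⊡ Q ⟧ φ = ⟦ P ⟧ λ a → ⟦ Q ⟧ λ b → φ (a ℕ.+ b)

  -- What makes `degree` useful: values beyond it may be changed freely, as in `window-δ`.
  ⟦⟧-cong-≤ : ∀ P {φ ψ} → (∀ k → k ≤ degree P → φ k ≈ ψ k) → ⟦ P ⟧ φ ≈ ⟦ P ⟧ ψ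
  ⟦⟧-cong-≤ (x^ e) h = h e ℕ.≤-refl
  ⟦⟧-cong-≤ 𝟎 h = refl
  ⟦⟧-cong-≤ (⊖ P) h = -‿cong (⟦⟧-cong-≤ P h)
  ⟦⟧-cong-≤ (P ⊞ Q) h = +-cong
    (⟦⟧-cong-≤ P λ k k≤ → h k (ℕ.≤-trans k≤ (ℕ.m≤m⊔n _ _)))
    (⟦⟧-cong-≤ Q λ k k≤ → h k (ℕ.≤-trans k≤ (ℕ.m≤n⊔m _ _)))
  ⟦⟧-cong-≤ (P ⊡ Q) h = ⟦⟧-cong-≤ P λ a a≤ → ⟦⟧-cong-≤ Q λ b b≤ →
    h (a ℕ.+ b) (ℕ.+-mono-≤ a≤ b≤)

  ⟦⟧-cong : ∀ P {φ ψ} → (∀ k → φ k ≈ ψ k) → ⟦ P ⟧ φ ≈ ⟦ P ⟧ ψ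
  ⟦⟧-cong P h = ⟦⟧-cong-≤ P λ k _ → h k

  ⟦⟧-0 : ∀ P → ⟦ P ⟧ (λ _ → 0#) ≈ 0#
  ⟦⟧-0 (x^ e) = refl
  ⟦⟧-0 𝟎 = refl
  ⟦⟧-0 (⊖ P) = trans (-‿cong (⟦⟧-0 P)) -0#≈0#
  ⟦⟧-0 (P ⊞ Q) = trans (+-cong (⟦⟧-0 P) (⟦⟧-0 Q)) (+-identityˡ 0#)
  ⟦⟧-0 (P ⊡ Q) = trans (⟦⟧-cong P λ _ → ⟦⟧-0 Q) (⟦⟧-0 P)

  ⟦⟧-+ : ∀ P φ ψ → ⟦ P ⟧ (λ k → φ k + ψ k) ≈ ⟦ P ⟧ φ + ⟦ P ⟧ ψ
  ⟦⟧-+ (x^ e) φ ψ = refl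
  ⟦⟧-+ 𝟎 φ ψ = sym (+-identityˡ 0#)
  ⟦⟧-+ (⊖ P) φ ψ = trans (-‿cong (⟦⟧-+ P φ ψ)) (sym (-‿+-comm _ _))
  ⟦⟧-+ (P ⊞ Q) φ ψ = trans (+-cong (⟦⟧-+ P φ ψ) (⟦⟧-+ Q φ ψ)) (interchange _ _ _ _)
  ⟦⟧-+ (P ⊡ Q) φ ψ = trans (⟦⟧-cong P λ a → ⟦⟧-+ Q _ _) (⟦⟧-+ P _ _)

  ⟦⟧-neg : ∀ P φ → ⟦ P ⟧ (λ k → - φ k) ≈ - ⟦ P ⟧ φ
  ⟦⟧-neg (x^ e) φ = refl
  ⟦⟧-neg 𝟎 φ = sym -0#≈0#
  ⟦⟧-neg (⊖ P) φ = -‿cong (⟦⟧-neg P φ)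
  ⟦⟧-neg (P ⊞ Q) φ = trans (+-cong (⟦⟧-neg P φ) (⟦⟧-neg Q φ)) (-‿+-comm _ _)
  ⟦⟧-neg (P ⊡ Q) φ = trans (⟦⟧-cong P λ a → ⟦⟧-neg Q _) (⟦⟧-neg P _)

  ⟦⟧-* : ∀ P z φ → ⟦ P ⟧ (λ k → z * φ k) ≈ z * ⟦ P ⟧ φ
  ⟦⟧-* (x^ e) z φ = refl
  ⟦⟧-* 𝟎 z φ = sym (zeroʳ z)
  ⟦⟧-* (⊖ P) z φ = trans (-‿cong (⟦⟧-* P z φ)) (-‿distribʳ-* z _)
  ⟦⟧-* (P ⊞ Q) z φ = trans (+-cong (⟦⟧-* P z φ) (⟦⟧-* Q z φ)) (sym (distribˡ z _ _))
  ⟦⟧-* (P ⊡ Q) z φ = trans (⟦⟧-cong P λ a → ⟦⟧-* Q z _) (⟦⟧-* P z _)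

  ⟦⟧-sum : ∀ P {m} (φ : Fin m → ℕ → C) →
    ⟦ P ⟧ (λ k → sum λ i → φ i k) ≈ sum λ i → ⟦ P ⟧ (φ i)
  ⟦⟧-sum P {zero} φ = ⟦⟧-0 P
  ⟦⟧-sum P {suc m} φ = trans (⟦⟧-+ P _ _) (+-congˡ (⟦⟧-sum P λ i → φ (suc i)))

  -- Interchange of two finite sums; it makes `⊡` commutative.
  ⟦⟧-comm : ∀ P Q (f : ℕ → ℕ → C) →
    ⟦ P ⟧ (λ a → ⟦ Q ⟧ λ b → f a b) ≈ ⟦ Q ⟧ (λ b → ⟦ P ⟧ λ a → f a b)
  ⟦⟧-comm (x^ e) Q f = refl
  ⟦⟧-comm 𝟎 Q f = sym (⟦⟧-0 Q)
  ⟦⟧-comm (⊖ P) Q f = trans (-‿cong (⟦⟧-comm P Q f)) (sym (⟦⟧-neg Q _))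
  ⟦⟧-comm (P ⊞ P′) Q f = trans (+-cong (⟦⟧-comm P Q f) (⟦⟧-comm P′ Q f)) (sym (⟦⟧-+ Q _ _))
  ⟦⟧-comm (P ⊡ P′) Q f = trans (⟦⟧-cong P λ a → ⟦⟧-comm P′ Q _) (⟦⟧-comm P Q _)

  infix 4 _≋_
  -- The sequence that is 1 at one index and 0 elsewhere reads off a coefficient, so this is
  -- equality of polynomials over the ring.
  record _≋_ (P Q : Poly) : Set where
    constructor ≋-by
    field at : ∀ φ → ⟦ P ⟧ φ ≈ ⟦ Q ⟧ φ
  open _≋_ public

  poly-commutativeRing : CommutativeRing 0ℓ 0ℓ
  poly-commutativeRing = record
    { Carrier = Poly ; _≈_ = _≋_ ; _+_ = _⊞_ ; _*_ = _⊡_ ; -_ = ⊖_ ; 0# = 𝟎 ; 1# = x^ 0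
    ; isCommutativeRing = record
      { isRing = record
        { +-isAbelianGroup = record
          { isGroup = record
            { isMonoid = record
              { isSemigroup = record
                { isMagma = record
                  { isEquivalence = record
                    { refl = ≋-by λ φ → refl
                    ; sym = λ e → ≋-by λ φ → sym (at e φ)
                    ; trans = λ e f → ≋-by λ φ → trans (at e φ) (at f φ) }
                  ; ∙-cong = λ e f → ≋-by λ φ → +-cong (at e φ) (at f φ) }
                ; assoc = λ P Q S → ≋-by λ φ → +-assoc _ _ _ }
              ; identity = (λ P → ≋-by λ φ → +-identityˡ _) , (λ P → ≋-by λ φ → +-identityʳ _) }
            ; inverse = (λ P → ≋-by λ φ → -‿inverseˡ _) , (λ P → ≋-by λ φ → -‿inverseʳ _)
            ; ⁻¹-cong = λ e → ≋-by λ φ → -‿cong (at e φ) }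
          ; comm = λ P Q → ≋-by λ φ → +-comm _ _ }
        ; *-cong = λ {P} {P′} {Q} {Q′} e f → ≋-by λ φ →
            trans (⟦⟧-cong P λ a → at f _) (at e _)
        ; *-assoc = λ P Q S → ≋-by λ φ → ⟦⟧-cong P λ a → ⟦⟧-cong Q λ b → ⟦⟧-cong S λ c →
            reflexive (≡.cong φ (ℕ.+-assoc a b c))
        ; *-identity = (λ P → ≋-by λ φ → refl)
            , (λ P → ≋-by λ φ → ⟦⟧-cong P λ a → reflexive (≡.cong φ (ℕ.+-identityʳ a)))
        ; distrib = (λ P Q S → ≋-by λ φ → ⟦⟧-+ P _ _) , (λ P Q S → ≋-by λ φ → refl) }
      ; *-comm = ⊡-comm } }
    where
    open import Data.Product.Base using (_,_)
    ⊡-comm : ∀ P Q → (P ⊡ Q) ≋ (Q ⊡ P)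
    ⊡-comm P Q = ≋-by λ φ → trans (⟦⟧-comm P Q _)
      (⟦⟧-cong Q λ b → ⟦⟧-cong P λ a → reflexive (≡.cong φ (ℕ.+-comm a b)))

  private module PR = CommutativeRing poly-commutativeRing
  open import Relation.Binary.Reasoning.Setoid PR.setoid
  open import Algebra.Solver.Ring.NaturalCoefficients.Default PR.commutativeSemiring
    using (solve; _:=_; _:+_; _:*_)
  open import Algebra.Properties.Ring PR.ring using ()
    renaming (-‿distribʳ-* to ⊖-distribʳ; -‿distribˡ-* to ⊖-distribˡ; -‿+-comm to ⊖-⊞-comm; -‿involutive to ⊖-involutive)

  open import Algebra.Properties.CommutativeSemigroup PR.*-commutativeSemigroup
    using () renaming (interchange to ⊡-interchange)
  open import Algebra.Properties.CommutativeSemigroup PR.+-commutativeSemigroup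
    using () renaming (interchange to ⊞-interchange)

  ⊡-minus : ∀ P Q S → P ⊡ (Q ⊞ ⊖ S) ≋ P ⊡ Q ⊞ ⊖ (P ⊡ S)
  ⊡-minus P Q S = PR.trans (PR.distribˡ P Q (⊖ S)) (PR.+-congˡ (PR.sym (⊖-distribʳ P S)))

  ⊡-Δ : ∀ P a → P ⊡ Δ a ≋ P ⊞ ⊖ (P ⊡ x^ a)
  ⊡-Δ P a = PR.trans (⊡-minus P (x^ 0) (x^ a)) (PR.+-congʳ (PR.*-identityʳ P))

  -- Separates positive from negative terms, after which each part is an identity in a semiring.
  minus-interchange : ∀ P Q S T → (P ⊞ ⊖ Q) ⊞ ⊖ (S ⊞ ⊖ T) ≋ (P ⊞ T) ⊞ ⊖ (S ⊞ Q)
  minus-interchange P Q S T = begin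
    (P ⊞ ⊖ Q) ⊞ ⊖ (S ⊞ ⊖ T)     ≈⟨ PR.+-congˡ (⊖-⊞-comm S (⊖ T)) ⟨
    (P ⊞ ⊖ Q) ⊞ (⊖ S ⊞ ⊖ ⊖ T)   ≈⟨ PR.+-congˡ (PR.trans (PR.+-congˡ (⊖-involutive T)) (PR.+-comm (⊖ S) T)) ⟩
    (P ⊞ ⊖ Q) ⊞ (T ⊞ ⊖ S)       ≈⟨ ⊞-interchange P (⊖ Q) T (⊖ S) ⟩
    (P ⊞ T) ⊞ (⊖ Q ⊞ ⊖ S)       ≈⟨ PR.+-congˡ (PR.trans (PR.+-comm (⊖ Q) (⊖ S)) (⊖-⊞-comm S Q)) ⟩
    (P ⊞ T) ⊞ ⊖ (S ⊞ Q)         ∎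

  x^-≡ : ∀ {a b} → a ≡ b → x^ a ≋ x^ b
  x^-≡ e = PR.reflexive (≡.cong x^_ e)

  x^-+ : ∀ {a b k} → k ≡ a ℕ.+ b → x^ k ≋ x^ a ⊡ x^ b
  x^-+ ≡.refl = ≋-by λ φ → refl

  G-+ : ∀ s a b → G s (a ℕ.+ b) ≋ G s a ⊞ x^ (s ℕ.* a) ⊡ G s b
  G-+ s a zero = ≋-by λ φ → trans (reflexive (≡.cong (λ t → ⟦ G s t ⟧ φ) (ℕ.+-identityʳ a)))
    (sym (+-identityʳ _))
  G-+ s a (suc b) = begin
    G s (a ℕ.+ suc b)
      ≡⟨ ≡.cong (G s) (ℕ.+-suc a b) ⟩
    G s (a ℕ.+ b) ⊞ x^ (s ℕ.* (a ℕ.+ b))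
      ≈⟨ PR.+-cong (G-+ s a b) (x^-+ (ℕ.*-distribˡ-+ s a b)) ⟩
    (G s a ⊞ x^ (s ℕ.* a) ⊡ G s b) ⊞ x^ (s ℕ.* a) ⊡ x^ (s ℕ.* b)
      ≈⟨ PR.+-assoc _ _ _ ⟩
    G s a ⊞ (x^ (s ℕ.* a) ⊡ G s b ⊞ x^ (s ℕ.* a) ⊡ x^ (s ℕ.* b))
      ≈⟨ PR.+-congˡ (PR.distribˡ (x^ (s ℕ.* a)) (G s b) (x^ (s ℕ.* b))) ⟨
    G s a ⊞ x^ (s ℕ.* a) ⊡ G s (suc b) ∎

  -- Each number below `a * b` is `a * i + j` for unique i < b and j < a.
  G-* : ∀ s a b → G (s ℕ.* a) b ⊡ G s a ≋ G s (a ℕ.* b)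
  G-* s a zero = begin
    𝟎 ⊡ G s a       ≈⟨ PR.zeroˡ (G s a) ⟩
    𝟎               ≡⟨ ≡.cong (G s) (ℕ.*-zeroʳ a) ⟨
    G s (a ℕ.* 0)   ∎
  G-* s a (suc b) = begin
    (G (s ℕ.* a) b ⊞ x^ (s ℕ.* a ℕ.* b)) ⊡ G s a
      ≈⟨ PR.distribʳ _ _ _ ⟩
    G (s ℕ.* a) b ⊡ G s a ⊞ x^ (s ℕ.* a ℕ.* b) ⊡ G s a
      ≈⟨ PR.+-cong (G-* s a b) (PR.*-congʳ {G s a} (x^-≡ (ℕ.*-assoc s a b))) ⟩
    G s (a ℕ.* b) ⊞ x^ (s ℕ.* (a ℕ.* b)) ⊡ G s a
      ≈⟨ G-+ s (a ℕ.* b) a ⟨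
    G s (a ℕ.* b ℕ.+ a)
      ≡⟨ ≡.cong (G s) (≡.trans (ℕ.+-comm _ a) (≡.sym (ℕ.*-suc a b))) ⟩
    G s (a ℕ.* suc b) ∎

  G-Δ : ∀ s t → G s t ⊡ Δ s ≋ Δ (s ℕ.* t)
  G-Δ s zero = ≋-by λ φ → sym (trans (+-congˡ (-‿cong (reflexive (≡.cong φ (ℕ.*-zeroʳ s)))))
    (-‿inverseʳ _))
  G-Δ s (suc t) = begin
    (G s t ⊞ x^ (s ℕ.* t)) ⊡ Δ s
      ≈⟨ PR.distribʳ (Δ s) (G s t) (x^ (s ℕ.* t)) ⟩
    G s t ⊡ Δ s ⊞ x^ (s ℕ.* t) ⊡ Δ s
      ≈⟨ PR.+-cong (G-Δ s t) (PR.distribˡ (x^ (s ℕ.* t)) (x^ 0) (⊖ x^ s)) ⟩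
    Δ (s ℕ.* t) ⊞ (x^ (s ℕ.* t) ⊡ x^ 0 ⊞ x^ (s ℕ.* t) ⊡ (⊖ x^ s))
      ≈⟨ PR.+-congˡ {Δ (s ℕ.* t)} (PR.+-cong {x^ (s ℕ.* t) ⊡ x^ 0} (PR.*-identityʳ (x^ (s ℕ.* t)))
           (PR.trans (PR.sym (⊖-distribʳ (x^ (s ℕ.* t)) (x^ s))) (PR.-‿cong (PR.sym (x^-+ st+s))))) ⟩
    (x^ 0 ⊞ ⊖ x^ (s ℕ.* t)) ⊞ (x^ (s ℕ.* t) ⊞ ⊖ x^ (s ℕ.* suc t))
      ≈⟨ ≋-by (λ φ → telescope (φ 0) (φ (s ℕ.* t)) (- φ (s ℕ.* suc t))) ⟩
    Δ (s ℕ.* suc t) ∎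
    where
    st+s : s ℕ.* suc t ≡ s ℕ.* t ℕ.+ s
    st+s = ≡.trans (ℕ.*-suc s t) (ℕ.+-comm s _)
    telescope : ∀ a b c → (a + - b) + (b + c) ≈ a + c
    telescope a b c = trans (+-assoc a (- b) (b + c)) (+-congˡ
      (trans (sym (+-assoc (- b) b c)) (trans (+-congʳ (-‿inverseˡ b)) (+-identityˡ c))))

  module _ {p q} (W : Cofactors p q) where
    open Cofactors W

    Φ-block : ∀ s i j → (G (s ℕ.* p) i ⊡ G (s ℕ.* q) j) ⊡ (G s p ⊡ Δ (s ℕ.* q)) ≋
      G s (p ℕ.* i) ⊡ Δ (s ℕ.* q ℕ.* j)
    Φ-block s i j = begin
      (G (s ℕ.* p) i ⊡ G (s ℕ.* q) j) ⊡ (G s p ⊡ Δ (s ℕ.* q))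
        ≈⟨ ⊡-interchange (G (s ℕ.* p) i) (G (s ℕ.* q) j) (G s p) (Δ (s ℕ.* q)) ⟩
      (G (s ℕ.* p) i ⊡ G s p) ⊡ (G (s ℕ.* q) j ⊡ Δ (s ℕ.* q))
        ≈⟨ PR.*-cong (G-* s p i) (G-Δ (s ℕ.* q) j) ⟩
      G s (p ℕ.* i) ⊡ Δ (s ℕ.* q ℕ.* j) ∎

    -- The relation Φ_pq(x) (1 - x^p)(1 - x^q) = (1 - x)(1 - x^(pq)) at x^s, with 1 - x^s divided
    -- out. Apart from its degree and weight this is all that is used of Φ_pq, and it takes the
    -- place of a definition through roots of unity.
    Φ-G-Δ : ∀ s → Φ W s ⊡ (G s p ⊡ Δ (s ℕ.* q)) ≋ Δ (s ℕ.* (p ℕ.* q))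
    Φ-G-Δ s = begin
      Φ W s ⊡ (G s p ⊡ Δ (s ℕ.* q))
        ≈⟨ PR.distribʳ _ _ _ ⟩
      (G (s ℕ.* p) ρ ⊡ G (s ℕ.* q) σ) ⊡ (G s p ⊡ Δ (s ℕ.* q)) ⊞
        ⊖ (x^ s ⊡ (G (s ℕ.* p) ρ′ ⊡ G (s ℕ.* q) σ′)) ⊡ (G s p ⊡ Δ (s ℕ.* q))
        ≈⟨ PR.+-cong (Φ-block s ρ σ) (PR.trans (PR.sym (⊖-distribˡ _ _)) (PR.-‿cong
             (PR.trans (PR.*-assoc _ _ _) (PR.*-congˡ {x^ s} (Φ-block s ρ′ σ′))))) ⟩
      g ⊡ Δ (s ℕ.* q ℕ.* σ) ⊞ ⊖ (x^ s ⊡ (g′ ⊡ Δ (s ℕ.* q ℕ.* σ′)))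
        ≈⟨ PR.+-cong (⊡-Δ g _) (PR.-‿cong (PR.trans (PR.*-congˡ {x^ s} (⊡-Δ g′ _)) (⊡-minus (x^ s) _ _))) ⟩
      (g ⊞ ⊖ (g ⊡ y)) ⊞ ⊖ (x^ s ⊡ g′ ⊞ ⊖ (x^ s ⊡ (g′ ⊡ y′)))
        ≈⟨ minus-interchange g (g ⊡ y) (x^ s ⊡ g′) (x^ s ⊡ (g′ ⊡ y′)) ⟩
      (g ⊞ x^ s ⊡ (g′ ⊡ y′)) ⊞ ⊖ (x^ s ⊡ g′ ⊞ g ⊡ y)
        ≈⟨ PR.+-cong upper (PR.-‿cong lower) ⟩
      G s (p ℕ.* q) ⊞ ⊖ (G s (p ℕ.* q) ⊡ x^ s)
        ≈⟨ ⊡-Δ (G s (p ℕ.* q)) s ⟨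
      G s (p ℕ.* q) ⊡ Δ s
        ≈⟨ G-Δ s (p ℕ.* q) ⟩
      Δ (s ℕ.* (p ℕ.* q)) ∎
      where
      g g′ y y′ : Poly
      g  = G s (p ℕ.* ρ)
      g′ = G s (p ℕ.* ρ′)
      y  = x^ (s ℕ.* q ℕ.* σ)
      y′ = x^ (s ℕ.* q ℕ.* σ′)

      -- As p ρ = q σ′ + 1, the second sum starts exactly where `g` stops.
      upper : g ⊞ x^ s ⊡ (g′ ⊡ y′) ≋ G s (p ℕ.* q)
      upper = begin
        g ⊞ x^ s ⊡ (g′ ⊡ y′)
          ≈⟨ solve 4 (λ a b c d → a :+ b :* (c :* d) := a :+ (b :* d) :* c) PR.refl g (x^ s) g′ y′ ⟩
        g ⊞ (x^ s ⊡ y′) ⊡ g′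
          ≈⟨ PR.+-congˡ {g} (PR.*-congʳ {g′} (PR.sym (x^-+ shift))) ⟩
        g ⊞ x^ (s ℕ.* (p ℕ.* ρ)) ⊡ g′
          ≈⟨ G-+ s (p ℕ.* ρ) (p ℕ.* ρ′) ⟨
        G s (p ℕ.* ρ ℕ.+ p ℕ.* ρ′)
          ≡⟨ ≡.cong (G s) pρ+pρ′≡ ⟩
        G s (p ℕ.* q) ∎
        where
        shift : s ℕ.* (p ℕ.* ρ) ≡ s ℕ.+ s ℕ.* q ℕ.* σ′
        shift = ≡.trans (≡.cong (s ℕ.*_) pρ≡) (≡.trans (ℕ.*-suc s _)
          (≡.cong (s ℕ.+_) (≡.sym (ℕ.*-assoc s q σ′))))

      -- The mirror image: by q σ = p ρ′ + 1 the sum `g` continues `g′`, and everything is shifted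
      -- by s.
      lower : x^ s ⊡ g′ ⊞ g ⊡ y ≋ G s (p ℕ.* q) ⊡ x^ s
      lower = begin
        x^ s ⊡ g′ ⊞ g ⊡ y
          ≈⟨ PR.+-congˡ {x^ s ⊡ g′} (PR.*-congˡ {g} (x^-+ shift)) ⟩
        x^ s ⊡ g′ ⊞ g ⊡ (x^ s ⊡ x^ (s ℕ.* (p ℕ.* ρ′)))
          ≈⟨ solve 4 (λ a b c d → a :* c :+ b :* (a :* d) := (c :+ d :* b) :* a) PR.refl
               (x^ s) g g′ (x^ (s ℕ.* (p ℕ.* ρ′))) ⟩
        (g′ ⊞ x^ (s ℕ.* (p ℕ.* ρ′)) ⊡ g) ⊡ x^ s
          ≈⟨ PR.*-congʳ {x^ s} (G-+ s (p ℕ.* ρ′) (p ℕ.* ρ)) ⟨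
        G s (p ℕ.* ρ′ ℕ.+ p ℕ.* ρ) ⊡ x^ s
          ≡⟨ ≡.cong (λ k → G s k ⊡ x^ s) (≡.trans (ℕ.+-comm (p ℕ.* ρ′) _) pρ+pρ′≡) ⟩
        G s (p ℕ.* q) ⊡ x^ s ∎
        where
        shift : s ℕ.* q ℕ.* σ ≡ s ℕ.+ s ℕ.* (p ℕ.* ρ′)
        shift = ≡.trans (ℕ.*-assoc s q σ) (≡.trans (≡.cong (s ℕ.*_) qσ≡) (ℕ.*-suc s _))

    -- Regrouped, the factors are those of `Φ-G-Δ` at s = 1, completed by `G (p * q) r`, and at s =
    -- r. Modulo x^(pqr) the right-hand side is 1, which makes Υ inverse to Ψ below that degree.
    Ψ-Υ : ∀ r → Ψ W r ⊡ Υ W r ≋ Δ (p ℕ.* q ℕ.* r) ⊡ Δ (p ℕ.* q ℕ.* r)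
    Ψ-Υ r = begin
      Ψ W r ⊡ Υ W r
        ≈⟨ solve 7 (λ a b c d e f g → (a :* (b :* c)) :* ((d :* (e :* f)) :* g) :=
             (a :* (e :* f) :* g) :* (d :* (b :* c))) PR.refl
             (Φ W 1) (G r p) (Δ (r ℕ.* q)) (Φ W r) (G 1 p) (Δ (1 ℕ.* q)) (G (p ℕ.* q) r) ⟩
      (Φ W 1 ⊡ (G 1 p ⊡ Δ (1 ℕ.* q)) ⊡ G (p ℕ.* q) r) ⊡ (Φ W r ⊡ (G r p ⊡ Δ (r ℕ.* q)))
        ≈⟨ PR.*-cong (PR.trans (PR.*-congʳ {G (p ℕ.* q) r} (Φ-G-Δ 1))
             (PR.*-comm (Δ (1 ℕ.* (p ℕ.* q))) (G (p ℕ.* q) r))) (Φ-G-Δ r) ⟩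
      (G (p ℕ.* q) r ⊡ Δ (1 ℕ.* (p ℕ.* q))) ⊡ Δ (r ℕ.* (p ℕ.* q))
        ≡⟨ ≡.cong₂ (λ a b → (G (p ℕ.* q) r ⊡ Δ a) ⊡ Δ b) (ℕ.*-identityˡ (p ℕ.* q)) (ℕ.*-comm r _) ⟩
      (G (p ℕ.* q) r ⊡ Δ (p ℕ.* q)) ⊡ Δ (p ℕ.* q ℕ.* r)
        ≈⟨ PR.*-congʳ {Δ (p ℕ.* q ℕ.* r)} (G-Δ (p ℕ.* q) r) ⟩
      Δ (p ℕ.* q ℕ.* r) ⊡ Δ (p ℕ.* q ℕ.* r) ∎

-- Zeros of Ψ and products with truncated polynomials.

module Windows (R : CommutativeRing 0ℓ 0ℓ) where
  open Polynomials
  open Functionals R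
  open CommutativeRing R renaming (Carrier to C)
  open import Algebra.Properties.Ring ring using (-0#≈0#)
  open import Algebra.Properties.Semiring.Sum semiring using (sum; sum-replicate-zero)
  open import Data.Fin.Base using (Fin)
  open import Data.Nat.Base as ℕ using (ℕ; zero; suc; _≤_)
  import Data.Nat.Properties as ℕ
  import Relation.Binary.PropositionalEquality as ≡
  open import Algebra.Properties.Semiring.Exp semiring using (_^_; ^-homo-*; ^-assocʳ; ^-congˡ; ^-congʳ)
  open import Data.Sum.Base using (_⊎_; inj₁; inj₂)
  open import Relation.Nullary.Decidable using (yes; no)
  open import Relation.Nullary.Negation using (contradiction)
  open import Relation.Binary.Reasoning.Setoid setoid

  -- Over a general commutative ring this is what dividing out a factor requires; it plays the part
  -- of being nonzero.
  Cancellable : C → Set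
  Cancellable y = ∀ w → y * w ≈ 0# → w ≈ 0#

  eval-⊡ : ∀ P Q z → ⟦ P ⊡ Q ⟧ (z ^_) ≈ ⟦ P ⟧ (z ^_) * ⟦ Q ⟧ (z ^_)
  eval-⊡ P Q z = trans (⟦⟧-cong P λ a → trans
    (⟦⟧-cong Q λ b → ^-homo-* z a b) (trans (⟦⟧-* Q _ _) (*-comm _ _))) (trans (⟦⟧-* P _ _) (*-comm _ _))

  eval-Δ : ∀ z a → z ^ a ≈ 1# → ⟦ Δ a ⟧ (z ^_) ≈ 0#
  eval-Δ z a e = trans (+-congˡ (-‿cong e)) (-‿inverseʳ 1#)

  pow-one : ∀ z a b → z ^ a ≈ 1# → z ^ (a ℕ.* b) ≈ 1#
  pow-one z a b e = trans (sym (^-assocʳ z a b)) (trans (^-congˡ b e) (1^ b))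
    where
    1^ : ∀ b → 1# ^ b ≈ 1#
    1^ zero = refl
    1^ (suc b) = trans (*-identityˡ _) (1^ b)

  module _ {p q} (W : Cofactors p q) (r : ℕ) where

    module _ (z : C) (dec : ∀ k → z ^ k ≈ 1# ⊎ Cancellable (⟦ Δ k ⟧ (z ^_))) where

      -- Each of the exponents q r, p r and p q is responsible for one factor of Ψ; here it is 1 -
      -- x^(rq).
      eval-Ψ-qr : z ^ (r ℕ.* q) ≈ 1# → ⟦ Ψ W r ⟧ (z ^_) ≈ 0#
      eval-Ψ-qr e = begin
        ⟦ Ψ W r ⟧ (z ^_)                ≈⟨ eval-⊡ (Φ W 1) (G r p ⊡ Δ (r ℕ.* q)) z ⟩
        _ * ⟦ G r p ⊡ Δ (r ℕ.* q) ⟧ (z ^_)   ≈⟨ *-congˡ (eval-⊡ (G r p) (Δ (r ℕ.* q)) z) ⟩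
        _ * (_ * ⟦ Δ (r ℕ.* q) ⟧ (z ^_))     ≈⟨ *-congˡ (*-congˡ (eval-Δ z (r ℕ.* q) e)) ⟩
        _ * (_ * 0#)                       ≈⟨ trans (*-congˡ (zeroʳ _)) (zeroʳ _) ⟩
        0#                                 ∎

      -- The factor (1 - x^(rp)) / (1 - x^r) vanishes at z unless z^r = 1, and that case falls under
      -- `eval-Ψ-qr`.
      eval-Ψ-pr : z ^ (r ℕ.* p) ≈ 1# → ⟦ Ψ W r ⟧ (z ^_) ≈ 0#
      eval-Ψ-pr e with dec r
      ... | inj₁ e′ = eval-Ψ-qr (pow-one z r q e′)
      ... | inj₂ cancel = begin
        ⟦ Ψ W r ⟧ (z ^_)                        ≈⟨ eval-⊡ (Φ W 1) (G r p ⊡ Δ (r ℕ.* q)) z ⟩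
        _ * ⟦ G r p ⊡ Δ (r ℕ.* q) ⟧ (z ^_)           ≈⟨ *-congˡ (eval-⊡ (G r p) (Δ (r ℕ.* q)) z) ⟩
        _ * (⟦ G r p ⟧ (z ^_) * _)                 ≈⟨ *-congˡ (*-congʳ (cancel _ G≈0)) ⟩
        _ * (0# * _)                               ≈⟨ trans (*-congˡ (zeroˡ _)) (zeroʳ _) ⟩
        0#                                         ∎
        where
        G≈0 : ⟦ Δ r ⟧ (z ^_) * ⟦ G r p ⟧ (z ^_) ≈ 0#
        G≈0 = begin
          ⟦ Δ r ⟧ (z ^_) * ⟦ G r p ⟧ (z ^_)   ≈⟨ *-comm _ _ ⟩
          ⟦ G r p ⟧ (z ^_) * ⟦ Δ r ⟧ (z ^_)   ≈⟨ eval-⊡ (G r p) (Δ r) z ⟨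
          ⟦ G r p ⊡ Δ r ⟧ (z ^_)              ≈⟨ at (G-Δ r p) (z ^_) ⟩
          ⟦ Δ (r ℕ.* p) ⟧ (z ^_)              ≈⟨ eval-Δ z (r ℕ.* p) e ⟩
          0#                                  ∎

      -- The factor Φ_pq vanishes at z when 1 - z^p and 1 - z^q can be cancelled; if z^p or z^q is
      -- 1, a previous lemma applies.
      eval-Ψ-pq : z ^ (p ℕ.* q) ≈ 1# → ⟦ Ψ W r ⟧ (z ^_) ≈ 0#
      eval-Ψ-pq e with dec p | dec q
      ... | inj₁ e′ | _ = eval-Ψ-pr (trans (^-congʳ z (ℕ.*-comm r p)) (pow-one z p r e′))
      ... | inj₂ _ | inj₁ e′ = eval-Ψ-qr (trans (^-congʳ z (ℕ.*-comm r q)) (pow-one z q r e′))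
      ... | inj₂ cancel-p | inj₂ cancel-q = begin
        ⟦ Ψ W r ⟧ (z ^_)    ≈⟨ eval-⊡ (Φ W 1) (G r p ⊡ Δ (r ℕ.* q)) z ⟩
        f * _               ≈⟨ *-congʳ f≈0 ⟩
        0# * _              ≈⟨ zeroˡ _ ⟩
        0#                  ∎
        where
        f g δp δq : C
        f = ⟦ Φ W 1 ⟧ (z ^_)
        g = ⟦ G 1 p ⟧ (z ^_)
        δp = ⟦ Δ p ⟧ (z ^_)
        δq = ⟦ Δ q ⟧ (z ^_)
        fg≈0 : f * g ≈ 0#
        fg≈0 = cancel-q _ (begin
          δq * (f * g)     ≈⟨ *-comm _ _ ⟩
          f * g * δq       ≈⟨ *-assoc _ _ _ ⟩
          f * (g * δq)     ≈⟨ *-congˡ (eval-⊡ (G 1 p) (Δ q) z) ⟨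
          f * ⟦ G 1 p ⊡ Δ q ⟧ (z ^_)    ≈⟨ eval-⊡ (Φ W 1) (G 1 p ⊡ Δ q) z ⟨
          ⟦ Φ W 1 ⊡ (G 1 p ⊡ Δ q) ⟧ (z ^_)
            ≡⟨ ≡.cong (λ k → ⟦ Φ W 1 ⊡ (G 1 p ⊡ Δ k) ⟧ (z ^_)) (ℕ.*-identityˡ q) ⟨
          ⟦ Φ W 1 ⊡ (G 1 p ⊡ Δ (1 ℕ.* q)) ⟧ (z ^_)   ≈⟨ at (Φ-G-Δ W 1) (z ^_) ⟩
          ⟦ Δ (1 ℕ.* (p ℕ.* q)) ⟧ (z ^_)
            ≈⟨ eval-Δ z (1 ℕ.* (p ℕ.* q)) (trans (^-congʳ z (ℕ.*-identityˡ (p ℕ.* q))) e) ⟩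
          0#               ∎)
        -- As 1 - z^p is (1 - z) `g`, it can be cancelled in place of `g`.
        f≈0 : f ≈ 0#
        f≈0 = cancel-p _ (begin
          δp * f                              ≡⟨ ≡.cong (λ k → ⟦ Δ k ⟧ (z ^_) * f) (ℕ.*-identityˡ p) ⟨
          ⟦ Δ (1 ℕ.* p) ⟧ (z ^_) * f          ≈⟨ *-congʳ (at (G-Δ 1 p) (z ^_)) ⟨
          ⟦ G 1 p ⊡ Δ 1 ⟧ (z ^_) * f          ≈⟨ *-congʳ (eval-⊡ (G 1 p) (Δ 1) z) ⟩
          g * _ * f                           ≈⟨ trans (*-comm _ _) (sym (*-assoc _ _ _)) ⟩
          f * g * _                           ≈⟨ *-congʳ fg≈0 ⟩
          0# * _                              ≈⟨ zeroˡ _ ⟩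
          0#                                  ∎)

  truncate : ℕ → (ℕ → C) → ℕ → C
  truncate j φ k with k ℕ.≤? j
  ... | yes _ = φ k
  ... | no _ = 0#

  truncate-≤ : ∀ {j k} φ → k ≤ j → truncate j φ k ≈ φ k
  truncate-≤ {j} {k} φ k≤j with k ℕ.≤? j
  ... | yes _ = refl
  ... | no k≰j = contradiction k≤j k≰j

  truncate-> : ∀ {j k} φ → j ℕ.< k → truncate j φ k ≈ 0#
  truncate-> {j} {k} φ j<k with k ℕ.≤? j
  ... | yes k≤j = contradiction k≤j (ℕ.<⇒≱ j<k)
  ... | no _ = refl

  truncate-lift : ∀ {j} {φ ψ : ℕ → C} (_~_ : C → C → Set) → 0# ~ 0# →
    (∀ k → φ k ~ ψ k) → ∀ k → truncate j φ k ~ truncate j ψ k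
  truncate-lift {j} _~_ z h k with k ℕ.≤? j
  ... | yes _ = h k
  ... | no _ = z

  -- The product of P with the terms of Q of degree at most j.
  window : (P Q : Poly) → ℕ → (ℕ → C) → C
  window P Q j φ = ⟦ P ⟧ λ a → ⟦ Q ⟧ (truncate j λ b → φ (a ℕ.+ b))

  module _ (P Q : Poly) where

    window-cong : ∀ j {φ ψ} → (∀ k → φ k ≈ ψ k) → window P Q j φ ≈ window P Q j ψ
    window-cong j h = ⟦⟧-cong P λ a → ⟦⟧-cong Q
      (truncate-lift {j} _≈_ refl λ b → h (a ℕ.+ b))

    window-* : ∀ j z φ → window P Q j (λ k → z * φ k) ≈ z * window P Q j φ
    window-* j z φ = trans
      (⟦⟧-cong P λ a → trans
        (⟦⟧-cong Q (λ b → sym (trunc-* (λ b → φ (a ℕ.+ b)) b))) (⟦⟧-* Q z (truncate j λ b → φ (a ℕ.+ b))))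
      (⟦⟧-* P z λ a → ⟦ Q ⟧ (truncate j λ b → φ (a ℕ.+ b)))
      where
      trunc-* : ∀ φ b → z * truncate j φ b ≈ truncate j (λ b → z * φ b) b
      trunc-* φ b with b ℕ.≤? j
      ... | yes _ = refl
      ... | no _ = zeroʳ z

    window-sum : ∀ j {m} (φ : Fin m → ℕ → C) →
      window P Q j (λ k → sum λ i → φ i k) ≈ sum λ i → window P Q j (φ i)
    window-sum j {m} φ = trans
      (⟦⟧-cong P λ a → trans
        (⟦⟧-cong Q (trunc-sum λ i b → φ i (a ℕ.+ b))) (⟦⟧-sum Q λ i → truncate j λ b → φ i (a ℕ.+ b)))
      (⟦⟧-sum P λ i a → ⟦ Q ⟧ (truncate j λ b → φ i (a ℕ.+ b)))
      where
      trunc-sum : ∀ (φ : Fin m → ℕ → C) b →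
        truncate j (λ b → sum λ i → φ i b) b ≈ sum λ i → truncate j (φ i) b
      trunc-sum φ b with b ℕ.≤? j
      ... | yes _ = refl
      ... | no _ = sym (sum-replicate-zero m)

    -- Truncation concerns the second factor only, so the value of P at h still splits off.
    window-root : ∀ j {φ h ψ} → (∀ a b → φ (a ℕ.+ b) ≈ h a * ψ b) →
      ⟦ P ⟧ h ≈ 0# → window P Q j φ ≈ 0#
    window-root j {φ} {h} {ψ} split root = begin
      window P Q j φ
        ≈⟨ ⟦⟧-cong P (λ a → trans (⟦⟧-cong Q (λ b → trunc-split a b))
             (trans (⟦⟧-* Q (h a) (truncate j ψ)) (*-comm _ _))) ⟩
      ⟦ P ⟧ (λ a → ⟦ Q ⟧ (truncate j ψ) * h a)
        ≈⟨ ⟦⟧-* P (⟦ Q ⟧ (truncate j ψ)) h ⟩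
      ⟦ Q ⟧ (truncate j ψ) * ⟦ P ⟧ h
        ≈⟨ trans (*-congˡ root) (zeroʳ _) ⟩
      0# ∎
      where
      trunc-split : ∀ a b → truncate j (λ b → φ (a ℕ.+ b)) b ≈ h a * truncate j ψ b
      trunc-split a b with b ℕ.≤? j
      ... | yes _ = split a b
      ... | no _ = sym (zeroʳ (h a))

    -- Truncating by b ≤ j and by a + b ≤ j differ only where b ≤ j < a + b, and there φ vanishes by
    -- the gap. So the window is the full product applied to the truncated sequence, and of (1 -
    -- x^N)² only the constant term meets an index up to j.
    window-δ : ∀ {j N φ} → P ⊡ Q ≋ Δ N ⊡ Δ N → j ℕ.< N →
      (∀ b → j ℕ.< b → b ≤ degree P ℕ.+ j → φ b ≈ 0#) → window P Q j φ ≈ φ 0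
    window-δ {j} {N} {φ} PQ≋ j<N gap = begin
      window P Q j φ
        ≈⟨ ⟦⟧-cong-≤ P (λ a a≤ → ⟦⟧-cong Q (move a a≤)) ⟩
      ⟦ P ⊡ Q ⟧ ψ
        ≈⟨ at PQ≋ ψ ⟩
      (ψ 0 - ψ N) - (ψ (N ℕ.+ 0) - ψ (N ℕ.+ N))
        ≈⟨ +-cong (+-congˡ (-‿cong (truncate-> φ j<N))) (-‿cong (+-cong
             (truncate-> φ (ℕ.<-≤-trans j<N (ℕ.m≤m+n N 0)))
             (-‿cong (truncate-> φ (ℕ.<-≤-trans j<N (ℕ.m≤m+n N N)))))) ⟩
      (ψ 0 - 0#) - (0# - 0#)
        ≈⟨ +-cong (+-congˡ -0#≈0#) (-‿cong (-‿inverseʳ 0#)) ⟩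
      (ψ 0 + 0#) - 0#
        ≈⟨ trans (+-congˡ -0#≈0#) (trans (+-identityʳ _) (+-identityʳ _)) ⟩
      ψ 0
        ≈⟨ truncate-≤ {j} φ ℕ.z≤n ⟩
      φ 0 ∎
      where
      ψ = truncate j φ
      move : ∀ a → a ≤ degree P → ∀ b → truncate j (λ b → φ (a ℕ.+ b)) b ≈ ψ (a ℕ.+ b)
      move a a≤ b with b ℕ.≤? j | a ℕ.+ b ℕ.≤? j
      ... | yes b≤j | yes _ = refl
      ... | yes b≤j | no a+b≰j = gap (a ℕ.+ b) (ℕ.≰⇒> a+b≰j) (ℕ.+-mono-≤ a≤ b≤j)
      ... | no b≰j | yes a+b≤j = contradiction (ℕ.m+n≤o⇒n≤o a a+b≤j) b≰j
      ... | no _ | no _ = refl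

  module _ (Bounded : ℕ → C → Set) (bounded-0 : ∀ {b} → Bounded b 0#)
    (bounded-neg : ∀ {b x} → Bounded b x → Bounded b (- x))
    (bounded-+ : ∀ {a b x y} → Bounded a x → Bounded b y → Bounded (a ℕ.+ b) (x + y)) where

    -- Only the triangle inequality enters, so any family of bounds closed under negation and sums
    -- will do.
    ⟦⟧-bounded : ∀ P {b φ} → (∀ k → Bounded b (φ k)) → Bounded (weight P ℕ.* b) (⟦ P ⟧ φ)
    ⟦⟧-bounded (x^ e) {b} {φ} h = ≡.subst (λ c → Bounded c (φ e)) (≡.sym (ℕ.*-identityˡ b)) (h e)
    ⟦⟧-bounded 𝟎 h = bounded-0
    ⟦⟧-bounded (⊖ P) h = bounded-neg (⟦⟧-bounded P h)
    ⟦⟧-bounded (P ⊞ Q) {b} {φ} h = ≡.subst (λ c → Bounded c (⟦ P ⊞ Q ⟧ φ))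
      (≡.sym (ℕ.*-distribʳ-+ b (weight P) (weight Q)))
      (bounded-+ (⟦⟧-bounded P h) (⟦⟧-bounded Q h))
    ⟦⟧-bounded (P ⊡ Q) {b} {φ} h = ≡.subst (λ c → Bounded c (⟦ P ⊡ Q ⟧ φ))
      (≡.sym (ℕ.*-assoc (weight P) (weight Q) b))
      (⟦⟧-bounded P λ a → ⟦⟧-bounded Q λ b → h (a ℕ.+ b))

    window-bounded : ∀ P Q j {b φ} → (∀ k → Bounded b (φ k)) →
      Bounded (weight P ℕ.* (weight Q ℕ.* b)) (window P Q j φ)
    window-bounded P Q j {b} {φ} h = ⟦⟧-bounded P λ a → ⟦⟧-bounded Q (truncate-bounded a)
      where
      truncate-bounded : ∀ a k → Bounded b (truncate j (λ b → φ (a ℕ.+ b)) k)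
      truncate-bounded a k with k ℕ.≤? j
      ... | yes _ = h (a ℕ.+ k)
      ... | no _ = bounded-0

-- Injections of finite sets.

module FiniteCombinatorics where
  open import Data.Fin.Base using (Fin; zero; suc; punchOut)
  open import Data.Fin.Permutation using (Permutation′; permutation)
  open import Data.Fin.Properties using (_≟_; any?; injective⇒≤; punchOut-injective)
  open import Data.List.Base using (List; _∷_; lookup)
  open import Data.List.Membership.Propositional.Properties using (∈-lookup)
  import Data.List.Relation.Unary.All as All
  open import Data.List.Relation.Unary.AllPairs using (_∷_)
  open import Data.List.Relation.Unary.Unique.Propositional using (Unique)
  open import Data.Nat.Base using (suc)
  import Data.Nat.Properties as ℕ
  open import Data.Product.Base using (∃-syntax; _,_; proj₁; proj₂)
  open import Function.Definitions using (Injective)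
  open import Relation.Binary.PropositionalEquality using (_≡_; refl; sym; cong)
  open import Relation.Nullary.Decidable using (yes; no)
  open import Relation.Nullary.Negation using (contradiction)

  -- Pigeonhole: a missed value could be punched out, leaving an injection of `Fin (suc m)` into
  -- `Fin m`.
  injective⇒hits : ∀ {m} {f : Fin m → Fin m} → Injective _≡_ _≡_ f → ∀ j → ∃[ i ] f i ≡ j
  injective⇒hits {suc m} {f} inj j with any? (λ i → f i ≟ j)
  ... | yes hit = hit
  ... | no miss = contradiction
    (injective⇒≤ {f = λ i → punchOut {i = j} (λ j≡fi → miss (i , sym j≡fi))}
      (λ {x} {y} e → inj (punchOut-injective (λ j≡fi → miss (x , sym j≡fi)) (λ j≡fi → miss (y , sym j≡fi)) e)))
    ℕ.1+n≰n

  injective⇒permutation : ∀ {m} {f : Fin m → Fin m} → Injective _≡_ _≡_ f → Permutation′ m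
  injective⇒permutation {f = f} inj = permutation f (λ j → proj₁ (hits j))
    (λ j → proj₂ (hits j)) (λ i → inj (proj₂ (hits (f i))))
    where hits = injective⇒hits inj

  lookup-injective : ∀ {A : Set} {xs : List A} → Unique xs → Injective _≡_ _≡_ (lookup xs)
  lookup-injective (x≢ ∷ u) {zero} {zero} e = refl
  lookup-injective (x≢ ∷ u) {zero} {suc j} e = contradiction e (All.lookup x≢ (∈-lookup j))
  lookup-injective (x≢ ∷ u) {suc i} {zero} e = contradiction (sym e) (All.lookup x≢ (∈-lookup i))
  lookup-injective (x≢ ∷ u) {suc i} {suc j} e = cong suc (lookup-injective u e)

-- Finite sums in a ring.

module Sums (R : CommutativeRing 0ℓ 0ℓ) where
  open CommutativeRing R renaming (Carrier to C) hiding (zero)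
  open import Algebra.Properties.Semiring.Sum semiring
  open import Algebra.Properties.Semiring.Mult semiring using () renaming (_×_ to _·_)
  open import Data.Bool.Base using (if_then_else_)
  open import Data.Fin.Base using (Fin; zero; suc; toℕ)
  import Data.Fin.Properties as Fin
  open import Data.List.Base using ([]; _∷_; lookup; filter; applyUpTo)
  open import Data.Nat.Base using (ℕ; zero; suc)
  open import Relation.Nullary.Decidable using (yes; no; does)
  open import Relation.Nullary.Negation using (¬_)
  open import Relation.Unary using (Decidable)
  open import Relation.Binary.Reasoning.Setoid setoid

  -- Of the same form as `identity`, so that over ℂ equations between sums are the matrix equations
  -- of `Invertible` as they stand.
  kronecker : ∀ {m} → Fin m → Fin m → C
  kronecker i j = if does (i Fin.≟ j) then 1# else 0#

  sum-zero : ∀ {m} {f : Fin m → C} → (∀ i → f i ≈ 0#) → sum f ≈ 0#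
  sum-zero {m} h = trans (sum-cong-≋ h) (sum-replicate-zero m)

  sum-ones : ∀ m → sum {m} (λ _ → 1#) ≈ m · 1#
  sum-ones zero = refl
  sum-ones (suc m) = +-congˡ (sum-ones m)

  sum-kroneckerʳ : ∀ {m} (f : Fin m → C) j → sum (λ i → f i * kronecker i j) ≈ f j
  sum-kroneckerʳ {suc m} f zero = begin
    f zero * 1# + sum (λ i → f (suc i) * 0#)   ≈⟨ +-cong (*-identityʳ _) (sum-zero {m} λ i → zeroʳ _) ⟩
    f zero + 0#                                ≈⟨ +-identityʳ _ ⟩
    f zero                                     ∎
  sum-kroneckerʳ {suc m} f (suc j) = begin
    f zero * 0# + sum (λ i → f (suc i) * kronecker i j)
      ≈⟨ +-cong (zeroʳ _) (sum-kroneckerʳ (λ i → f (suc i)) j) ⟩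
    0# + f (suc j)   ≈⟨ +-identityˡ _ ⟩
    f (suc j)        ∎

  sum-kroneckerˡ : ∀ {m} (f : Fin m → C) i → sum (λ j → kronecker i j * f j) ≈ f i
  sum-kroneckerˡ {suc m} f zero = begin
    1# * f zero + sum (λ i → 0# * f (suc i))   ≈⟨ +-cong (*-identityˡ _) (sum-zero {m} λ i → zeroˡ _) ⟩
    f zero + 0#                                ≈⟨ +-identityʳ _ ⟩
    f zero                                     ∎
  sum-kroneckerˡ {suc m} f (suc i) = begin
    0# * f zero + sum (λ j → kronecker i j * f (suc j))
      ≈⟨ +-cong (zeroˡ _) (sum-kroneckerˡ (λ j → f (suc j)) i) ⟩
    0# + f (suc i)   ≈⟨ +-identityˡ _ ⟩
    f (suc i)        ∎

  sum-filter : ∀ {A : Set} {P : A → Set} (P? : Decidable P) (g : A → C) →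
    (∀ x → ¬ P x → g x ≈ 0#) → ∀ xs →
    sum (λ i → g (lookup (filter P? xs) i)) ≈ sum (λ i → g (lookup xs i))
  sum-filter P? g h [] = refl
  sum-filter P? g h (x ∷ xs) with P? x
  ... | yes _ = +-congˡ (sum-filter P? g h xs)
  ... | no ¬Px = trans (sum-filter P? g h xs)
    (sym (trans (+-congʳ (h x ¬Px)) (+-identityˡ _)))

  sum-applyUpTo : ∀ (g : ℕ → C) f n →
    sum (λ i → g (lookup (applyUpTo f n) i)) ≈ sum {n} (λ i → g (f (toℕ i)))
  sum-applyUpTo g f zero = refl
  sum-applyUpTo g f (suc n) = +-congˡ (sum-applyUpTo g (λ i → f (suc i)) n)

-- Vandermonde systems.

module VandermondeInverse (R : CommutativeRing 0ℓ 0ℓ) where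
  open CommutativeRing R renaming (Carrier to C) hiding (zero)
  open Sums R
  open Windows R using (Cancellable)
  open import Algebra.Properties.Ring ring using (x≈y⇒x∙y⁻¹≈ε; x∙y⁻¹≈ε⇒x≈y; x[y-z]≈xy-xz; //-rightDividesˡ; +-cancelʳ)
  open import Algebra.Properties.Semiring.Sum semiring
  open import Algebra.Properties.Semiring.Exp semiring using (_^_)
  open import Data.Fin.Base using (Fin; zero; suc; toℕ; fromℕ<)
  open import Data.Fin.Properties using (suc-injective; toℕ<n; toℕ-fromℕ<)
  open import Algebra.Properties.CommutativeSemigroup *-commutativeSemigroup using (x∙yz≈y∙xz)
  open import Algebra.Properties.CommutativeSemigroup +-commutativeSemigroup
    using () renaming (x∙yz≈y∙xz to +-x∙yz≈y∙xz)
  open import Data.Nat.Base using (ℕ; suc; _≤_; s≤s)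
  import Data.Nat.Properties as ℕ
  open import Relation.Binary.PropositionalEquality as ≡ using (_≢_)
  open import Relation.Binary.Reasoning.Setoid setoid

  cancel-≈ : ∀ {y a b} → Cancellable y → a * y ≈ b * y → a ≈ b
  cancel-≈ {y} {a} {b} cancel e = x∙y⁻¹≈ε⇒x≈y a b (cancel (a - b)
    (trans (x[y-z]≈xy-xz y a b) (x≈y⇒x∙y⁻¹≈ε (trans (*-comm y a) (trans e (*-comm b y))))))

  -- Subtracting ζ₀ times the l-th equation from the (l+1)-st eliminates y₀.
  vandermonde-cancel : ∀ {m} (ζ : Fin m → C) → (∀ i j → i ≢ j → Cancellable (ζ i - ζ j)) →
    (y y′ : Fin m → C) →
    (∀ (l : Fin m) → sum (λ i → y i * ζ i ^ toℕ l) ≈ sum (λ i → y′ i * ζ i ^ toℕ l)) →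
    ∀ i → y i ≈ y′ i
  vandermonde-cancel {suc m} ζ apart y y′ eqs = all
    where
    power-sum : (Fin (suc m) → C) → ℕ → C
    power-sum y l = sum λ i → y i * ζ i ^ l

    eliminated : (Fin (suc m) → C) → Fin m → C
    eliminated y i = y (suc i) * (ζ (suc i) - ζ zero)

    term : ∀ a z w v → a * (z * v) ≈ a * (z - w) * v + w * (a * v)
    term a z w v = begin
      a * (z * v)                          ≈⟨ *-congˡ (*-congʳ (//-rightDividesˡ w z)) ⟨
      a * ((z - w + w) * v)                ≈⟨ *-congˡ (distribʳ v (z - w) w) ⟩
      a * ((z - w) * v + w * v)            ≈⟨ distribˡ a _ _ ⟩
      a * ((z - w) * v) + a * (w * v)      ≈⟨ +-cong (sym (*-assoc _ _ _)) (x∙yz≈y∙xz a w v) ⟩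
      a * (z - w) * v + w * (a * v)        ∎

    step : ∀ y l → power-sum y (suc l) ≈
      sum (λ i → eliminated y i * ζ (suc i) ^ l) + ζ zero * power-sum y l
    step y l = begin
      y zero * (ζ zero * ζ zero ^ l) + sum (λ i → y (suc i) * (ζ (suc i) * ζ (suc i) ^ l))
        ≈⟨ +-cong (x∙yz≈y∙xz (y zero) (ζ zero) (ζ zero ^ l))
             (sum-cong-≋ λ i → term (y (suc i)) (ζ (suc i)) (ζ zero) (ζ (suc i) ^ l)) ⟩
      ζ zero * (y zero * ζ zero ^ l) +
        sum (λ i → eliminated y i * ζ (suc i) ^ l + ζ zero * (y (suc i) * ζ (suc i) ^ l))
        ≈⟨ +-congˡ (trans (∑-distrib-+ (λ i → eliminated y i * ζ (suc i) ^ l) _)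
             (+-congˡ (sym (*-distribˡ-sum (ζ zero) (λ i → y (suc i) * ζ (suc i) ^ l))))) ⟩
      ζ zero * (y zero * ζ zero ^ l) +
        (sum (λ i → eliminated y i * ζ (suc i) ^ l) +
          ζ zero * sum (λ i → y (suc i) * ζ (suc i) ^ l))
        ≈⟨ +-x∙yz≈y∙xz _ _ _ ⟩
      sum (λ i → eliminated y i * ζ (suc i) ^ l) +
        (ζ zero * (y zero * ζ zero ^ l) + ζ zero * sum (λ i → y (suc i) * ζ (suc i) ^ l))
        ≈⟨ +-congˡ (distribˡ (ζ zero) _ _) ⟨
      sum (λ i → eliminated y i * ζ (suc i) ^ l) + ζ zero * power-sum y l ∎

    power-sums : ∀ l → l ≤ m → power-sum y l ≈ power-sum y′ l
    power-sums l l≤m = ≡.subst (λ k → power-sum y k ≈ power-sum y′ k)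
      (toℕ-fromℕ< (s≤s l≤m)) (eqs (fromℕ< (s≤s l≤m)))

    -- Elimination leaves a Vandermonde system of size m in the unknowns y (suc i) (ζ (suc i) - ζ
    -- zero), whose second factor is then cancelled.
    tail : ∀ i → y (suc i) ≈ y′ (suc i)
    tail i = cancel-≈ (apart (suc i) zero λ ()) (vandermonde-cancel (λ i → ζ (suc i))
      (λ i j i≢j → apart (suc i) (suc j) (λ e → i≢j (suc-injective e)))
      (eliminated y) (eliminated y′)
      (λ l → +-cancelʳ (ζ zero * power-sum y (toℕ l)) _ _ (begin
        sum (λ i → eliminated y i * ζ (suc i) ^ toℕ l) + ζ zero * power-sum y (toℕ l)
          ≈⟨ step y (toℕ l) ⟨
        power-sum y (suc (toℕ l))
          ≈⟨ power-sums (suc (toℕ l)) (toℕ<n l) ⟩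
        power-sum y′ (suc (toℕ l))
          ≈⟨ step y′ (toℕ l) ⟩
        sum (λ i → eliminated y′ i * ζ (suc i) ^ toℕ l) + ζ zero * power-sum y′ (toℕ l)
          ≈⟨ +-congˡ (*-congˡ (power-sums (toℕ l) (ℕ.<⇒≤ (toℕ<n l)))) ⟨
        sum (λ i → eliminated y′ i * ζ (suc i) ^ toℕ l) + ζ zero * power-sum y (toℕ l) ∎))
      i)

    all : ∀ i → y i ≈ y′ i
    -- All other unknowns agree, so the equation with exponent 0 settles the remaining one.
    all zero = trans (sym (*-identityʳ _)) (trans (+-cancelʳ _ _ _ (trans (eqs zero)
      (+-congˡ (sym (sum-cong-≋ λ i → *-congʳ (tail i)))))) (*-identityʳ _))
    all (suc i) = tail i

  -- If X V = I then (V X) V = V = I V, and `vandermonde-cancel` removes V on the right, row by row.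
  -- No determinant is involved.
  vandermonde-inverseʳ : ∀ {m} (ζ : Fin m → C) → (∀ i j → i ≢ j → Cancellable (ζ i - ζ j)) →
    (X : Fin m → Fin m → C) →
    (∀ j l → sum (λ i → X j i * ζ i ^ toℕ l) ≈ kronecker j l) →
    ∀ i k → sum (λ j → ζ i ^ toℕ j * X j k) ≈ kronecker i k
  vandermonde-inverseʳ {m} ζ apart X XV i = vandermonde-cancel ζ apart _ _ λ l → begin
    sum (λ k → sum (λ j → ζ i ^ toℕ j * X j k) * ζ k ^ toℕ l)
      ≈⟨ sum-cong-≋ {m} (λ k → trans (*-distribʳ-sum (ζ k ^ toℕ l) (λ j → ζ i ^ toℕ j * X j k))
           (sum-cong-≋ {m} λ j → *-assoc _ _ _)) ⟩
    sum (λ k → sum (λ j → ζ i ^ toℕ j * (X j k * ζ k ^ toℕ l)))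
      ≈⟨ ∑-comm (λ k j → ζ i ^ toℕ j * (X j k * ζ k ^ toℕ l)) ⟩
    sum (λ j → sum (λ k → ζ i ^ toℕ j * (X j k * ζ k ^ toℕ l)))
      ≈⟨ sum-cong-≋ {m} (λ j → trans (sym (*-distribˡ-sum (ζ i ^ toℕ j) (λ k → X j k * ζ k ^ toℕ l)))
           (*-congˡ (XV j l))) ⟩
    sum (λ j → ζ i ^ toℕ j * kronecker j l)
      ≈⟨ sum-kroneckerʳ (λ j → ζ i ^ toℕ j) l ⟩
    ζ i ^ toℕ l
      ≈⟨ sum-kroneckerˡ (λ k → ζ k ^ toℕ l) i ⟨
    sum (λ k → kronecker i k * ζ k ^ toℕ l) ∎

-- Roots of unity and the orthogonality of their powers.

module RootsOfUnity (R : CommutativeRing 0ℓ 0ℓ) where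
  open CommutativeRing R renaming (Carrier to C) hiding (zero)
  open FiniteCombinatorics
  open Sums R
  open Windows R using (Cancellable; pow-one)
  open import Algebra.Properties.Ring ring using (x≈y⇒x∙y⁻¹≈ε; x∙y⁻¹≈ε⇒x≈y; x[y-z]≈xy-xz)
  open import Algebra.Properties.CommutativeSemigroup *-commutativeSemigroup using (x∙yz≈y∙xz)
  open import Algebra.Properties.Semiring.Sum semiring
  open import Algebra.Properties.Semiring.Exp semiring using (_^_; ^-homo-*; ^-assocʳ; ^-congˡ; ^-congʳ)
  open import Algebra.Properties.Semiring.Mult semiring using () renaming (_×_ to _·_)
  open import Data.Bool.Base using (if_then_else_)
  open import Data.Fin.Base using (Fin; zero; suc; toℕ)
  open import Data.List.Base using (List; lookup; filter; map; upTo; applyUpTo)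
  open import Data.List.Membership.Propositional using (_∈_)
  open import Data.List.Membership.Propositional.Properties
    using (∈-lookup; ∈-filter⁻; ∈-applyUpTo⁻)
  open import Data.List.Properties using (map-upTo)
  open import Data.List.Relation.Unary.Unique.Propositional using (Unique)
  import Data.List.Relation.Unary.Unique.Propositional.Properties as Unique
  open import Data.Nat.Base as ℕ using (ℕ; suc; _≤_; _<_; z≤n; s≤s)
  open import Data.Nat.Coprimality as Coprime using (Coprime; coprime?; coprime-divisor)
  open import Data.Nat.DivMod using (_%_; _/_; m≡m%n+[m/n]*n; m%n<n)
  open import Data.Nat.Divisibility using (_∣_; _∣?_; divides; m%n≡0⇒n∣m; ∣⇒≤)
  import Data.Nat.Properties as ℕ
  open import Data.Product.Base using (_×_; _,_; proj₁; proj₂; ∃-syntax)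
  open import Data.Sum.Base using (_⊎_; inj₁; inj₂)
  open import Function.Definitions using (Injective)
  open import Relation.Binary.PropositionalEquality as ≡ using (_≡_)
  open import Relation.Nullary.Decidable using (yes; no; does)
  open import Relation.Nullary.Negation using (¬_; contradiction)
  open import Relation.Binary.Reasoning.Setoid setoid

  IsPrimitive : ℕ → C → Set
  IsPrimitive n z = z ^ n ≈ 1# × (∀ k → 0 < k → k < n → ¬ (z ^ k ≈ 1#))

  indicator : ℕ → ℕ → C
  indicator n k = if does (n ∣? k) then 1# else 0#

  indicator-∣ : ∀ {n k} → n ∣ k → indicator n k ≈ 1#
  indicator-∣ {n} {k} n∣k with n ∣? k
  ... | yes _ = refl
  ... | no n∤k = contradiction n∣k n∤k

  indicator-∤ : ∀ {n k} → ¬ (n ∣ k) → indicator n k ≈ 0#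
  indicator-∤ {n} {k} n∤k with n ∣? k
  ... | yes n∣k = contradiction n∣k n∤k
  ... | no _ = refl

  geometric : ∀ z n → (1# - z) * sum {n} (λ i → z ^ toℕ i) ≈ 1# - z ^ n
  geometric z ℕ.zero = trans (zeroʳ _) (sym (-‿inverseʳ 1#))
  geometric z (suc n) = begin
    (1# - z) * (1# + sum {n} (λ i → z * z ^ toℕ i))
      ≈⟨ *-congˡ (+-congˡ (*-distribˡ-sum z (λ (i : Fin n) → z ^ toℕ i))) ⟨
    (1# - z) * (1# + z * S)
      ≈⟨ distribˡ (1# - z) 1# (z * S) ⟩
    (1# - z) * 1# + (1# - z) * (z * S)
      ≈⟨ +-cong (*-identityʳ _) (trans (x∙yz≈y∙xz _ z S) (*-congˡ (geometric z n))) ⟩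
    (1# - z) + z * (1# - z ^ n)
      ≈⟨ +-congˡ (trans (x[y-z]≈xy-xz z 1# (z ^ n)) (+-congʳ (*-identityʳ z))) ⟩
    (1# - z) + (z - z * z ^ n)
      ≈⟨ +-assoc 1# (- z) _ ⟩
    1# + (- z + (z - z * z ^ n))
      ≈⟨ +-congˡ (trans (sym (+-assoc (- z) z _)) (trans (+-congʳ (-‿inverseˡ z)) (+-identityˡ _))) ⟩
    1# - z * z ^ n ∎
    where
    S = sum {n} λ i → z ^ toℕ i

  power-root : ∀ {n z} e → z ^ n ≈ 1# → (z ^ e) ^ n ≈ 1#
  power-root {n} {z} e h = trans (^-assocʳ z e n) (trans (^-congʳ z (ℕ.*-comm e n)) (pow-one z n e h))

  *-cancellable : ∀ {a b} → Cancellable a → Cancellable b → Cancellable (a * b)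
  *-cancellable ca cb w e = cb w (ca _ (trans (sym (*-assoc _ _ w)) e))

  -- A root of unity is a unit, with inverse z^(n-1).
  root-cancellable : ∀ {n z} → 0 < n → z ^ n ≈ 1# → Cancellable z
  root-cancellable {suc n} {z} _ e w zw≈0 = begin
    w              ≈⟨ *-identityˡ w ⟨
    1# * w         ≈⟨ *-congʳ (trans (sym e) (*-comm z _)) ⟩
    z ^ n * z * w  ≈⟨ *-assoc _ _ _ ⟩
    z ^ n * (z * w) ≈⟨ trans (*-congˡ zw≈0) (zeroʳ _) ⟩
    0#             ∎

  module _ {n : ℕ} .{{_ : ℕ.NonZero n}}
    (dec : ∀ z → z ^ n ≈ 1# → z ≈ 1# ⊎ Cancellable (1# - z)) where

    private
      0<n : 0 < n
      0<n = ℕ.>-nonZero⁻¹ n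

    -- y - z = y (1 - z / y), where 1 / y is y^(n-1). The quotient z / y is again an n-th root of
    -- unity, so the dichotomy applies to it.
    roots-apart : ∀ {y z} → y ^ n ≈ 1# → z ^ n ≈ 1# → ¬ (y ≈ z) → Cancellable (y - z)
    roots-apart {y} {z} yⁿ≈1 zⁿ≈1 y≉z = go (dec (y⁻¹ * z) quotientⁿ)
      where
      open import Algebra.Properties.CommutativeSemiring.Exp commutativeSemiring using (^-distrib-*)
      y⁻¹ : C
      y⁻¹ = y ^ ℕ.pred n
      quotientⁿ : (y⁻¹ * z) ^ n ≈ 1#
      quotientⁿ = begin
        (y⁻¹ * z) ^ n      ≈⟨ ^-distrib-* y⁻¹ z n ⟩
        y⁻¹ ^ n * z ^ n    ≈⟨ *-cong (power-root {n} {y} (ℕ.pred n) yⁿ≈1) zⁿ≈1 ⟩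
        1# * 1#            ≈⟨ *-identityˡ 1# ⟩
        1#                 ∎
      y*y⁻¹z : y * (y⁻¹ * z) ≈ z
      y*y⁻¹z = trans (sym (*-assoc y y⁻¹ z)) (trans
        (*-congʳ (trans (^-congʳ y (ℕ.suc-pred n)) yⁿ≈1)) (*-identityˡ z))
      go : y⁻¹ * z ≈ 1# ⊎ Cancellable (1# - y⁻¹ * z) → Cancellable (y - z)
      go (inj₁ y⁻¹z≈1) = contradiction (begin
        y                ≈⟨ *-identityʳ y ⟨
        y * 1#           ≈⟨ *-congˡ y⁻¹z≈1 ⟨
        y * (y⁻¹ * z)    ≈⟨ y*y⁻¹z ⟩
        z                ∎) y≉z
      go (inj₂ cancel) w e = *-cancellable (root-cancellable 0<n yⁿ≈1) cancel w (begin
        y * (1# - y⁻¹ * z) * w          ≈⟨ *-congʳ (x[y-z]≈xy-xz y 1# _) ⟩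
        (y * 1# - y * (y⁻¹ * z)) * w    ≈⟨ *-congʳ (+-cong (*-identityʳ y) (-‿cong y*y⁻¹z)) ⟩
        (y - z) * w                     ≈⟨ e ⟩
        0#                              ∎)

    module _ {ω : C} (ω-primitive : IsPrimitive n ω) where

      ωⁿ≈1 : ω ^ n ≈ 1#
      ωⁿ≈1 = proj₁ ω-primitive

      power-one⇒∣ : ∀ k → ω ^ k ≈ 1# → n ∣ k
      power-one⇒∣ k e with k % n in eq
      ... | ℕ.zero = m%n≡0⇒n∣m k n eq
      ... | suc j = contradiction (begin
        ω ^ suc j                         ≈⟨ *-identityʳ _ ⟨
        ω ^ suc j * 1#                    ≈⟨ *-congˡ (trans (^-congʳ ω (ℕ.*-comm (k / n) n))
            (pow-one ω n (k / n) ωⁿ≈1)) ⟨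
        ω ^ suc j * ω ^ (k / n ℕ.* n)     ≈⟨ ^-homo-* ω (suc j) (k / n ℕ.* n) ⟨
        ω ^ (suc j ℕ.+ k / n ℕ.* n)       ≈⟨ ^-congʳ ω (≡.trans (≡.cong (ℕ._+ k / n ℕ.* n) (≡.sym eq))
            (≡.sym (m≡m%n+[m/n]*n k n))) ⟩
        ω ^ k                             ≈⟨ e ⟩
        1#                                ∎)
        (proj₂ ω-primitive (suc j) (s≤s z≤n) (≡.subst (_< n) eq (m%n<n k n)))

      ∣⇒power-one : ∀ {k} → n ∣ k → ω ^ k ≈ 1#
      ∣⇒power-one (divides c ≡.refl) = trans (^-congʳ ω (ℕ.*-comm c n)) (pow-one ω n c ωⁿ≈1)

      power-primitive : ∀ {e} → Coprime e n → IsPrimitive n (ω ^ e)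
      power-primitive {e} e⊥n = trans (^-assocʳ ω e n) (∣⇒power-one (divides e ≡.refl))
        , λ k 0<k k<n e≈1 → ℕ.<⇒≱ k<n (∣⇒≤ {{ℕ.>-nonZero 0<k}} (coprime-divisor (Coprime.sym e⊥n)
            (power-one⇒∣ (e ℕ.* k) (trans (sym (^-assocʳ ω e k)) e≈1))))

      -- The exponents run over 1, ..., n, the range over which `φ` counts, instead of 0, ..., n -
      -- 1; this only puts a factor `ω ^ k` in front of the geometric sum.
      sum-powers : ∀ k → sum {n} (λ i → (ω ^ suc (toℕ i)) ^ k) ≈ n · 1# * indicator n k
      sum-powers k = trans (sum-cong-≋ {n} λ i → swap (suc (toℕ i))) (go (n ∣? k))
        where
        swap : ∀ i → (ω ^ i) ^ k ≈ (ω ^ k) ^ i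
        swap i = trans (^-assocʳ ω i k) (trans (^-congʳ ω (ℕ.*-comm i k)) (sym (^-assocʳ ω k i)))
        powⁿ : (ω ^ k) ^ n ≈ 1#
        powⁿ = trans (^-assocʳ ω k n) (∣⇒power-one (divides k ≡.refl))
        one^ : ∀ i → 1# ^ i ≈ 1#
        one^ ℕ.zero = refl
        one^ (suc i) = trans (*-identityˡ _) (one^ i)
        go : _ → sum {n} (λ i → (ω ^ k) ^ suc (toℕ i)) ≈ n · 1# * indicator n k
        go (yes n∣k) = begin
          sum {n} (λ i → (ω ^ k) ^ suc (toℕ i))  ≈⟨ sum-cong-≋ {n} (λ i → trans
            (^-congˡ (suc (toℕ i)) (∣⇒power-one n∣k)) (one^ (suc (toℕ i)))) ⟩
          sum {n} (λ i → 1#)       ≈⟨ sum-ones n ⟩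
          n · 1#                   ≈⟨ *-identityʳ _ ⟨
          n · 1# * 1#              ≈⟨ *-congˡ (indicator-∣ n∣k) ⟨
          n · 1# * indicator n k   ∎
        go (no n∤k) with dec (ω ^ k) powⁿ
        ... | inj₁ e = contradiction (power-one⇒∣ k e) n∤k
        ... | inj₂ cancel = begin
          sum {n} (λ i → (ω ^ k) ^ suc (toℕ i))         ≈⟨ *-distribˡ-sum (ω ^ k) (λ (i : Fin n) → (ω ^ k) ^ toℕ i) ⟨
          ω ^ k * sum {n} (λ i → (ω ^ k) ^ toℕ i)       ≈⟨ *-congˡ (cancel _ (trans (geometric (ω ^ k) n)
            (x≈y⇒x∙y⁻¹≈ε (sym powⁿ)))) ⟩
          ω ^ k * 0#               ≈⟨ trans (zeroʳ _) (sym (zeroʳ _)) ⟩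
          n · 1# * 0#              ≈⟨ *-congˡ (indicator-∤ n∤k) ⟨
          n · 1# * indicator n k   ∎

      -- The bounds 0 < a and b ≤ n leave b - a < n, so ω^(b-a) = 1 contradicts primitivity unless b
      -- = a.
      power-injective-≤ : ∀ {a b} → a ≤ b → 0 < a → b ≤ n → ω ^ a ≈ ω ^ b → a ≡ b
      power-injective-≤ {a} {b} a≤b 0<a b≤n e = ℕ.≤-antisym a≤b (ℕ.m∸n≡0⇒m≤n (small (b ℕ.∸ a)
        (ℕ.<-≤-trans (ℕ.∸-monoʳ-< 0<a a≤b) b≤n)
        (x∙y⁻¹≈ε⇒x≈y _ _ (root-cancellable {n} 0<n ωᵃⁿ≈1 _ (begin
          ω ^ a * (ω ^ (b ℕ.∸ a) - 1#)
            ≈⟨ x[y-z]≈xy-xz _ _ _ ⟩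
          ω ^ a * ω ^ (b ℕ.∸ a) - ω ^ a * 1#
            ≈⟨ x≈y⇒x∙y⁻¹≈ε (trans (sym (^-homo-* ω a (b ℕ.∸ a))) (trans (^-congʳ ω (ℕ.m+[n∸m]≡n a≤b))
                 (trans (sym e) (sym (*-identityʳ _))))) ⟩
          0# ∎)))))
        where
        ωᵃⁿ≈1 : (ω ^ a) ^ n ≈ 1#
        ωᵃⁿ≈1 = trans (^-assocʳ ω a n) (∣⇒power-one (divides a ≡.refl))
        small : ∀ k → k < n → ω ^ k ≈ 1# → k ≡ 0
        small ℕ.zero _ _ = ≡.refl
        small (suc k) k<n e = contradiction e (proj₂ ω-primitive (suc k) (s≤s z≤n) k<n)

      power-injective : ∀ {a b} → 0 < a → a ≤ n → 0 < b → b ≤ n → ω ^ a ≈ ω ^ b → a ≡ b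
      power-injective {a} {b} 0<a a≤n 0<b b≤n e with ℕ.≤-total a b
      ... | inj₁ a≤b = power-injective-≤ a≤b 0<a b≤n e
      ... | inj₂ b≤a = ≡.sym (power-injective-≤ b≤a 0<b a≤n (sym e))

      private
        exponents : List ℕ
        exponents = filter (λ k → coprime? k n) (map suc (upTo n))

        exponents-unique : Unique exponents
        exponents-unique = Unique.filter⁺ (λ k → coprime? k n) (Unique.map⁺ ℕ.suc-injective (Unique.upTo⁺ n))

        exponents-range : ∀ {e} → e ∈ exponents → 0 < e × e ≤ n × Coprime e n
        exponents-range e∈ with ∈-filter⁻ (λ k → coprime? k n) e∈
        ... | e∈′ , coprime with ∈-applyUpTo⁻ suc (≡.subst (_ ∈_) (map-upTo suc n) e∈′)
        ... | i , i<n , ≡.refl = s≤s z≤n , i<n , coprime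

      -- By completeness ζ lists the φ(n) powers ω^e with e coprime to n, and an
      -- injection of Fin (φ n) into itself is a permutation.
      sum-primitive : (ζ : Fin (φ n) → C) → (∀ z → IsPrimitive n z → ∃[ i ] z ≈ ζ i) →
        (g : C → C) → (∀ {y z} → y ≈ z → g y ≈ g z) →
        (∀ e → ¬ Coprime e n → g (ω ^ e) ≈ 0#) →
        sum (λ i → g (ζ i)) ≈ sum {n} (λ i → g (ω ^ suc (toℕ i)))
      sum-primitive ζ complete g g-cong g-vanishes = begin
        sum (λ i → g (ζ i))
          ≈⟨ ∑-permute (λ i → g (ζ i)) (injective⇒permutation index-injective) ⟩
        sum (λ i → g (ζ (index i)))
          ≈⟨ sum-cong-≋ {φ n} (λ i → g-cong (proj₂ (found i))) ⟨
        sum (λ i → g (ω ^ lookup exponents i))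
          ≈⟨ sum-filter (λ k → coprime? k n) (λ e → g (ω ^ e)) g-vanishes (map suc (upTo n)) ⟩
        sum (λ i → g (ω ^ lookup (map suc (upTo n)) i))
          ≡⟨ ≡.cong (λ xs → sum (λ i → g (ω ^ lookup xs i))) (map-upTo suc n) ⟩
        sum (λ i → g (ω ^ lookup (applyUpTo suc n) i))
          ≈⟨ sum-applyUpTo (λ e → g (ω ^ e)) suc n ⟩
        sum {n} (λ i → g (ω ^ suc (toℕ i))) ∎
        where
        range : ∀ i → 0 < lookup exponents i × lookup exponents i ≤ n × Coprime (lookup exponents i) n
        range i = exponents-range (∈-lookup i)
        found : ∀ i → ∃[ k ] ω ^ lookup exponents i ≈ ζ k
        found i = complete _ (power-primitive (proj₂ (proj₂ (range i))))
        index : Fin (φ n) → Fin (φ n)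
        index i = proj₁ (found i)
        index-injective : Injective _≡_ _≡_ index
        index-injective {i} {j} e = lookup-injective exponents-unique (power-injective
          (proj₁ (range i)) (proj₁ (proj₂ (range i))) (proj₁ (range j)) (proj₁ (proj₂ (range j)))
          (trans (proj₂ (found i)) (trans (reflexive (≡.cong ζ e)) (sym (proj₂ (found j))))))

-- The explicit inverse of the Vandermonde matrix.

module CyclotomicInverse (R : CommutativeRing 0ℓ 0ℓ) where
  open CommutativeRing R renaming (Carrier to C) hiding (zero)
  open Polynomials
  open Functionals R
  open Windows R
  open Sums R
  open VandermondeInverse R
  open RootsOfUnity R
  open import Algebra.Properties.CommutativeSemigroup *-commutativeSemigroup using (x∙yz≈y∙xz)
  open import Algebra.Properties.Semiring.Sum semiring
  open import Algebra.Properties.Semiring.Exp semiring using (_^_; ^-homo-*; ^-congˡ; ^-congʳ)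
  open import Algebra.Properties.Semiring.Mult semiring using () renaming (_×_ to _·_)
  open import Data.Fin.Base using (Fin; toℕ)
  import Data.Fin.Properties as Fin
  open import Data.Nat.Base as ℕ using (ℕ; _≤_; _<_; _∸_; z≤n)
  open import Data.Nat.Coprimality using (Coprime)
  open import Data.Nat.DivMod using (_/_; m/n*n≤m; m<n*o⇒m/o<n; m≡m%n+[m/n]*n; m%n<n)
  open import Data.Nat.Divisibility using (_∣_; divides; ∣-refl)
  import Data.Nat.Properties as ℕ
  open import Data.Product.Base using (∃-syntax; proj₁)
  open import Data.Sum.Base using (_⊎_)
  open import Relation.Binary.PropositionalEquality as ≡ using (_≡_)
  open import Relation.Nullary.Decidable using (yes; no)
  open import Relation.Nullary.Negation using (¬_; contradiction)
  open import Relation.Binary.Reasoning.Setoid setoid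

  private module N = ℕ.≤-Reasoning

  private
    m<[1+m/n]*n : ∀ m n .{{_ : ℕ.NonZero n}} → m < ℕ.suc (m / n) ℕ.* n
    m<[1+m/n]*n m n = ℕ.≤-<-trans (ℕ.≤-reflexive (m≡m%n+[m/n]*n m n)) (ℕ.+-monoˡ-< (m / n ℕ.* n) (m%n<n m n))

    multiple-between : ∀ {n k} → n ∣ k → 0 < k → k < n ℕ.+ n → k ≡ n
    multiple-between {n} (divides ℕ.zero ≡.refl) () _
    multiple-between {n} (divides (ℕ.suc ℕ.zero) ≡.refl) _ _ = ℕ.+-identityʳ n
    multiple-between {n} (divides (ℕ.suc (ℕ.suc c)) ≡.refl) _ k<2n = contradiction k<2n
      (ℕ.≤⇒≯ (ℕ.+-monoʳ-≤ n (ℕ.m≤m+n n _)))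

    shift-<ˡ : ∀ {n j x} → j ≤ n → j < x → n < n ∸ j ℕ.+ x
    shift-<ˡ {n} {j} {x} j≤n j<x = ≡.subst (_< n ∸ j ℕ.+ x) (ℕ.m∸n+n≡m j≤n) (ℕ.+-monoʳ-< (n ∸ j) j<x)

    shift-<ʳ : ∀ {n j x} → j ≤ n → x < n ℕ.+ j → n ∸ j ℕ.+ x < n ℕ.+ n
    shift-<ʳ {n} {j} {x} j≤n x< = ℕ.+-cancelʳ-< j _ _ (ℕ.≤-<-trans (ℕ.≤-reflexive eq)
      (ℕ.<-≤-trans (ℕ.+-monoʳ-< n x<) (ℕ.≤-reflexive (≡.sym (ℕ.+-assoc n n j)))))
      where
      open import Data.Nat.Solver using (module +-*-Solver)
      open +-*-Solver using (solve; _:=_; _:+_)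
      eq : n ∸ j ℕ.+ x ℕ.+ j ≡ n ℕ.+ x
      eq = ≡.trans (solve 3 (λ a b c → a :+ b :+ c := a :+ c :+ b) ≡.refl (n ∸ j) x j)
        (≡.cong (ℕ._+ x) (ℕ.m∸n+n≡m j≤n))

  -- A record, since a plain function type would be unfolded for the concrete ring ℂ.
  record VanishesAtNonprimitive (P : Poly) (n d : ℕ) : Set where
    field vanishes : ∀ {ω} → IsPrimitive n ω → ∀ e → ¬ Coprime e n → ⟦ P ⟧ (λ a → (ω ^ e) ^ (d ℕ.* a)) ≈ 0#
  open VanishesAtNonprimitive public

  module _ (P Q : Poly) (n d : ℕ) .{{_ : ℕ.NonZero d}} (n⁻¹ : C) where

    -- Lagrange interpolation: the coefficient of x^j in the polynomial of degree
    -- < φ(n) that is 1 at the primitive n-th root z and 0 at the other ones.  The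
    -- quotient j / d appears because Φ_n(x) = Φ_pqr(x^d).
    entry : ℕ → C → C
    entry j z = n⁻¹ * window P Q (j / d) (λ b → z ^ (n ∸ j ℕ.+ d ℕ.* b))

    entry-cong : ∀ j {y z} → y ≈ z → entry j y ≈ entry j z
    entry-cong j e = *-congˡ (window-cong P Q (j / d) λ b → ^-congˡ (n ∸ j ℕ.+ d ℕ.* b) e)

    entry-* : ∀ j l z → entry j z * z ^ l ≈ n⁻¹ * window P Q (j / d) (λ b → z ^ (n ∸ j ℕ.+ (d ℕ.* b ℕ.+ l)))
    entry-* j l z = begin
      n⁻¹ * window P Q (j / d) (λ b → z ^ (n ∸ j ℕ.+ d ℕ.* b)) * z ^ l
        ≈⟨ trans (*-assoc _ _ _) (*-congˡ (*-comm _ _)) ⟩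
      n⁻¹ * (z ^ l * window P Q (j / d) (λ b → z ^ (n ∸ j ℕ.+ d ℕ.* b)))
        ≈⟨ *-congˡ (window-* P Q (j / d) (z ^ l) (λ b → z ^ (n ∸ j ℕ.+ d ℕ.* b))) ⟨
      n⁻¹ * window P Q (j / d) (λ b → z ^ l * z ^ (n ∸ j ℕ.+ d ℕ.* b))
        ≈⟨ *-congˡ (window-cong P Q (j / d) λ b → trans (*-comm _ _) (trans
             (sym (^-homo-* z (n ∸ j ℕ.+ d ℕ.* b) l)) (^-congʳ z (ℕ.+-assoc (n ∸ j) (d ℕ.* b) l)))) ⟩
      n⁻¹ * window P Q (j / d) (λ b → z ^ (n ∸ j ℕ.+ (d ℕ.* b ℕ.+ l))) ∎

    entry-root : ∀ j z → ⟦ P ⟧ (λ a → z ^ (d ℕ.* a)) ≈ 0# → entry j z ≈ 0#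
    entry-root j z root = trans (*-congˡ (window-root P Q (j / d)
      {λ b → z ^ (n ∸ j ℕ.+ d ℕ.* b)} {λ a → z ^ (d ℕ.* a)}
      {λ b → z ^ (n ∸ j ℕ.+ d ℕ.* b)} split root)) (zeroʳ _)
      where
      split : ∀ a b → z ^ (n ∸ j ℕ.+ d ℕ.* (a ℕ.+ b)) ≈ z ^ (d ℕ.* a) * z ^ (n ∸ j ℕ.+ d ℕ.* b)
      split a b = trans (^-congʳ z (≡.trans (≡.cong (n ∸ j ℕ.+_) (ℕ.*-distribˡ-+ d a b))
        (x∙yz≡y∙xz (n ∸ j) (d ℕ.* a) (d ℕ.* b)))) (^-homo-* z (d ℕ.* a) (n ∸ j ℕ.+ d ℕ.* b))
        where open import Algebra.Properties.CommutativeSemigroup ℕ.+-commutativeSemigroup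
                using () renaming (x∙yz≈y∙xz to x∙yz≡y∙xz)

    module _ {N D : ℕ} .{{_ : ℕ.NonZero n}} (n≡ : n ≡ d ℕ.* N) (φ≡ : φ n ≡ d ℕ.* D)
      (PQ≋ : P ⊡ Q ≋ Δ N ⊡ Δ N) (degree≤ : degree P ℕ.+ D ≤ N)
      (n⁻¹-inverse : n⁻¹ * (n · 1#) ≈ 1#)
      (dec : ∀ z → z ^ n ≈ 1# → z ≈ 1# ⊎ Cancellable (1# - z))
      (ζ : Fin (φ n) → C) (ζ-primitive : ∀ i → IsPrimitive n (ζ i))
      (distinct : ∀ {i j} → ζ i ≈ ζ j → i ≡ j)
      (complete : ∀ z → IsPrimitive n z → ∃[ i ] z ≈ ζ i)
      {ω : C} (ω-primitive : IsPrimitive n ω)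
      (P-vanishes : VanishesAtNonprimitive P n d)
      where

      private
        φ≤n : φ n ≤ n
        φ≤n = ≡.subst₂ _≤_ (≡.sym φ≡) (≡.sym n≡)
          (ℕ.*-monoʳ-≤ d (ℕ.≤-trans (ℕ.m≤n+m D (degree P)) degree≤))

        dP+φ≤n : d ℕ.* degree P ℕ.+ φ n ≤ n
        dP+φ≤n = ≡.subst₂ _≤_ (≡.trans (ℕ.*-distribˡ-+ d (degree P) D)
          (≡.cong (d ℕ.* degree P ℕ.+_) (≡.sym φ≡))) (≡.sym n≡) (ℕ.*-monoʳ-≤ d degree≤)

      module _ (j l : Fin (φ n)) where
        private
          J L : ℕ
          J = toℕ j
          L = toℕ l
          J<φ : J < φ n
          J<φ = Fin.toℕ<n j
          L<φ : L < φ n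
          L<φ = Fin.toℕ<n l
          J≤n : J ≤ n
          J≤n = ℕ.≤-trans (ℕ.<⇒≤ J<φ) φ≤n

          -- For an n-th root of unity `n ∸ J` stands for the exponent -J.
          exponent : ℕ → ℕ
          exponent b = n ∸ J ℕ.+ (d ℕ.* b ℕ.+ L)

        -- The exponent lies strictly between n and 2n: d b exceeds J because b exceeds J / d, while
        -- d deg P + φ(n) ≤ n keeps d b + L below n + J.
        gap : ∀ b → J / d < b → b ≤ degree P ℕ.+ J / d → ¬ (n ∣ exponent b)
        gap b J/d<b b≤ n∣ = ℕ.<-irrefl (≡.sym (multiple-between n∣ (ℕ.≤-<-trans z≤n n<) <2n)) n<
          where
          n< : n < exponent b
          n< = shift-<ˡ J≤n (ℕ.<-≤-trans (m<[1+m/n]*n J d) (ℕ.≤-trans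
            (ℕ.*-monoˡ-≤ d J/d<b) (ℕ.≤-trans (ℕ.≤-reflexive (ℕ.*-comm b d)) (ℕ.m≤m+n _ L))))
          <2n : exponent b < n ℕ.+ n
          <2n = shift-<ʳ J≤n (N.begin-strict
            d ℕ.* b ℕ.+ L                                 N.<⟨ ℕ.+-monoʳ-< (d ℕ.* b) L<φ ⟩
            d ℕ.* b ℕ.+ φ n                               N.≤⟨ ℕ.+-monoˡ-≤ (φ n) (ℕ.*-monoʳ-≤ d b≤) ⟩
            d ℕ.* (degree P ℕ.+ J / d) ℕ.+ φ n            N.≡⟨ ≡.cong (ℕ._+ φ n) (ℕ.*-distribˡ-+ d (degree P) (J / d)) ⟩
            d ℕ.* degree P ℕ.+ d ℕ.* (J / d) ℕ.+ φ n      N.≡⟨ xy∙z≈xz∙y (d ℕ.* degree P) _ (φ n) ⟩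
            d ℕ.* degree P ℕ.+ φ n ℕ.+ d ℕ.* (J / d)      N.≤⟨ ℕ.+-mono-≤ dP+φ≤n
              (ℕ.≤-trans (ℕ.≤-reflexive (ℕ.*-comm d (J / d))) (m/n*n≤m J d)) ⟩
            n ℕ.+ J                                       N.∎)
            where
            open import Algebra.Properties.CommutativeSemigroup ℕ.+-commutativeSemigroup using (xy∙z≈xz∙y)

        -- The exponent n - J + L lies strictly between 0 and 2n, hence is a multiple of n only for
        -- L = J.
        indicator-exponent-0 : indicator n (exponent 0) ≈ kronecker j l
        indicator-exponent-0 with j Fin.≟ l
        ... | yes ≡.refl = indicator-∣ (≡.subst (n ∣_) (≡.sym (≡.trans
            (≡.cong (λ k → n ∸ J ℕ.+ (k ℕ.+ J)) (ℕ.*-zeroʳ d)) (ℕ.m∸n+n≡m J≤n))) ∣-refl)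
        ... | no j≢l = indicator-∤ λ n∣ → j≢l (Fin.toℕ-injective
          (ℕ.+-cancelˡ-≡ (n ∸ J) _ _ (≡.trans (ℕ.m∸n+n≡m J≤n)
          (≡.sym (multiple-between (≡.subst (n ∣_) (≡.cong (λ k → n ∸ J ℕ.+ (k ℕ.+ L)) (ℕ.*-zeroʳ d)) n∣)
            (ℕ.<-≤-trans (ℕ.m<n⇒0<n∸m (ℕ.<-≤-trans J<φ φ≤n)) (ℕ.m≤m+n (n ∸ J) L))
            (ℕ.+-mono-≤-< (ℕ.m∸n≤m n J) (ℕ.<-≤-trans L<φ φ≤n)))))))

        entry-inverse : sum (λ i → entry J (ζ i) * ζ i ^ L) ≈ kronecker j l
        entry-inverse = begin
          sum (λ i → entry J (ζ i) * ζ i ^ L)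
            ≈⟨ sum-primitive dec ω-primitive ζ complete (λ z → entry J z * z ^ L)
                 (λ e → *-cong (entry-cong J e) (^-congˡ L e))
                 (λ e e⊥̸n → trans (*-congʳ (entry-root J (ω ^ e)
                   (vanishes P-vanishes ω-primitive e e⊥̸n))) (zeroˡ _)) ⟩
          sum {n} (λ i → entry J (z i) * z i ^ L)
            ≈⟨ sum-cong-≋ {n} (λ i → entry-* J L (z i)) ⟩
          sum {n} (λ i → n⁻¹ * window P Q (J / d) (λ b → z i ^ exponent b))
            ≈⟨ *-distribˡ-sum {n} n⁻¹ (λ i → window P Q (J / d) (λ b → z i ^ exponent b)) ⟨
          n⁻¹ * sum {n} (λ i → window P Q (J / d) (λ b → z i ^ exponent b))
            ≈⟨ *-congˡ (window-sum P Q (J / d) {n} (λ i b → z i ^ exponent b)) ⟨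
          n⁻¹ * window P Q (J / d) (λ b → sum {n} λ i → z i ^ exponent b)
            ≈⟨ *-congˡ (window-cong P Q (J / d) λ b → sum-powers dec ω-primitive (exponent b)) ⟩
          n⁻¹ * window P Q (J / d) (λ b → n · 1# * indicator n (exponent b))
            ≈⟨ *-congˡ (window-* P Q (J / d) (n · 1#) λ b → indicator n (exponent b)) ⟩
          n⁻¹ * (n · 1# * window P Q (J / d) (λ b → indicator n (exponent b)))
            ≈⟨ trans (sym (*-assoc _ _ _)) (trans (*-congʳ n⁻¹-inverse) (*-identityˡ _)) ⟩
          window P Q (J / d) (λ b → indicator n (exponent b))
            -- J / d < N because J < φ n ≤ n = d N, so the window stays below the degree at which
            -- the product of P and Q departs from 1.
            ≈⟨ window-δ P Q PQ≋ (m<n*o⇒m/o<n (ℕ.<-≤-trans J<φ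
                 (ℕ.≤-trans φ≤n (ℕ.≤-reflexive (≡.trans n≡ (ℕ.*-comm d N))))))
                 (λ b J/d<b b≤ → indicator-∤ (gap b J/d<b b≤)) ⟩
          indicator n (exponent 0)
            ≈⟨ indicator-exponent-0 ⟩
          kronecker j l ∎
          where
          z : Fin n → C
          z i = ω ^ ℕ.suc (toℕ i)

      entry-inverseʳ : ∀ i k → sum {φ n} (λ j → ζ i ^ toℕ j * entry (toℕ j) (ζ k)) ≈ kronecker i k
      entry-inverseʳ = vandermonde-inverseʳ ζ
        (λ i j i≢j → roots-apart dec (proj₁ (ζ-primitive i)) (proj₁ (ζ-primitive j)) λ e → i≢j (distinct e))
        (λ j i → entry (toℕ j) (ζ i)) entry-inverse

-- Estimates for rational numbers.

module Rationals where
  open import Data.Integer.Base as ℤ using (+_)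
  import Data.Integer.Properties as ℤ
  open import Data.Nat.Base as ℕ using (ℕ; zero; suc)
  import Data.Nat.Properties as ℕ
  open import Data.Product.Base using (∃-syntax; _×_; _,_)
  open import Data.Rational.Base using (ℚ; 0ℚ; 1ℚ; ½; _+_; _*_; _-_; -_; ∣_∣; 1/_; _/_; _≤_; _<_;
    Positive; NonNegative; NonZero;
    positive; nonNegative)
  open import Data.Rational.Properties
  open import Data.Rational.Solver using (module +-*-Solver)
  import Data.Rational.Unnormalised.Base as ℚᵘ
  import Data.Rational.Unnormalised.Properties as ℚᵘ
  open import Data.Sum.Base using (inj₁; inj₂)
  open import Relation.Binary.PropositionalEquality
  open import Relation.Nullary.Decidable using (yes; no)
  open import Relation.Nullary.Negation using (contradiction)
  open +-*-Solver

  0<1 : 0ℚ < 1ℚ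
  0<1 = positive⁻¹ 1ℚ

  *-pos : ∀ {a b} → 0ℚ < a → 0ℚ < b → 0ℚ < a * b
  *-pos {a} {b} 0<a 0<b = positive⁻¹ _ {{pos*pos⇒pos a {{positive 0<a}} b {{positive 0<b}}}}

  *-nonneg : ∀ {a b} → 0ℚ ≤ a → 0ℚ ≤ b → 0ℚ ≤ a * b
  *-nonneg {a} {b} 0≤a 0≤b = nonNegative⁻¹ _ {{nonNeg*nonNeg⇒nonNeg a {{nonNegative 0≤a}} b {{nonNegative 0≤b}}}}

  +-nonneg : ∀ {a b} → 0ℚ ≤ a → 0ℚ ≤ b → 0ℚ ≤ a + b
  +-nonneg = +-mono-≤

  *-mono : ∀ {a b c d} → 0ℚ ≤ c → 0ℚ ≤ b → a ≤ b → c ≤ d → a * c ≤ b * d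
  *-mono {a} {b} {c} {d} 0≤c 0≤b a≤b c≤d =
    ≤-trans (*-monoʳ-≤-nonNeg c {{nonNegative 0≤c}} a≤b) (*-monoˡ-≤-nonNeg b {{nonNegative 0≤b}} c≤d)

  ≤-+ʳ : ∀ {a b} → 0ℚ ≤ b → a ≤ a + b
  ≤-+ʳ {a} {b} 0≤b = subst (_≤ a + b) (+-identityʳ a) (+-monoʳ-≤ a 0≤b)

  ≤-+ˡ : ∀ {a b} → 0ℚ ≤ b → a ≤ b + a
  ≤-+ˡ {a} {b} 0≤b = subst (a ≤_) (+-comm a b) (≤-+ʳ 0≤b)

  +-cancelʳ-≤ : ∀ p q s → q + p ≤ s + p → q ≤ s
  +-cancelʳ-≤ p q s h = subst₂ _≤_ (undo q) (undo s) (+-monoˡ-≤ (- p) h)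
    where
    undo : ∀ q → q + p + - p ≡ q
    undo q = trans (+-assoc q p (- p)) (trans (cong (_+_ q) (+-inverseʳ p)) (+-identityʳ q))

  half : ℚ → ℚ
  half ε = ½ * ε

  half-pos : ∀ {ε} → 0ℚ < ε → 0ℚ < half ε
  half-pos = *-pos (positive⁻¹ ½)

  half+half : ∀ ε → half ε + half ε ≡ ε
  half+half ε = trans (sym (*-distribʳ-+ ε ½ ½)) (*-identityˡ ε)

  abstract
    small-multiple : ∀ {c ε} → 0ℚ ≤ c → 0ℚ < ε → ∃[ η ] 0ℚ < η × η ≤ 1ℚ × c * η ≤ ε
    small-multiple {c} {ε} 0≤c 0<ε = η , 0<η
      , subst (η ≤_) (*-inverseʳ D) (*-monoʳ-≤-nonNeg (1/ D) {{0≤1/D}} (≤-+ˡ (+-nonneg 0≤c 0≤1)))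
      , subst (c * η ≤_) Dη≡ε (*-monoʳ-≤-nonNeg η {{nonNegative (<⇒≤ 0<η)}}
          (subst (c ≤_) (sym (+-assoc c 1ℚ ε)) (≤-+ʳ (+-nonneg 0≤1 (<⇒≤ 0<ε)))))
      where
      0≤1 : 0ℚ ≤ 1ℚ
      0≤1 = <⇒≤ 0<1
      -- D ≥ ε makes η = ε / D at most 1, and D ≥ c gives c η ≤ ε.
      D : ℚ
      D = c + 1ℚ + ε
      0<D : 0ℚ < D
      0<D = +-mono-≤-< (+-nonneg 0≤c 0≤1) 0<ε
      instance
        D-pos : Positive D
        D-pos = positive 0<D
        D-nonZero : NonZero D
        D-nonZero = pos⇒nonZero D
      0≤1/D : NonNegative (1/ D)
      0≤1/D = pos⇒nonNeg (1/ D) {{1/pos⇒pos D}}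
      η : ℚ
      η = ε * 1/ D
      0<η : 0ℚ < η
      0<η = *-pos 0<ε (positive⁻¹ _ {{1/pos⇒pos D}})
      Dη≡ε : D * η ≡ ε
      Dη≡ε = trans (solve 3 (λ d e i → d :* (e :* i) := e :* (d :* i)) refl D ε (1/ D))
        (trans (cong (ε *_) (*-inverseʳ D)) (*-identityʳ ε))

  sq-cancel-≤ : ∀ {a b} → 0ℚ ≤ b → a * a ≤ b * b → a ≤ b
  sq-cancel-≤ {a} {b} 0≤b a²≤b² with a ≤? b
  ... | yes a≤b = a≤b
  ... | no a≰b = contradiction (<-≤-trans b²<a² a²≤b²) (<-irrefl refl)
    where
    b<a : b < a
    b<a = ≰⇒> a≰b
    b²<a² : b * b < a * a
    b²<a² = ≤-<-trans (*-monoˡ-≤-nonNeg b {{nonNegative 0≤b}} (<⇒≤ b<a))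
      (*-monoˡ-<-pos a {{positive (≤-<-trans 0≤b b<a)}} b<a)

  ∣p∣²≡p² : ∀ p → ∣ p ∣ * ∣ p ∣ ≡ p * p
  ∣p∣²≡p² p with ∣p∣≡p∨∣p∣≡-p p
  ... | inj₁ e = cong₂ _*_ e e
  ... | inj₂ e = trans (cong₂ _*_ e e) (solve 1 (λ p → (:- p) :* (:- p) := p :* p) refl p)

  p²-nonneg : ∀ p → 0ℚ ≤ p * p
  p²-nonneg p = subst (0ℚ ≤_) (∣p∣²≡p² p) (*-nonneg (0≤∣p∣ p) (0≤∣p∣ p))

  p≤∣p∣ : ∀ p → p ≤ ∣ p ∣
  p≤∣p∣ p with ≤-total 0ℚ p
  ... | inj₁ 0≤p = ≤-reflexive (sym (0≤p⇒∣p∣≡p 0≤p))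
  ... | inj₂ p≤0 = ≤-trans p≤0 (0≤∣p∣ p)

  -∣p∣≤p : ∀ p → - ∣ p ∣ ≤ p
  -∣p∣≤p p = subst₂ _≤_ refl (⁻¹-involutive p) (neg-antimono-≤ (subst (- p ≤_) (∣-p∣≡∣p∣ p) (p≤∣p∣ (- p))))
    where open import Algebra.Properties.Group +-0-group using (⁻¹-involutive)

  ∣p-q∣≤⇒p≤q+ : ∀ {p q r} → ∣ p - q ∣ ≤ r → p ≤ q + r
  ∣p-q∣≤⇒p≤q+ {p} {q} h = subst (_≤ q + _) (solve 2 (λ p q → q :+ (p :- q) := p) refl p q)
    (+-monoʳ-≤ q (≤-trans (p≤∣p∣ (p - q)) h))

  toℚ : ℕ → ℚ
  toℚ n = + n / 1

  private
    toℚᵘ-toℚ : ∀ n → Data.Rational.Base.toℚᵘ (toℚ n) ℚᵘ.≃ ℚᵘ.mkℚᵘ (+ n) 0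
    toℚᵘ-toℚ n = toℚᵘ-fromℚᵘ (ℚᵘ.mkℚᵘ (+ n) 0)

  toℚ-+ : ∀ m n → toℚ (m ℕ.+ n) ≡ toℚ m + toℚ n
  toℚ-+ m n = toℚᵘ-injective (ℚᵘ.≃-trans (toℚᵘ-toℚ (m ℕ.+ n)) (ℚᵘ.≃-trans
    (ℚᵘ.*≡* (cong (ℤ._* + 1) (sym (cong₂ ℤ._+_ (ℤ.*-identityʳ (+ m)) (ℤ.*-identityʳ (+ n))))))
    (ℚᵘ.≃-sym (ℚᵘ.≃-trans (toℚᵘ-homo-+ (toℚ m) (toℚ n)) (ℚᵘ.+-cong (toℚᵘ-toℚ m) (toℚᵘ-toℚ n))))))

  toℚ-* : ∀ m n → toℚ (m ℕ.* n) ≡ toℚ m * toℚ n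
  toℚ-* m n = toℚᵘ-injective (ℚᵘ.≃-trans (toℚᵘ-toℚ (m ℕ.* n)) (ℚᵘ.≃-trans
    (ℚᵘ.*≡* (cong (ℤ._* + 1) (ℤ.pos-* m n)))
    (ℚᵘ.≃-sym (ℚᵘ.≃-trans (toℚᵘ-homo-* (toℚ m) (toℚ n)) (ℚᵘ.*-cong (toℚᵘ-toℚ m) (toℚᵘ-toℚ n))))))

  toℚ-mono : ∀ {m n} → m ℕ.≤ n → toℚ m ≤ toℚ n
  toℚ-mono {m} {n} m≤n = toℚᵘ-cancel-≤ (ℚᵘ.≤-respˡ-≃ (ℚᵘ.≃-sym (toℚᵘ-toℚ m))
    (ℚᵘ.≤-respʳ-≃ (ℚᵘ.≃-sym (toℚᵘ-toℚ n)) (ℚᵘ.*≤* (ℤ.*-monoʳ-≤-nonNeg (+ 1) (ℤ.+≤+ m≤n)))))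

  toℚ-nonneg : ∀ n → 0ℚ ≤ toℚ n
  toℚ-nonneg n = toℚ-mono (ℕ.z≤n {n})

  toℚ-pos : ∀ n .{{_ : ℕ.NonZero n}} → 0ℚ < toℚ n
  toℚ-pos n = <-≤-trans 0<1 (toℚ-mono (ℕ.>-nonZero⁻¹ n))

  infixr 8 _^ℚ_
  _^ℚ_ : ℚ → ℕ → ℚ
  p ^ℚ zero  = 1ℚ
  p ^ℚ suc n = p * p ^ℚ n

  -- For a > 1 one has a ≤ a^(n+1). This bounds the modulus of a root of unity without extracting
  -- n-th roots.
  power-≤⇒≤ : ∀ {a b} n → 0ℚ ≤ a → 1ℚ ≤ b → a ^ℚ suc n ≤ b → a ≤ b
  power-≤⇒≤ {a} {b} n 0≤a 1≤b aⁿ≤b with a ≤? 1ℚ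
  ... | yes a≤1 = ≤-trans a≤1 1≤b
  ... | no a≰1 = ≤-trans (subst (_≤ a * a ^ℚ n) (*-identityʳ a)
      (*-monoˡ-≤-nonNeg a {{nonNegative 0≤a}} (1≤aⁿ n))) aⁿ≤b
    where
    1≤aⁿ : ∀ n → 1ℚ ≤ a ^ℚ n
    1≤aⁿ zero = ≤-refl
    1≤aⁿ (suc n) = *-mono {1ℚ} {a} {1ℚ} {a ^ℚ n} (<⇒≤ 0<1) 0≤a (<⇒≤ (≰⇒> a≰1)) (1≤aⁿ n)

-- Ring identities for differences.

module DifferenceIdentities (R : CommutativeRing 0ℓ 0ℓ) where
  open CommutativeRing R
  open import Algebra.Properties.Ring ring using (-1*x≈-x; -‿involutive; -‿+-comm)
  open import Algebra.Solver.Ring.NaturalCoefficients.Default commutativeSemiring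
  open import Relation.Binary.Reasoning.Setoid setoid

  -‿minus : ∀ a b → - (a - b) ≈ b - a
  -‿minus a b = trans (sym (-‿+-comm a (- b))) (trans (+-congˡ (-‿involutive b)) (+-comm (- a) b))

  minus-trans : ∀ a b c → (a - b) + (b - c) ≈ a - c
  minus-trans a b c = begin
    (a - b) + (b - c)     ≈⟨ solve 4 (λ a b b⁻ c → (a :+ b⁻) :+ (b :+ c) := (a :+ c) :+ (b :+ b⁻)) refl a b (- b) (- c) ⟩
    (a - c) + (b - b)     ≈⟨ trans (+-congˡ (-‿inverseʳ b)) (+-identityʳ _) ⟩
    a - c                 ∎

  minus-+ : ∀ a a′ b b′ → (a - a′) + (b - b′) ≈ (a + b) - (a′ + b′)
  minus-+ a a′ b b′ = trans
    (solve 4 (λ a a′ b b′ → (a :+ a′) :+ (b :+ b′) := (a :+ b) :+ (a′ :+ b′)) refl a (- a′) b (- b′))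
    (+-congˡ (-‿+-comm a′ b′))

  -- Each difference is multiplied by a single factor, which is bounded along a Cauchy sequence;
  -- this makes multiplication respect equality of reals.
  minus-* : ∀ a a′ b b′ → a * (b - b′) + b′ * (a - a′) ≈ a * b - a′ * b′
  minus-* a a′ b b′ = begin
    a * (b - b′) + b′ * (a - a′)
      ≈⟨ +-cong (*-congˡ (+-congˡ (-1*x≈-x b′))) (*-congˡ (+-congˡ (-1*x≈-x a′))) ⟨
    a * (b + - 1# * b′) + b′ * (a + - 1# * a′)
      ≈⟨ solve 5 (λ a a′ b b′ n → a :* (b :+ n :* b′) :+ b′ :* (a :+ n :* a′) :=
           (a :* b :+ n :* (a′ :* b′)) :+ (a :* b′ :+ n :* (a :* b′))) refl a a′ b b′ (- 1#) ⟩
    (a * b + - 1# * (a′ * b′)) + (a * b′ + - 1# * (a * b′))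
      ≈⟨ +-cong (+-congˡ (-1*x≈-x _)) (trans (+-congˡ (-1*x≈-x _)) (-‿inverseʳ _)) ⟩
    (a * b - a′ * b′) + 0#
      ≈⟨ +-identityʳ _ ⟩
    a * b - a′ * b′ ∎

  shifted-product : ∀ a b e → (a + e) * (b + e) ≈ a * b + (a + b + e) * e
  shifted-product = solve 3 (λ a b e → (a :+ e) :* (b :+ e) := a :* b :+ (a :+ b :+ e) :* e) refl

-- Real and imaginary parts of ring identities.

module ComplexIdentities (R : CommutativeRing 0ℓ 0ℓ) where
  open CommutativeRing R
  open import Algebra.Properties.Ring ring using (-1*x≈-x; -‿distribˡ-*; -‿distribʳ-*; -‿involutive; -‿+-comm)
  open import Algebra.Solver.Ring.NaturalCoefficients.Default commutativeSemiring
  open import Relation.Binary.Reasoning.Setoid setoid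

  -- With negation as multiplication by a constant n, the associative and
  -- distributive laws hold for every n, so that the semiring solver applies.
  private
    n : Carrier
    n = - 1#
    neg : ∀ x → n * x ≈ - x
    neg = -1*x≈-x

  *-assoc-re : ∀ a b c d e f → (a * c + - (b * d)) * e + - ((a * d + b * c) * f) ≈
      a * (c * e + - (d * f)) + - (b * (c * f + d * e))
  *-assoc-re a b c d e f = begin
    (a * c + - (b * d)) * e + - ((a * d + b * c) * f)       ≈⟨ +-cong (*-congʳ (+-congˡ (neg _))) (neg _) ⟨
    (a * c + n * (b * d)) * e + n * ((a * d + b * c) * f)   ≈⟨ solve 7 (λ n a b c d e f →
      (a :* c :+ n :* (b :* d)) :* e :+ n :* ((a :* d :+ b :* c) :* f) :=
      a :* (c :* e :+ n :* (d :* f)) :+ n :* (b :* (c :* f :+ d :* e))) refl n a b c d e f ⟩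
    a * (c * e + n * (d * f)) + n * (b * (c * f + d * e))   ≈⟨ +-cong (*-congˡ (+-congˡ (neg _))) (neg _) ⟩
    a * (c * e + - (d * f)) + - (b * (c * f + d * e))       ∎

  *-assoc-im : ∀ a b c d e f → (a * c + - (b * d)) * f + (a * d + b * c) * e ≈
    a * (c * f + d * e) + b * (c * e + - (d * f))
  *-assoc-im a b c d e f = begin
    (a * c + - (b * d)) * f + (a * d + b * c) * e     ≈⟨ +-congʳ (*-congʳ (+-congˡ (neg _))) ⟨
    (a * c + n * (b * d)) * f + (a * d + b * c) * e   ≈⟨ solve 7 (λ n a b c d e f →
      (a :* c :+ n :* (b :* d)) :* f :+ (a :* d :+ b :* c) :* e :=
      a :* (c :* f :+ d :* e) :+ b :* (c :* e :+ n :* (d :* f))) refl n a b c d e f ⟩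
    a * (c * f + d * e) + b * (c * e + n * (d * f))   ≈⟨ +-congˡ (*-congˡ (+-congˡ (neg _))) ⟩
    a * (c * f + d * e) + b * (c * e + - (d * f))     ∎

  distribˡ-re : ∀ a b c d e f → a * (c + e) + - (b * (d + f)) ≈
    (a * c + - (b * d)) + (a * e + - (b * f))
  distribˡ-re a b c d e f = begin
    a * (c + e) + - (b * (d + f))               ≈⟨ +-congˡ (neg _) ⟨
    a * (c + e) + n * (b * (d + f))             ≈⟨ solve 7 (λ n a b c d e f →
      a :* (c :+ e) :+ n :* (b :* (d :+ f)) := (a :* c :+ n :* (b :* d)) :+ (a :* e :+ n :* (b :* f)))
      refl n a b c d e f ⟩
    (a * c + n * (b * d)) + (a * e + n * (b * f))   ≈⟨ +-cong (+-congˡ (neg _)) (+-congˡ (neg _)) ⟩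
    (a * c + - (b * d)) + (a * e + - (b * f))   ∎

  distribˡ-im : ∀ a b c d e f → a * (d + f) + b * (c + e) ≈ (a * d + b * c) + (a * f + b * e)
  distribˡ-im = solve 6 (λ a b c d e f →
    a :* (d :+ f) :+ b :* (c :+ e) := (a :* d :+ b :* c) :+ (a :* f :+ b :* e)) refl

  *-comm-im : ∀ a b c d → a * d + b * c ≈ c * b + d * a
  *-comm-im = solve 4 (λ a b c d → a :* d :+ b :* c := c :* b :+ d :* a) refl

  square-minus : ∀ x y → (x + - y) * (x + - y) + (x * y + x * y) ≈ x * x + y * y
  square-minus x y = begin
    (x + - y) * (x + - y) + (x * y + x * y)       ≈⟨ solve 3 (λ x y n →
      (x :+ n) :* (x :+ n) :+ (x :* y :+ x :* y) := x :* (y :+ n) :+ x :* (y :+ n) :+ (x :* x :+ n :* n))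
      refl x y (- y) ⟩
    x * (y + - y) + x * (y + - y) + (x * x + - y * - y)
      ≈⟨ +-cong (+-cong x*0 x*0) (+-congˡ (trans (sym (-‿distribˡ-* y (- y)))
           (trans (-‿cong (sym (-‿distribʳ-* y y))) (-‿involutive (y * y))))) ⟩
    0# + 0# + (x * x + y * y)                     ≈⟨ trans (+-congʳ (+-identityˡ 0#)) (+-identityˡ _) ⟩
    x * x + y * y                                 ∎
    where
    x*0 : x * (y + - y) ≈ 0#
    x*0 = trans (*-congˡ (-‿inverseʳ y)) (zeroʳ x)

  -- The Brahmagupta-Fibonacci identity. The cross terms 2 (a c)(b d) of the squared imaginary part
  -- are what `square-minus` asks for to remove the sign in the real part.
  norm-* : ∀ a b c d → (a * c + - (b * d)) * (a * c + - (b * d)) + (a * d + b * c) * (a * d + b * c) ≈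
    (a * a + b * b) * (c * c + d * d)
  norm-* a b c d = begin
    (a * c + - (b * d)) * (a * c + - (b * d)) + (a * d + b * c) * (a * d + b * c)
      ≈⟨ +-congˡ (solve 4 (λ a b c d → (a :* d :+ b :* c) :* (a :* d :+ b :* c) :=
           ((a :* c) :* (b :* d) :+ (a :* c) :* (b :* d)) :+ ((a :* d) :* (a :* d) :+ (b :* c) :* (b :* c)))
           refl a b c d) ⟩
    (a * c + - (b * d)) * (a * c + - (b * d)) +
      (((a * c) * (b * d) + (a * c) * (b * d)) + ((a * d) * (a * d) + (b * c) * (b * c)))
      ≈⟨ trans (sym (+-assoc _ _ _)) (+-congʳ (square-minus (a * c) (b * d))) ⟩
    ((a * c) * (a * c) + (b * d) * (b * d)) + ((a * d) * (a * d) + (b * c) * (b * c))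
      ≈⟨ solve 4 (λ a b c d → ((a :* c) :* (a :* c) :+ (b :* d) :* (b :* d)) :+
           ((a :* d) :* (a :* d) :+ (b :* c) :* (b :* c)) := (a :* a :+ b :* b) :* (c :* c :+ d :* d))
           refl a b c d ⟩
    (a * a + b * b) * (c * c + d * d) ∎

  -- For z = a + b i and w = c + d i these recover |z|² w from z w.
  conj-re : ∀ a b c d → a * (a * c + - (b * d)) + b * (a * d + b * c) ≈ (a * a + b * b) * c
  conj-re a b c d = begin
    a * (a * c + - (b * d)) + b * (a * d + b * c)
      ≈⟨ solve 5 (λ a b c d n → a :* (a :* c :+ n) :+ b :* (a :* d :+ b :* c) :=
           (a :* a :+ b :* b) :* c :+ a :* (n :+ b :* d)) refl a b c d (- (b * d)) ⟩
    (a * a + b * b) * c + a * (- (b * d) + b * d)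
      ≈⟨ trans (+-congˡ (trans (*-congˡ (-‿inverseˡ _)) (zeroʳ a))) (+-identityʳ _) ⟩
    (a * a + b * b) * c ∎

  conj-im : ∀ a b c d → a * (a * d + b * c) + - (b * (a * c + - (b * d))) ≈ (a * a + b * b) * d
  conj-im a b c d = begin
    a * (a * d + b * c) + - (b * (a * c + - (b * d)))
      ≈⟨ +-congˡ (trans (-‿distribʳ-* b _) (*-congˡ (trans (sym (-‿+-comm _ _)) (+-congˡ (-‿involutive _))))) ⟩
    a * (a * d + b * c) + b * (- (a * c) + b * d)
      ≈⟨ solve 5 (λ a b c d n → a :* (a :* d :+ b :* c) :+ b :* (n :+ b :* d) :=
           (a :* a :+ b :* b) :* d :+ b :* (n :+ a :* c)) refl a b c d (- (a * c)) ⟩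
    (a * a + b * b) * d + b * (- (a * c) + a * c)
      ≈⟨ trans (+-congˡ (trans (*-congˡ (-‿inverseˡ _)) (zeroʳ b))) (+-identityʳ _) ⟩
    (a * a + b * b) * d ∎

-- Equality of reals through null sequences.

module Reals where
  open Rationals
  open import Data.Nat.Base as ℕ using (ℕ; _⊔_)
  import Data.Nat.Properties as ℕ
  open import Data.Product.Base using (∃-syntax; _×_; _,_)
  open import Data.Rational.Base using (ℚ; 0ℚ; 1ℚ; _+_; _*_; _-_; -_; ∣_∣; _≤_; _<_)
  open import Data.Rational.Properties
  open import Relation.Binary.PropositionalEquality
  open DifferenceIdentities +-*-commutativeRing

  Eventually : (ℕ → Set) → Set
  Eventually P = ∃[ N ] ∀ n → N ℕ.≤ n → P n

  eventually-map₂ : ∀ {P Q S : ℕ → Set} → (∀ n → P n → Q n → S n) →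
    Eventually P → Eventually Q → Eventually S
  eventually-map₂ f (M , p) (N , q) = M ⊔ N , λ n M⊔N≤n →
    f n (p n (ℕ.m⊔n≤o⇒m≤o M N M⊔N≤n)) (q n (ℕ.m⊔n≤o⇒n≤o M N M⊔N≤n))

  eventually-map : ∀ {P Q : ℕ → Set} → (∀ n → P n → Q n) → Eventually P → Eventually Q
  eventually-map f (N , p) = N , λ n N≤n → f n (p n N≤n)

  -- `x ≈ᴿ y` unfolds to `Null` of the termwise difference, so its laws reduce to sums and products
  -- of null sequences.
  Null : (ℕ → ℚ) → Set
  Null s = ∀ ε → 0ℚ < ε → Eventually λ n → ∣ s n ∣ ≤ ε

  null-≗ : ∀ {s t} → (∀ n → s n ≡ t n) → Null s → Null t
  null-≗ e h ε 0<ε = eventually-map (λ n → subst (λ q → ∣ q ∣ ≤ ε) (e n)) (h ε 0<ε)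

  null-0 : Null λ _ → 0ℚ
  null-0 ε 0<ε = 0 , λ _ _ → <⇒≤ 0<ε

  null-+ : ∀ {s t} → Null s → Null t → Null λ n → s n + t n
  null-+ {s} {t} hs ht ε 0<ε = eventually-map₂
    (λ n h₁ h₂ → ≤-trans (∣p+q∣≤∣p∣+∣q∣ (s n) (t n))
      (subst (∣ s n ∣ + ∣ t n ∣ ≤_) (half+half ε) (+-mono-≤ h₁ h₂)))
    (hs (half ε) (half-pos 0<ε)) (ht (half ε) (half-pos 0<ε))

  null-neg : ∀ {s} → Null s → Null λ n → - s n
  null-neg {s} hs ε 0<ε = eventually-map (λ n → subst (_≤ ε) (sym (∣-p∣≡∣p∣ (s n)))) (hs ε 0<ε)

  null-* : ∀ {s t} → EventuallyBounded s → Null t → Null λ n → s n * t n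
  null-* {s} {t} (b , 0≤b , bounded) ht ε 0<ε = go (small-multiple 0≤b 0<ε)
    where
    go : (∃[ η ] 0ℚ < η × η ≤ 1ℚ × b * η ≤ ε) → Eventually λ n → ∣ s n * t n ∣ ≤ ε
    go (η , 0<η , _ , bη≤ε) = eventually-map₂
      (λ n h₁ h₂ → subst (_≤ ε) (sym (∣p*q∣≡∣p∣*∣q∣ (s n) (t n)))
        (≤-trans (*-mono {∣ s n ∣} {b} {∣ t n ∣} {η} (0≤∣p∣ (t n)) 0≤b h₁ h₂) bη≤ε))
      bounded (ht η 0<η)

  -- Ring operations on reals are termwise, so with this lemma the ring laws come directly from
  -- those of ℚ.
  pointwise : ∀ {x y} → (∀ n → seq x n ≡ seq y n) → x ≈ᴿ y
  pointwise {x} {y} e = null-≗ {λ _ → 0ℚ} {λ n → seq x n - seq y n}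
    (λ n → sym (trans (cong (_- seq y n) (e n)) (+-inverseʳ (seq y n)))) null-0

  ≈ᴿ-refl : ∀ {x} → x ≈ᴿ x
  ≈ᴿ-refl {x} = pointwise {x} {x} λ _ → refl

  ≈ᴿ-sym : ∀ {x y} → x ≈ᴿ y → y ≈ᴿ x
  ≈ᴿ-sym {x} {y} h = null-≗ {λ n → - (seq x n - seq y n)} {λ n → seq y n - seq x n}
    (λ n → -‿minus (seq x n) (seq y n))
    (null-neg {λ n → seq x n - seq y n} h)

  ≈ᴿ-trans : ∀ {x y z} → x ≈ᴿ y → y ≈ᴿ z → x ≈ᴿ z
  ≈ᴿ-trans {x} {y} {z} h k =
    null-≗ {λ n → (seq x n - seq y n) + (seq y n - seq z n)} {λ n → seq x n - seq z n}
      (λ n → minus-trans (seq x n) (seq y n) (seq z n))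
      (null-+ {λ n → seq x n - seq y n} {λ n → seq y n - seq z n} h k)

  +ᴿ-cong : ∀ {x x′ y y′} → x ≈ᴿ x′ → y ≈ᴿ y′ → x +ᴿ y ≈ᴿ x′ +ᴿ y′
  +ᴿ-cong {x} {x′} {y} {y′} h k =
    null-≗ {λ n → (seq x n - seq x′ n) + (seq y n - seq y′ n)}
      {λ n → (seq x n + seq y n) - (seq x′ n + seq y′ n)}
      (λ n → minus-+ (seq x n) (seq x′ n) (seq y n) (seq y′ n))
      (null-+ {λ n → seq x n - seq x′ n} {λ n → seq y n - seq y′ n} h k)

  -ᴿ-cong : ∀ {x y} → x ≈ᴿ y → -ᴿ x ≈ᴿ -ᴿ y
  -ᴿ-cong {x} {y} h = null-≗ {λ n → - (seq x n - seq y n)} {λ n → (- seq x n) - (- seq y n)}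
    (λ n → neg-distrib-+ (seq x n) (- seq y n))
    (null-neg {λ n → seq x n - seq y n} h)

  *ᴿ-cong : ∀ {x x′ y y′} → x ≈ᴿ x′ → y ≈ᴿ y′ → x *ᴿ y ≈ᴿ x′ *ᴿ y′
  *ᴿ-cong {x} {x′} {y} {y′} h k =
    null-≗ {λ n → seq x n * (seq y n - seq y′ n) + seq y′ n * (seq x n - seq x′ n)}
      {λ n → seq x n * seq y n - seq x′ n * seq y′ n}
      (λ n → minus-* (seq x n) (seq x′ n) (seq y n) (seq y′ n))
      (null-+ {λ n → seq x n * (seq y n - seq y′ n)} {λ n → seq y′ n * (seq x n - seq x′ n)}
        (null-* {seq x} {λ n → seq y n - seq y′ n} (cauchy⇒bounded {seq x} (cauchy x)) k)
        (null-* {seq y′} {λ n → seq x n - seq x′ n} (cauchy⇒bounded {seq y′} (cauchy y′)) h))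

-- The commutative ring of complex numbers.

module Complex where
  open Reals
  open import Data.Product.Base using (_,_)
  open import Data.Rational.Base as ℚ using (ℚ)
  open import Data.Rational.Properties
  open import Relation.Binary.PropositionalEquality using (_≡_; trans; cong₂)
  open import Data.Nat.Base using (ℕ)
  open ComplexIdentities +-*-commutativeRing

  sre sim : ℂ → ℕ → ℚ
  sre z = seq (re z)
  sim z = seq (im z)

  pointwiseᶜ : ∀ {z w} → (∀ n → sre z n ≡ sre w n) → (∀ n → sim z n ≡ sim w n) → z ≈ᶜ w
  pointwiseᶜ {z} {w} e f = pointwise {re z} {re w} e , pointwise {im z} {im w} f

  ≈ᶜ-refl : ∀ {z} → z ≈ᶜ z
  ≈ᶜ-refl {z} = ≈ᴿ-refl {re z} , ≈ᴿ-refl {im z}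

  ≈ᶜ-sym : ∀ {z w} → z ≈ᶜ w → w ≈ᶜ z
  ≈ᶜ-sym {z} {w} (h , k) = ≈ᴿ-sym {re z} {re w} h , ≈ᴿ-sym {im z} {im w} k

  ≈ᶜ-trans : ∀ {z w v} → z ≈ᶜ w → w ≈ᶜ v → z ≈ᶜ v
  ≈ᶜ-trans {z} {w} {v} (h , k) (h′ , k′) =
    ≈ᴿ-trans {re z} {re w} {re v} h h′ , ≈ᴿ-trans {im z} {im w} {im v} k k′

  +ᶜ-cong : ∀ {z z′ w w′} → z ≈ᶜ z′ → w ≈ᶜ w′ → z +ᶜ w ≈ᶜ z′ +ᶜ w′
  +ᶜ-cong {z} {z′} {w} {w′} (h , k) (h′ , k′) =
    +ᴿ-cong {re z} {re z′} {re w} {re w′} h h′ , +ᴿ-cong {im z} {im z′} {im w} {im w′} k k′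

  -ᶜ-cong : ∀ {z w} → z ≈ᶜ w → -ᶜ z ≈ᶜ -ᶜ w
  -ᶜ-cong {z} {w} (h , k) = -ᴿ-cong {re z} {re w} h , -ᴿ-cong {im z} {im w} k

  *ᶜ-cong : ∀ {z z′ w w′} → z ≈ᶜ z′ → w ≈ᶜ w′ → z *ᶜ w ≈ᶜ z′ *ᶜ w′
  *ᶜ-cong {z} {z′} {w} {w′} (h , k) (h′ , k′) =
      +ᴿ-cong {re z *ᴿ re w} {re z′ *ᴿ re w′} { -ᴿ (im z *ᴿ im w)} { -ᴿ (im z′ *ᴿ im w′)}
        (*ᴿ-cong {re z} {re z′} {re w} {re w′} h h′)
        (-ᴿ-cong {im z *ᴿ im w} {im z′ *ᴿ im w′} (*ᴿ-cong {im z} {im z′} {im w} {im w′} k k′))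
    , +ᴿ-cong {re z *ᴿ im w} {re z′ *ᴿ im w′} {im z *ᴿ re w} {im z′ *ᴿ re w′}
        (*ᴿ-cong {re z} {re z′} {im w} {im w′} h k′)
        (*ᴿ-cong {im z} {im z′} {re w} {re w′} k h′)

  *ᶜ-comm : ∀ z w → z *ᶜ w ≈ᶜ w *ᶜ z
  *ᶜ-comm z w = pointwiseᶜ {z *ᶜ w} {w *ᶜ z}
    (λ n → cong₂ (λ x y → x ℚ.+ ℚ.- y) (*-comm (sre z n) (sre w n)) (*-comm (sim z n) (sim w n)))
    (λ n → *-comm-im (sre z n) (sim z n) (sre w n) (sim w n))

  *ᶜ-assoc : ∀ z w v → z *ᶜ w *ᶜ v ≈ᶜ z *ᶜ (w *ᶜ v)
  *ᶜ-assoc z w v = pointwiseᶜ {z *ᶜ w *ᶜ v} {z *ᶜ (w *ᶜ v)}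
    (λ n → *-assoc-re (sre z n) (sim z n) (sre w n) (sim w n) (sre v n) (sim v n))
    (λ n → *-assoc-im (sre z n) (sim z n) (sre w n) (sim w n) (sre v n) (sim v n))

  *ᶜ-identityˡ : ∀ z → 1ᶜ *ᶜ z ≈ᶜ z
  *ᶜ-identityˡ z = pointwiseᶜ {1ᶜ *ᶜ z} {z}
    (λ n → trans (cong₂ (λ x y → x ℚ.+ ℚ.- y) (*-identityˡ (sre z n)) (*-zeroˡ (sim z n))) (+-identityʳ (sre z n)))
    (λ n → trans (cong₂ ℚ._+_ (*-identityˡ (sim z n)) (*-zeroˡ (sre z n))) (+-identityʳ (sim z n)))

  *ᶜ-distribˡ-+ᶜ : ∀ z w v → z *ᶜ (w +ᶜ v) ≈ᶜ z *ᶜ w +ᶜ z *ᶜ v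
  *ᶜ-distribˡ-+ᶜ z w v = pointwiseᶜ {z *ᶜ (w +ᶜ v)} {z *ᶜ w +ᶜ z *ᶜ v}
    (λ n → distribˡ-re (sre z n) (sim z n) (sre w n) (sim w n) (sre v n) (sim v n))
    (λ n → distribˡ-im (sre z n) (sim z n) (sre w n) (sim w n) (sre v n) (sim v n))

  ℂ-commutativeRing : CommutativeRing 0ℓ 0ℓ
  ℂ-commutativeRing = record
    { Carrier = ℂ ; _≈_ = _≈ᶜ_ ; _+_ = _+ᶜ_ ; _*_ = _*ᶜ_ ; -_ = -ᶜ_ ; 0# = 0ᶜ ; 1# = 1ᶜ
    ; isCommutativeRing = record
      { isRing = record
        { +-isAbelianGroup = record
          { isGroup = record
            { isMonoid = record
              { isSemigroup = record
                { isMagma = record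
                  { isEquivalence = record
                    { refl = λ {z} → (≈ᶜ-refl {z})
                    ; sym = λ {z} {w} e → (≈ᶜ-sym {z} {w} e)
                    ; trans = λ {z} {w} {v} e f → (≈ᶜ-trans {z} {w} {v} e f) }
                  ; ∙-cong = λ {z} {z′} {w} {w′} e f → (+ᶜ-cong {z} {z′} {w} {w′} e f) }
                ; assoc = λ z w v → pointwiseᶜ {z +ᶜ w +ᶜ v} {z +ᶜ (w +ᶜ v)}
                    (λ n → +-assoc (sre z n) (sre w n) (sre v n))
                    (λ n → +-assoc (sim z n) (sim w n) (sim v n)) }
              ; identity =
                  (λ z → pointwiseᶜ {0ᶜ +ᶜ z} {z} (λ n → +-identityˡ (sre z n)) (λ n → +-identityˡ (sim z n)))
                , (λ z → pointwiseᶜ {z +ᶜ 0ᶜ} {z} (λ n → +-identityʳ (sre z n)) (λ n → +-identityʳ (sim z n))) }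
            ; inverse =
                (λ z → pointwiseᶜ { -ᶜ z +ᶜ z} {0ᶜ} (λ n → +-inverseˡ (sre z n)) (λ n → +-inverseˡ (sim z n)))
              , (λ z → pointwiseᶜ {z +ᶜ -ᶜ z} {0ᶜ} (λ n → +-inverseʳ (sre z n)) (λ n → +-inverseʳ (sim z n)))
            ; ⁻¹-cong = λ {z} {w} e → (-ᶜ-cong {z} {w} e) }
          ; comm = λ z w → pointwiseᶜ {z +ᶜ w} {w +ᶜ z}
              (λ n → +-comm (sre z n) (sre w n)) (λ n → +-comm (sim z n) (sim w n)) }
        ; *-cong = λ {z} {z′} {w} {w′} e f → (*ᶜ-cong {z} {z′} {w} {w′} e f)
        ; *-assoc = λ z w v → (*ᶜ-assoc z w v)
        ; *-identity = (λ z → (*ᶜ-identityˡ z)) , λ z →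
            (≈ᶜ-trans {z *ᶜ 1ᶜ} {1ᶜ *ᶜ z} {z} (*ᶜ-comm z 1ᶜ) (*ᶜ-identityˡ z))
        ; distrib = (λ z w v → (*ᶜ-distribˡ-+ᶜ z w v)) , λ z w v →
            (≈ᶜ-trans {(w +ᶜ v) *ᶜ z} {z *ᶜ (w +ᶜ v)} {w *ᶜ z +ᶜ v *ᶜ z} (*ᶜ-comm (w +ᶜ v) z)
              (≈ᶜ-trans {z *ᶜ (w +ᶜ v)} {z *ᶜ w +ᶜ z *ᶜ v} {w *ᶜ z +ᶜ v *ᶜ z} (*ᶜ-distribˡ-+ᶜ z w v)
                (+ᶜ-cong {z *ᶜ w} {w *ᶜ z} {z *ᶜ v} {v *ᶜ z} (*ᶜ-comm z w) (*ᶜ-comm z v)))) }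
      ; *-comm = λ z w → (*ᶜ-comm z w) } }

-- Roots of unity equal to 1 or apart from it.

module RootDichotomy (R : CommutativeRing 0ℓ 0ℓ) where
  open CommutativeRing R renaming (Carrier to C) hiding (zero)
  open Windows R using (Cancellable)
  open RootsOfUnity R using (geometric)
  open import Algebra.Properties.Ring ring using (x≈y⇒x∙y⁻¹≈ε; x∙y⁻¹≈ε⇒x≈y; x[y-z]≈xy-xz; [y-z]x≈yx-zx)
  open import Algebra.Properties.Semiring.Sum semiring
  open import Algebra.Properties.Semiring.Exp semiring using (_^_)
  open import Algebra.Properties.Semiring.Mult semiring using () renaming (_×_ to _·_)
  open import Data.Fin.Base using (Fin; toℕ)
  open import Data.Nat.Base using (zero; suc; _<_)
  open import Data.Product.Base using (∃-syntax; _,_)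
  open import Data.Sum.Base using (_⊎_; inj₁; inj₂)
  open import Relation.Binary.Reasoning.Setoid setoid

  -- Modulo 1 - z every power of z is 1. The witness comes from the recursion S ↦ 1 + z S with z S =
  -- S - (1 - z) S.
  power-sum-expansion : ∀ z n → ∃[ y ] sum {n} (λ i → z ^ toℕ i) ≈ n · 1# + (1# - z) * y
  power-sum-expansion z zero = 0# , sym (trans (+-identityˡ _) (zeroʳ _))
  power-sum-expansion z (suc n) with power-sum-expansion z n
  ... | y , e = y - S , (begin
    1# + sum {n} (λ i → z * z ^ toℕ i)       ≈⟨ +-congˡ (*-distribˡ-sum z (λ (i : Fin n) → z ^ toℕ i)) ⟨
    1# + z * S                               ≈⟨ +-congˡ zS ⟩
    1# + (S - (1# - z) * S)                  ≈⟨ +-congˡ (+-congʳ e) ⟩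
    1# + ((n · 1# + (1# - z) * y) - (1# - z) * S)   ≈⟨ +-congˡ (trans (+-assoc _ _ _)
        (+-congˡ (sym (x[y-z]≈xy-xz (1# - z) y S)))) ⟩
    1# + (n · 1# + (1# - z) * (y - S))       ≈⟨ +-assoc _ _ _ ⟨
    1# + n · 1# + (1# - z) * (y - S)         ∎)
    where
    S : C
    S = sum {n} λ i → z ^ toℕ i
    open import Algebra.Properties.Group +-group using (⁻¹-anti-homo-//; //-rightDividesˡ)
    zS : z * S ≈ S - (1# - z) * S
    zS = sym (begin
      S - (1# - z) * S          ≈⟨ +-congˡ (-‿cong (trans ([y-z]x≈yx-zx S 1# z) (+-congʳ (*-identityˡ S)))) ⟩
      S - (S - z * S)           ≈⟨ +-congˡ (⁻¹-anti-homo-// S (z * S)) ⟩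
      S + (z * S - S)           ≈⟨ +-comm _ _ ⟩
      (z * S - S) + S           ≈⟨ //-rightDividesˡ S (z * S) ⟩
      z * S                     ∎)

  -- If (1 − z) y is cancellable so is 1 − z; otherwise 1 + z + … + z^(n−1) is,
  -- being n + (1 − z) y, and its product with 1 − z vanishes.
  root-dichotomy : (∀ w → Cancellable w ⊎ (∀ n → 0 < n → Cancellable (n · 1# + w))) →
    ∀ n → 0 < n → ∀ z → z ^ n ≈ 1# → z ≈ 1# ⊎ Cancellable (1# - z)
  root-dichotomy split n 0<n z zⁿ≈1 with power-sum-expansion z n
  ... | y , e with split ((1# - z) * y)
  ... | inj₁ cancel = inj₂ λ w h → cancel w (begin
    (1# - z) * y * w      ≈⟨ trans (*-congʳ (*-comm _ _)) (*-assoc _ _ _) ⟩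
    y * ((1# - z) * w)    ≈⟨ trans (*-congˡ h) (zeroʳ y) ⟩
    0#                    ∎)
  ... | inj₂ cancel = inj₁ (sym (x∙y⁻¹≈ε⇒x≈y 1# z (cancel n 0<n (1# - z) (begin
    (n · 1# + (1# - z) * y) * (1# - z)         ≈⟨ *-comm _ _ ⟩
    (1# - z) * (n · 1# + (1# - z) * y)         ≈⟨ *-congˡ e ⟨
    (1# - z) * sum {n} (λ i → z ^ toℕ i)       ≈⟨ geometric z n ⟩
    1# - z ^ n                                 ≈⟨ x≈y⇒x∙y⁻¹≈ε (sym zⁿ≈1) ⟩
    0#                                         ∎))))

-- Cancellation in ℂ by lower bounds for the norm.

module ComplexAnalysis where
  open Rationals
  open Reals
  open Complex
  open ComplexIdentities
  open RootDichotomy ℂ-commutativeRing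
  open Windows ℂ-commutativeRing using (Cancellable)
  open import Algebra.Properties.Semiring.Mult (CommutativeRing.semiring ℂ-commutativeRing)
    using () renaming (_×_ to _·_)
  open import Data.Integer.Base using (+_)
  open import Data.Nat.Base as ℕ using (ℕ; zero; suc)
  import Data.Nat.Properties as ℕ
  open import Data.Product.Base using (∃-syntax; _×_; _,_)
  open import Data.Rational.Base using (ℚ; 0ℚ; 1ℚ; ½; _/_; _+_; _*_; _-_; -_; ∣_∣; _≤_; _<_; positive; nonNegative)
  open import Data.Rational.Properties
  open import Data.Sum.Base using (_⊎_; inj₁; inj₂)
  open import Data.Unit.Base using (tt)
  open import Relation.Binary.PropositionalEquality
  open import Relation.Nullary.Decidable using (Dec; yes; no; toWitness)

  norm² : ℂ → ℝ
  norm² z = re z *ᴿ re z +ᴿ im z *ᴿ im z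

  minus-0 : ∀ p → p - 0ℚ ≡ p
  minus-0 = +-identityʳ

  bounded-below-cancel : ∀ {t x c} → 0ℚ < c → (Eventually λ k → c ≤ seq t k) →
    t *ᴿ x ≈ᴿ 0ᴿ → x ≈ᴿ 0ᴿ
  bounded-below-cancel {t} {x} {c} 0<c c≤t tx≈0 ε 0<ε = eventually-map₂
    (λ k c≤tₖ tx≤ → subst (λ p → ∣ p ∣ ≤ ε) (sym (minus-0 (seq x k)))
      (*-cancelˡ-≤-pos c {{positive 0<c}} (begin
        c * ∣ seq x k ∣                ≤⟨ *-monoʳ-≤-nonNeg (∣ seq x k ∣) {{nonNegative (0≤∣p∣ (seq x k))}}
                                            (≤-trans c≤tₖ (p≤∣p∣ (seq t k))) ⟩
        ∣ seq t k ∣ * ∣ seq x k ∣      ≡⟨ ∣p*q∣≡∣p∣*∣q∣ (seq t k) (seq x k) ⟨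
        ∣ seq t k * seq x k ∣          ≡⟨ cong ∣_∣ (minus-0 (seq t k * seq x k)) ⟨
        ∣ seq t k * seq x k - 0ℚ ∣     ≤⟨ tx≤ ⟩
        c * ε                          ∎)))
    c≤t (tx≈0 (c * ε) (*-pos 0<c 0<ε))
    where open ≤-Reasoning

  -- Multiplying z w = 0 by the conjugate of z gives |z|² w = 0 in each component, and |z|² is
  -- bounded away from 0.
  norm-cancellable : ∀ {z c} → 0ℚ < c → (Eventually λ k → c ≤ seq (norm² z) k) → Cancellable z
  norm-cancellable {z} {c} 0<c c≤ w (h , k) =
      bounded-below-cancel {norm² z} {re w} 0<c c≤
        (≈ᴿ-trans {norm² z *ᴿ re w} {combine} {0ᴿ}
          (pointwise {norm² z *ᴿ re w} {combine} λ n → sym (conj-re R (sre z n) (sim z n) (sre w n) (sim w n)))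
          (combination-0 {re z} {im z} {re (z *ᶜ w)} {im (z *ᶜ w)} h k))
    , bounded-below-cancel {norm² z} {im w} 0<c c≤
        (≈ᴿ-trans {norm² z *ᴿ im w} {combine′} {0ᴿ}
          (pointwise {norm² z *ᴿ im w} {combine′} λ n → sym (trans
            (cong (_+_ (sre z n * sim (z *ᶜ w) n)) (sym (neg-distribˡ-* (sim z n) (sre (z *ᶜ w) n))))
            (conj-im R (sre z n) (sim z n) (sre w n) (sim w n))))
          (combination-0 {re z} { -ᴿ im z} {im (z *ᶜ w)} {re (z *ᶜ w)} k h))
    where
    R : CommutativeRing 0ℓ 0ℓ
    R = +-*-commutativeRing
    combine combine′ : ℝ
    combine  = re z *ᴿ re (z *ᶜ w) +ᴿ im z *ᴿ im (z *ᶜ w)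
    combine′ = re z *ᴿ im (z *ᶜ w) +ᴿ (-ᴿ im z) *ᴿ re (z *ᶜ w)
    combination-0 : ∀ {x y a b} → a ≈ᴿ 0ᴿ → b ≈ᴿ 0ᴿ → x *ᴿ a +ᴿ y *ᴿ b ≈ᴿ 0ᴿ
    combination-0 {x} {y} {a} {b} a≈0 b≈0 =
      ≈ᴿ-trans {x *ᴿ a +ᴿ y *ᴿ b} {x *ᴿ 0ᴿ +ᴿ y *ᴿ 0ᴿ} {0ᴿ}
        (+ᴿ-cong {x *ᴿ a} {x *ᴿ 0ᴿ} {y *ᴿ b} {y *ᴿ 0ᴿ}
          (*ᴿ-cong {x} {x} {a} {0ᴿ} (≈ᴿ-refl {x}) a≈0) (*ᴿ-cong {y} {y} {b} {0ᴿ} (≈ᴿ-refl {y}) b≈0))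
        (pointwise {x *ᴿ 0ᴿ +ᴿ y *ᴿ 0ᴿ} {0ᴿ} λ n →
          trans (cong₂ _+_ (*-zeroʳ (seq x n)) (*-zeroʳ (seq y n))) (+-identityʳ 0ℚ))

  private
    ¼ ⅛ 1/16 : ℚ
    ¼ = + 1 / 4
    ⅛ = + 1 / 8
    1/16 = + 1 / 16

  -- The order of reals is undecidable, but the two alternatives overlap. One approximation that is
  -- within 1/16 of all later ones is compared with 1/8; the later ones then are at least 1/16 or at
  -- most 3/16 ≤ 1/4.
  norm-dichotomy : ∀ w → (Eventually λ k → 1/16 ≤ seq (norm² w) k) ⊎ (Eventually λ k → seq (norm² w) k ≤ ¼)
  norm-dichotomy w = go (cauchy (norm² w) 1/16 (positive⁻¹ 1/16))
    where
    r : ℕ → ℚ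
    r = seq (norm² w)
    go : (∃[ N ] (∀ m n → N ℕ.≤ m → N ℕ.≤ n → ∣ r m - r n ∣ ≤ 1/16)) →
      (Eventually λ k → 1/16 ≤ r k) ⊎ (Eventually λ k → r k ≤ ¼)
    go (N , close) = decide (r N ≤? ⅛)
      where
      decide : Dec (r N ≤ ⅛) → (Eventually λ k → 1/16 ≤ r k) ⊎ (Eventually λ k → r k ≤ ¼)
      decide (yes rN≤⅛) = inj₂ (N , λ k N≤k → ≤-trans (∣p-q∣≤⇒p≤q+ {r k} {r N} (close k N N≤k ℕ.≤-refl))
        (≤-trans (+-monoˡ-≤ 1/16 rN≤⅛) (toWitness {a? = ⅛ + 1/16 ≤? ¼} tt)))
      decide (no rN≰⅛) = inj₁ (N , λ k N≤k → +-cancelʳ-≤ 1/16 1/16 (r k)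
        (≤-trans (<⇒≤ (≰⇒> rN≰⅛)) (∣p-q∣≤⇒p≤q+ {r N} {r k} (close N k ℕ.≤-refl N≤k))))

  sre-· : ∀ n k → sre (n · 1ᶜ) k ≡ toℚ n
  sre-· zero k = refl
  sre-· (suc n) k = trans (cong (_+_ 1ℚ) (sre-· n k)) (sym (toℚ-+ 1 n))

  sim-· : ∀ n k → sim (n · 1ᶜ) k ≡ 0ℚ
  sim-· zero k = refl
  sim-· (suc n) k = trans (cong (_+_ 0ℚ) (sim-· n k)) (+-identityʳ 0ℚ)

  square-≤-norm : ∀ a b → a * a ≤ a * a + b * b
  square-≤-norm a b = ≤-+ʳ (p²-nonneg b)

  -- From |Re w| ≤ 1/2 and n ≥ 1 the real part of n + w is at least 1/2. This is the reason for the
  -- threshold 1/4 in `norm-dichotomy`.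
  small⇒cancellable : ∀ w → (Eventually λ k → seq (norm² w) k ≤ ¼) →
    ∀ n → 0 ℕ.< n → Cancellable (n · 1ᶜ +ᶜ w)
  small⇒cancellable w small n 0<n = norm-cancellable {n · 1ᶜ +ᶜ w} {¼} (positive⁻¹ ¼)
    (eventually-map (λ k → bound k) small)
    where
    bound : ∀ k → seq (norm² w) k ≤ ¼ → ¼ ≤ seq (norm² (n · 1ᶜ +ᶜ w)) k
    bound k h = ≤-trans (*-mono {½} {x} {½} {x} (<⇒≤ (positive⁻¹ ½)) (≤-trans (<⇒≤ (positive⁻¹ ½)) ½≤x) ½≤x ½≤x)
      (square-≤-norm x (sim (n · 1ᶜ +ᶜ w) k))
      where
      a x : ℚ
      a = sre w k
      x = sre (n · 1ᶜ +ᶜ w) k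
      ∣a∣≤½ : ∣ a ∣ ≤ ½
      ∣a∣≤½ = sq-cancel-≤ (<⇒≤ (positive⁻¹ ½)) (subst (_≤ ½ * ½) (sym (∣p∣²≡p² a))
        (≤-trans (square-≤-norm a (sim w k)) h))
      ½≤x : ½ ≤ x
      ½≤x = +-mono-≤ {1ℚ} {sre (n · 1ᶜ) k} { - ½} {a}
        (subst (1ℚ ≤_) (sym (sre-· n k)) (toℚ-mono 0<n))
        (≤-trans (neg-antimono-≤ ∣a∣≤½) (-∣p∣≤p a))

  open import Algebra.Properties.Semiring.Exp (CommutativeRing.semiring ℂ-commutativeRing) using (_^_)

  root-of-unity-dichotomy : ∀ n → 0 ℕ.< n → ∀ z → z ^ n ≈ᶜ 1ᶜ → z ≈ᶜ 1ᶜ ⊎ Cancellable (1ᶜ +ᶜ -ᶜ z)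
  root-of-unity-dichotomy = root-dichotomy split
    where
    split : ∀ w → Cancellable w ⊎ (∀ n → 0 ℕ.< n → Cancellable (n · 1ᶜ +ᶜ w))
    split w with norm-dichotomy w
    ... | inj₁ large = inj₁ (norm-cancellable {w} {1/16} (positive⁻¹ 1/16) large)
    ... | inj₂ small = inj₂ (small⇒cancellable w small)

-- Bounds for reals, complex numbers and the Frobenius norm.

module Bounds where
  open Rationals
  open Reals
  open Complex
  open ComplexAnalysis using (norm²; square-≤-norm)
  open DifferenceIdentities using (shifted-product)
  open ComplexIdentities using (norm-*)
  open import Data.Fin.Base using (Fin; zero; suc)
  open import Data.Nat.Base as ℕ using (ℕ; zero; suc)
  import Data.Nat.Properties as ℕ
  open import Data.Product.Base using (∃-syntax; _×_; _,_)
  open import Data.Rational.Base using (ℚ; 0ℚ; 1ℚ; _+_; _*_; _-_; -_; ∣_∣; _≤_; _<_; nonNegative)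
  open import Data.Rational.Properties
  open import Data.Sum.Base using (_⊎_; inj₁; inj₂)
  open import Relation.Binary.PropositionalEquality

  -- This is |x| ≤ b on representatives: single terms may exceed b, though eventually by no more
  -- than any given ε.
  record Bounded (b : ℚ) (x : ℝ) : Set where
    constructor bounded-by
    field eventually-≤ : ∀ ε → 0ℚ < ε → Eventually λ k → ∣ seq x k ∣ ≤ b + ε

  open Bounded

  bounded⇒≤ : ∀ {b x} → Bounded b x → x ≤ᴿ fromℚ b
  bounded⇒≤ {b} {x} h ε 0<ε = eventually-map (λ k → ≤-trans (p≤∣p∣ (seq x k))) (eventually-≤ h ε 0<ε)

  bounded-mono : ∀ {b c x} → b ≤ c → Bounded b x → Bounded c x
  bounded-mono b≤c h = bounded-by λ ε 0<ε →
    eventually-map (λ k hₖ → ≤-trans hₖ (+-monoˡ-≤ ε b≤c)) (eventually-≤ h ε 0<ε)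

  bounded-fromℚ : ∀ {b} → 0ℚ ≤ b → Bounded b (fromℚ b)
  bounded-fromℚ 0≤b = bounded-by λ ε 0<ε → 0 , λ k _ →
    ≤-trans (≤-reflexive (0≤p⇒∣p∣≡p 0≤b)) (≤-+ʳ (<⇒≤ 0<ε))

  bounded-0 : ∀ {b} → 0ℚ ≤ b → Bounded b 0ᴿ
  bounded-0 0≤b = bounded-mono 0≤b (bounded-fromℚ ≤-refl)

  bounded-neg : ∀ {b x} → Bounded b x → Bounded b (-ᴿ x)
  bounded-neg {b} {x} h = bounded-by λ ε 0<ε →
    eventually-map (λ k → subst (_≤ b + ε) (sym (∣-p∣≡∣p∣ (seq x k)))) (eventually-≤ h ε 0<ε)

  bounded-+ : ∀ {a b x y} → Bounded a x → Bounded b y → Bounded (a + b) (x +ᴿ y)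
  bounded-+ {a} {b} {x} {y} h h′ = bounded-by λ ε 0<ε →
    eventually-map₂ (λ k hₖ h′ₖ → ≤-trans (∣p+q∣≤∣p∣+∣q∣ (seq x k) (seq y k))
      (≤-trans (+-mono-≤ hₖ h′ₖ) (≤-reflexive (trans (interchange a (half ε) b (half ε))
        (cong (_+_ (a + b)) (half+half ε))))))
    (eventually-≤ h (half ε) (half-pos 0<ε)) (eventually-≤ h′ (half ε) (half-pos 0<ε))
    where
    open import Algebra.Properties.CommutativeSemigroup
      (CommutativeRing.+-commutativeSemigroup +-*-commutativeRing) using (interchange)

  -- (a + η)(b + η) = a b + (a + b + η) η, and η ≤ 1 makes the excess at most (a + b + 1) η.
  bounded-* : ∀ {a b x y} → 0ℚ ≤ a → 0ℚ ≤ b → Bounded a x → Bounded b y → Bounded (a * b) (x *ᴿ y)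
  bounded-* {a} {b} {x} {y} 0≤a 0≤b h h′ = bounded-by λ ε 0<ε →
    go ε (small-multiple {a + b + 1ℚ} (+-nonneg (+-nonneg 0≤a 0≤b) (<⇒≤ 0<1)) 0<ε)
    where
    go : ∀ ε → (∃[ η ] 0ℚ < η × η ≤ 1ℚ × (a + b + 1ℚ) * η ≤ ε) →
      Eventually λ k → ∣ seq x k * seq y k ∣ ≤ a * b + ε
    go ε (η , 0<η , η≤1 , cη≤ε) = eventually-map₂ (λ k hₖ h′ₖ → begin
      ∣ seq x k * seq y k ∣            ≡⟨ ∣p*q∣≡∣p∣*∣q∣ (seq x k) (seq y k) ⟩
      ∣ seq x k ∣ * ∣ seq y k ∣        ≤⟨ *-mono (0≤∣p∣ (seq y k)) (+-nonneg 0≤a (<⇒≤ 0<η)) hₖ h′ₖ ⟩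
      (a + η) * (b + η)                ≡⟨ shifted-product +-*-commutativeRing a b η ⟩
      a * b + (a + b + η) * η          ≤⟨ +-monoʳ-≤ (a * b) (*-monoʳ-≤-nonNeg η {{nonNegative (<⇒≤ 0<η)}}
                                            (+-monoʳ-≤ (a + b) η≤1)) ⟩
      a * b + (a + b + 1ℚ) * η         ≤⟨ +-monoʳ-≤ (a * b) cη≤ε ⟩
      a * b + ε                        ∎)
      (eventually-≤ h η 0<η) (eventually-≤ h′ η 0<η)
      where open ≤-Reasoning

  -- A tolerance ε² under the root becomes ε outside, since b² + ε² ≤ (b + ε)².
  bounded-√ : ∀ {b x} → 0ℚ ≤ b → Bounded (b * b) x → Bounded b (√ x)
  bounded-√ {b} {x} 0≤b h = bounded-by λ ε 0<ε →
    eventually-map (λ k hₖ → subst (_≤ b + ε) (sym (0≤p⇒∣p∣≡p (sqrtApprox-nonneg k (seq x k))))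
      (go ε 0<ε k (≤-trans (p≤∣p∣ (seq x k)) hₖ) (sqrtApprox-lower k (seq x k))))
    (eventually-≤ h (ε * ε) (*-pos 0<ε 0<ε))
    where
    go : ∀ ε → 0ℚ < ε → ∀ k → seq x k ≤ b * b + ε * ε →
      sqrtApprox k (seq x k) ≡ 0ℚ ⊎ sqrtApprox k (seq x k) * sqrtApprox k (seq x k) ≤ seq x k →
      sqrtApprox k (seq x k) ≤ b + ε
    go ε 0<ε k x≤ (inj₁ f≡0) = subst (_≤ b + ε) (sym f≡0) (+-nonneg 0≤b (<⇒≤ 0<ε))
    go ε 0<ε k x≤ (inj₂ f²≤x) = sq-cancel-≤ (+-nonneg 0≤b 0≤ε) (≤-trans f²≤x (≤-trans x≤
      (subst (b * b + ε * ε ≤_) (sym (*-distribʳ-+ (b + ε) b ε)) (+-mono-≤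
        (*-monoˡ-≤-nonNeg b {{nonNegative 0≤b}} (≤-+ʳ 0≤ε))
        (*-monoˡ-≤-nonNeg ε {{nonNegative 0≤ε}} (≤-+ˡ 0≤b))))))
      where
      0≤ε : 0ℚ ≤ ε
      0≤ε = <⇒≤ 0<ε

  bounded-sum : ∀ {m c} (f : Fin m → ℝ) → (∀ i → Bounded c (f i)) → Bounded (toℚ m * c) (sumᴿ f)
  bounded-sum {zero} {c} f h = bounded-0 (≤-reflexive (sym (*-zeroˡ c)))
  bounded-sum {suc m} {c} f h = bounded-mono (≤-reflexive (sym (trans (cong (_* c) (toℚ-+ 1 m))
      (trans (*-distribʳ-+ c 1ℚ (toℚ m)) (cong (_+ toℚ m * c) (*-identityˡ c))))))
    (bounded-+ (h zero) (bounded-sum (λ i → f (suc i)) (λ i → h (suc i))))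

  -- The m² squared moduli add up to at most (m c)². The hypothesis is about `norm²` because that is
  -- free of roots.
  bounded-frobenius : ∀ {m c} (A : Matrix m m) → 0ℚ ≤ c →
    (∀ i j → Bounded (c * c) (norm² (A i j))) → Bounded (toℚ m * c) ‖ A ‖
  bounded-frobenius {m} {c} A 0≤c h = bounded-√ (*-nonneg (toℚ-nonneg m) 0≤c)
    (bounded-mono (≤-reflexive rearrange)
      (bounded-sum (λ i → sumᴿ λ j → ∣ A i j ∣ᶜ ^ᴿ 2) λ i →
        bounded-sum (λ j → ∣ A i j ∣ᶜ ^ᴿ 2) λ j →
          bounded-* 0≤c (*-nonneg 0≤c 0≤1) (modulus i j)
            (bounded-* 0≤c 0≤1 (modulus i j) (bounded-fromℚ 0≤1))))
    where
    0≤1 : 0ℚ ≤ 1ℚ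
    0≤1 = <⇒≤ 0<1
    modulus : ∀ i j → Bounded c ∣ A i j ∣ᶜ
    modulus i j = bounded-√ 0≤c (h i j)
    open import Algebra.Properties.CommutativeSemigroup
      (CommutativeRing.*-commutativeSemigroup +-*-commutativeRing) using (interchange)
    rearrange : toℚ m * (toℚ m * (c * (c * 1ℚ))) ≡ (toℚ m * c) * (toℚ m * c)
    rearrange = trans (cong (λ d → toℚ m * (toℚ m * (c * d))) (*-identityʳ c))
      (trans (sym (*-assoc (toℚ m) (toℚ m) (c * c))) (interchange (toℚ m) (toℚ m) c c))

  -- 2 c² ≤ (2 c)²: the sharp modulus √2 c is irrational and is rounded up to 2 c. The factor 2 of
  -- the theorem originates here.
  bounded-norm² : ∀ {c z} → 0ℚ ≤ c → Bounded c (re z) → Bounded c (im z) →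
    Bounded ((c + c) * (c + c)) (norm² z)
  bounded-norm² {c} {z} 0≤c h h′ = bounded-mono
    (subst (c * c + c * c ≤_) (sym (*-distribʳ-+ (c + c) c c))
      (+-mono-≤ c*c≤ c*c≤))
    (bounded-+ (bounded-* 0≤c 0≤c h h) (bounded-* 0≤c 0≤c h′ h′))
    where
    c*c≤ : c * c ≤ c * (c + c)
    c*c≤ = *-monoˡ-≤-nonNeg c {{nonNegative 0≤c}} (≤-+ʳ 0≤c)

  -- Exact at every index, because products are formed termwise; so a bound for z^n carries over to
  -- the single terms of z.
  norm²-power : ∀ z n k → seq (norm² (z ^ᶜ n)) k ≡ seq (norm² z) k ^ℚ n
  norm²-power z zero k = refl
  norm²-power z (suc n) k = trans
    (norm-* +-*-commutativeRing (sre z k) (sim z k) (sre (z ^ᶜ n) k) (sim (z ^ᶜ n) k))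
    (cong (seq (norm² z) k *_) (norm²-power z n k))

  norm²-nonneg : ∀ z k → 0ℚ ≤ seq (norm² z) k
  norm²-nonneg z k = +-nonneg (p²-nonneg (sre z k)) (p²-nonneg (sim z k))

  -- The terms of (|z|²)^(n+1) are eventually at most 1 + ε, and `power-≤⇒≤` passes to |z|².
  root-norm²-bounded : ∀ {z} n → z ^ᶜ suc n ≈ᶜ 1ᶜ → Bounded 1ℚ (norm² z)
  root-norm²-bounded {z} n (re≈ , im≈) = bounded-by λ ε 0<ε → eventually-map
    (λ k hₖ → subst (_≤ 1ℚ + ε) (sym (0≤p⇒∣p∣≡p (norm²-nonneg z k)))
      (power-≤⇒≤ n (norm²-nonneg z k) (≤-+ʳ (<⇒≤ 0<ε))
        (subst (_≤ 1ℚ + ε) (norm²-power z (suc n) k)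
          (∣p-q∣≤⇒p≤q+ {seq (norm² (z ^ᶜ suc n)) k} {1ℚ} hₖ))))
    (norm≈1 ε 0<ε)
    where
    w : ℂ
    w = z ^ᶜ suc n
    norm≈1 : norm² w ≈ᴿ norm² 1ᶜ
    norm≈1 = +ᴿ-cong {re w *ᴿ re w} {1ᴿ *ᴿ 1ᴿ} {im w *ᴿ im w} {0ᴿ *ᴿ 0ᴿ}
      (*ᴿ-cong {re w} {1ᴿ} {re w} {1ᴿ} re≈ re≈) (*ᴿ-cong {im w} {0ᴿ} {im w} {0ᴿ} im≈ im≈)

  norm²-bounded⇒component-bounded : ∀ {z} → Bounded 1ℚ (norm² z) → Bounded 1ℚ (re z) × Bounded 1ℚ (im z)
  norm²-bounded⇒component-bounded {z} h =
      bounded-by (λ ε 0<ε → eventually-map (λ k hₖ → component ε 0<ε (sre z k)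
        (≤-trans (square-≤-norm (sre z k) (sim z k)) (≤-trans (p≤∣p∣ (seq (norm² z) k)) hₖ)))
        (eventually-≤ h ε 0<ε))
    , bounded-by (λ ε 0<ε → eventually-map (λ k hₖ → component ε 0<ε (sim z k)
        (≤-trans (≤-+ˡ (p²-nonneg (sre z k))) (≤-trans (p≤∣p∣ (seq (norm² z) k)) hₖ)))
        (eventually-≤ h ε 0<ε))
    where
    component : ∀ ε → 0ℚ < ε → ∀ a → a * a ≤ 1ℚ + ε → ∣ a ∣ ≤ 1ℚ + ε
    component ε 0<ε a a²≤ = sq-cancel-≤ 0≤1+ε (subst (_≤ (1ℚ + ε) * (1ℚ + ε)) (sym (∣p∣²≡p² a))
      (≤-trans a²≤ (subst (_≤ (1ℚ + ε) * (1ℚ + ε)) (*-identityʳ (1ℚ + ε))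
        (*-monoˡ-≤-nonNeg (1ℚ + ε) {{nonNegative 0≤1+ε}} (≤-+ʳ (<⇒≤ 0<ε))))))
      where
      0≤1+ε : 0ℚ ≤ 1ℚ + ε
      0≤1+ε = +-nonneg (<⇒≤ 0<1) (<⇒≤ 0<ε)

  -- Bounds for the two components add up under sums, whereas the modulus would require the triangle
  -- inequality in ℂ.
  record Boundedᶜ (b : ℚ) (z : ℂ) : Set where
    constructor _,ᶜ_
    field
      re-bounded : Bounded b (re z)
      im-bounded : Bounded b (im z)

  boundedᶜ-scale : ∀ {b u z} → 0ℚ ≤ b → 0ℚ ≤ u → Boundedᶜ b z → Boundedᶜ (u * b) ((fromℚ u +i 0ᴿ) *ᶜ z)
  boundedᶜ-scale {b} {u} {z} 0≤b 0≤u (h ,ᶜ h′) =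
    bounded-mono (≤-reflexive u*b+0) (bounded-+ (bounded-* 0≤u 0≤b u-bounded h)
      (bounded-neg (bounded-* ≤-refl 0≤b 0-bounded h′)))
    ,ᶜ bounded-mono (≤-reflexive u*b+0) (bounded-+ (bounded-* 0≤u 0≤b u-bounded h′)
      (bounded-* ≤-refl 0≤b 0-bounded h))
    where
    u-bounded : Bounded u (fromℚ u)
    u-bounded = bounded-fromℚ 0≤u
    0-bounded : Bounded 0ℚ 0ᴿ
    0-bounded = bounded-0 ≤-refl
    u*b+0 : u * b + 0ℚ * b ≡ u * b
    u*b+0 = trans (cong (_+_ (u * b)) (*-zeroˡ b)) (+-identityʳ (u * b))

  module W = Windows ℂ-commutativeRing

  window-boundedᶜ : ∀ P Q j {φ} → (∀ k → Boundedᶜ 1ℚ (φ k)) →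
    Boundedᶜ (toℚ (Polynomials.weight P ℕ.* Polynomials.weight Q)) (W.window P Q j φ)
  window-boundedᶜ P Q j {φ} h = subst (λ w → Boundedᶜ (toℚ (Polynomials.weight P ℕ.* w)) (W.window P Q j φ))
    (ℕ.*-identityʳ (Polynomials.weight Q))
    (W.window-bounded (λ b → Boundedᶜ (toℚ b))
      (λ {b} → bounded-0 (toℚ-nonneg b) ,ᶜ bounded-0 (toℚ-nonneg b))
      (λ { (h ,ᶜ h′) → bounded-neg h ,ᶜ bounded-neg h′ })
      (λ { {a} {b} {x} {y} (h ,ᶜ h′) (k ,ᶜ k′) → subst (λ c → Boundedᶜ c (x +ᶜ y)) (sym (toℚ-+ a b))
        (bounded-+ h k ,ᶜ bounded-+ h′ k′) })
      P Q j {1} h)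

-- Existence of the Lam-Leung cofactors.

module CofactorExistence where
  open Polynomials using (Cofactors)
  open import Data.Nat.Base using (ℕ; zero; suc; _+_; _*_; _∸_; _≤_; _<_; z≤n; s≤s; NonZero; >-nonZero)
  open import Data.Nat.Coprimality using (Coprime; coprime-Bézout)
  open import Data.Nat.DivMod using (_/_; _%_; m≡m%n+[m/n]*n; m%n<n)
  open import Data.Nat.Divisibility using (_∣_; divides; ∣m+n∣m⇒∣n; ∣1⇒≡1; n∣m*n)
  open import Data.Nat.GCD using (module Bézout)
  open import Data.Nat.Properties
  open import Data.Nat.Solver using (module +-*-Solver)
  open import Relation.Binary.PropositionalEquality
  open import Relation.Nullary.Negation using (contradiction)
  open +-*-Solver using (solve; _:=_; _:+_; _:*_; con)

  -- Bézout's identity comes with either sign; exchanging p and q reduces one to the other.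
  cofactors-swap : ∀ {p q} → Cofactors q p → Cofactors p q
  cofactors-swap {p} {q} W = record
    { ρ = σ ; ρ′ = σ′ ; σ = ρ ; σ′ = ρ′ ; 0<ρ = 0<σ ; 0<ρ′ = 0<σ′ ; 0<σ = 0<ρ ; 0<σ′ = 0<ρ′
    ; ρ+ρ′≡q = σ+σ′≡p ; σ+σ′≡p = ρ+ρ′≡q
    ; bezout = trans (+-comm (p * σ) (q * ρ)) (trans bezout (cong suc (*-comm q p))) }
    where open Cofactors W

  -- From ρ p = y q + 1 the other cofactor is σ = p - y, as q (p - y) = p q + 1 - ρ p.
  inverse⇒cofactors : ∀ {p q ρ y} → 1 < p → 1 < q → ρ < q → suc (y * q) ≡ ρ * p → Cofactors p q
  inverse⇒cofactors {p} {q} {ρ} {y} 1<p 1<q ρ<q e = record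
    { ρ = ρ ; ρ′ = q ∸ ρ ; σ = p ∸ y ; σ′ = y
    ; 0<ρ = 0<ρ ρ e ; 0<ρ′ = m<n⇒0<n∸m ρ<q ; 0<σ = m<n⇒0<n∸m y<p ; 0<σ′ = 0<y y e
    ; ρ+ρ′≡q = m+[n∸m]≡n (<⇒≤ ρ<q) ; σ+σ′≡p = m∸n+n≡m (<⇒≤ y<p)
    ; bezout = trans (cong₂ _+_ (trans (*-comm p ρ) (sym e)) (*-comm q (p ∸ y)))
        (cong suc (trans (sym (*-distribʳ-+ q y (p ∸ y)))
          (cong (_* q) (m+[n∸m]≡n (<⇒≤ y<p))))) }
    where
    0<ρ : ∀ ρ → suc (y * q) ≡ ρ * p → 0 < ρ
    0<ρ (suc _) _ = s≤s z≤n
    y<p : y < p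
    y<p = *-cancelʳ-< q y p (≤-trans (≤-reflexive e) (≤-trans (*-monoˡ-≤ p (<⇒≤ ρ<q)) (≤-reflexive (*-comm q p))))
    0<y : ∀ y → suc (y * q) ≡ ρ * p → 0 < y
    0<y zero e = contradiction (∣1⇒≡1 (divides ρ e)) λ p≡1 → <-irrefl (sym p≡1) 1<p
    0<y (suc _) _ = s≤s z≤n

  -- Reducing x modulo q removes k p q with k = x / q from the right-hand side, which lowers y by k
  -- p.
  bezout⇒cofactors : ∀ {p q} x y → 1 < p → 1 < q → 1 + y * q ≡ x * p → Cofactors p q
  bezout⇒cofactors {p} {q} x y 1<p 1<q e = inverse⇒cofactors {y = y ∸ x / q * p} 1<p 1<q (m%n<n x q) reduced
    where
    instance
      q≢0 : NonZero q
      q≢0 = >-nonZero (<-trans (s≤s z≤n) 1<q)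
    ρ k : ℕ
    ρ = x % q
    k = x / q
    e′ : suc (y * q) ≡ ρ * p + k * p * q
    e′ = trans e (trans (cong (_* p) (m≡m%n+[m/n]*n x q))
      (solve 4 (λ ρ k p q → (ρ :+ k :* q) :* p := ρ :* p :+ k :* p :* q) refl ρ k p q))
    -- Otherwise ρ p + k p q = 1 + y q ≤ k p q, so ρ p = 0 and q divides 1.
    kp≤y : k * p ≤ y
    kp≤y = ≮⇒≥ λ y<kp → contradiction (∣1⇒≡1 (q∣1 y<kp)) λ q≡1 → <-irrefl (sym q≡1) 1<q
      where
      ρp≡0 : y < k * p → ρ * p ≡ 0
      ρp≡0 y<kp = n≤0⇒n≡0 (+-cancelʳ-≤ (k * p * q) (ρ * p) 0 (begin
        ρ * p + k * p * q   ≡⟨ e′ ⟨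
        suc (y * q)         ≤⟨ +-monoˡ-≤ (y * q) (<⇒≤ 1<q) ⟩
        suc y * q           ≤⟨ *-monoˡ-≤ q y<kp ⟩
        k * p * q           ∎))
        where open ≤-Reasoning
      q∣1 : y < k * p → q ∣ 1
      q∣1 y<kp = ∣m+n∣m⇒∣n (subst (q ∣_) (trans (sym (trans e′ (cong (_+ k * p * q) (ρp≡0 y<kp)))) (+-comm 1 (y * q)))
        (n∣m*n (k * p))) (n∣m*n y)
    reduced : suc ((y ∸ k * p) * q) ≡ ρ * p
    reduced = +-cancelʳ-≡ (k * p * q) _ _ (trans (cong suc (trans (sym (*-distribʳ-+ q (y ∸ k * p) (k * p)))
      (cong (_* q) (m∸n+n≡m kp≤y)))) e′)

  coprime⇒cofactors : ∀ {p q} → 1 < p → 1 < q → Coprime p q → Cofactors p q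
  coprime⇒cofactors 1<p 1<q p⊥q with coprime-Bézout p⊥q
  ... | Bézout.+- x y e = bezout⇒cofactors x y 1<p 1<q e
  ... | Bézout.-+ x y e = cofactors-swap (bezout⇒cofactors y x 1<q 1<p e)

-- The totient of a number with three prime divisors.

module TotientOfThreePrimes where
  open import Data.Bool.Base using (if_then_else_)
  open import Data.List.Base using (List; []; _∷_; filter; length; map; upTo; applyUpTo)
  open import Data.List.Properties using (map-upTo)
  open import Data.List.Relation.Unary.All as All using (All; []; _∷_)
  open import Data.List.Relation.Unary.All.Properties using (all-filter)
  open import Data.List.Membership.Propositional using (_∈_)
  open import Data.List.Membership.Propositional.Properties using (∈-filter⁺; ∈-upTo⁺)
  open import Data.Nat.Base
  open import Data.Nat.Coprimality using (Coprime; coprime?)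
  open import Data.Nat.Divisibility
  open import Data.Nat.ListAction using (product)
  open import Data.Nat.ListAction.Properties using (∈⇒∣product)
  open import Data.Nat.Primality using (Prime; prime?; euclidsLemma; productOfPrimes≢0;
    prime⇒nonZero; prime⇒irreducible; ¬prime[1])
  open import Data.Nat.Primality.Factorisation using (factorise)
  open import Data.Nat.Properties
  open import Data.Nat.Solver using (module +-*-Solver)
  open import Data.Product.Base using (_×_; _,_; proj₁; ∃-syntax)
  open import Data.Empty using (⊥-elim)
  open import Data.Sum.Base using (_⊎_; inj₁; inj₂)
  open import Relation.Binary.PropositionalEquality
  open import Relation.Nullary.Decidable using (Dec; yes; no; does; _×-dec_)
  open import Relation.Nullary.Negation using (¬_; contradiction)
  open import Relation.Unary using (Decidable)
  open +-*-Solver using (solve; _:=_; _:+_; _:*_; con)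

  Σ[k<_] : ℕ → (ℕ → ℕ) → ℕ
  Σ[k< zero ]  f = 0
  Σ[k< suc n ] f = f 0 + Σ[k< n ] λ k → f (suc k)

  Σ-cong-< : ∀ n {f g} → (∀ k → k < n → f k ≡ g k) → Σ[k< n ] f ≡ Σ[k< n ] g
  Σ-cong-< zero h = refl
  Σ-cong-< (suc n) h = cong₂ _+_ (h 0 (s≤s z≤n)) (Σ-cong-< n λ k k<n → h (suc k) (s≤s k<n))

  Σ-cong : ∀ n {f g} → (∀ k → f k ≡ g k) → Σ[k< n ] f ≡ Σ[k< n ] g
  Σ-cong n h = Σ-cong-< n λ k _ → h k

  Σ-+ : ∀ m n f → Σ[k< m + n ] f ≡ Σ[k< m ] f + Σ[k< n ] λ k → f (m + k)
  Σ-+ zero n f = refl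
  Σ-+ (suc m) n f = trans (cong (f 0 +_) (Σ-+ m n λ k → f (suc k))) (sym (+-assoc (f 0) _ _))

  -- `φ` counts from 1 to n and the sieve from 0 to n - 1; this bridges the two.
  Σ-suc : ∀ n {f} → f n ≡ f 0 → Σ[k< n ] (λ k → f (suc k)) ≡ Σ[k< n ] f
  Σ-suc n {f} e = +-cancelˡ-≡ (f 0) _ _ (begin
    Σ[k< 1 + n ] f                   ≡⟨ cong (λ m → Σ[k< m ] f) (+-comm 1 n) ⟩
    Σ[k< n + 1 ] f                   ≡⟨ Σ-+ n 1 f ⟩
    Σ[k< n ] f + (f (n + 0) + 0)     ≡⟨ cong (Σ[k< n ] f +_)
      (trans (+-identityʳ _) (trans (cong f (+-identityʳ n)) e)) ⟩
    Σ[k< n ] f + f 0                 ≡⟨ +-comm _ (f 0) ⟩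
    f 0 + Σ[k< n ] f                 ∎)
    where open ≡-Reasoning

  Periodic : ℕ → (ℕ → ℕ) → Set
  Periodic T f = ∀ k → f (T + k) ≡ f k

  periodic-* : ∀ d {T f} → Periodic T f → Periodic (d * T) f
  periodic-* zero h k = refl
  periodic-* (suc d) {T} {f} h k = trans (cong f (+-assoc T (d * T) k)) (trans (h _) (periodic-* d h k))

  Σ-periodic : ∀ d T {f} → Periodic T f → Σ[k< d * T ] f ≡ d * Σ[k< T ] f
  Σ-periodic zero T h = refl
  Σ-periodic (suc d) T {f} h = trans (Σ-+ T (d * T) f) (cong (Σ[k< T ] f +_)
    (trans (Σ-cong (d * T) h) (Σ-periodic d T h)))

  coprimeTo : ℕ → ℕ → ℕ
  coprimeTo p k = if does (p ∣? k) then 0 else 1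

  coprimeTo-∣ : ∀ {p k} → p ∣ k → coprimeTo p k ≡ 0
  coprimeTo-∣ {p} {k} p∣k with p ∣? k
  ... | yes _ = refl
  ... | no p∤k = contradiction p∣k p∤k

  coprimeTo-∤ : ∀ {p k} → ¬ (p ∣ k) → coprimeTo p k ≡ 1
  coprimeTo-∤ {p} {k} p∤k with p ∣? k
  ... | yes p∣k = contradiction p∣k p∤k
  ... | no _ = refl

  coprimeTo-⇔ : ∀ {p j k} → (p ∣ j → p ∣ k) → (p ∣ k → p ∣ j) → coprimeTo p j ≡ coprimeTo p k
  coprimeTo-⇔ {p} {j} {k} f g with p ∣? j
  ... | yes p∣j = sym (coprimeTo-∣ (f p∣j))
  ... | no p∤j = sym (coprimeTo-∤ λ p∣k → p∤j (g p∣k))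

  coprimeTo-periodic : ∀ p → Periodic p (coprimeTo p)
  coprimeTo-periodic p k = coprimeTo-⇔ {p} {p + k} {k} (λ h → ∣m+n∣m⇒∣n h ∣-refl) (∣m∣n⇒∣m+n ∣-refl)

  -- The multiples of p contribute Σ_{j<T} f(p j) to the sum over k < T p.
  Σ-sieve : ∀ p .{{_ : NonZero p}} T f →
    Σ[k< T * p ] (λ k → f k * coprimeTo p k) + Σ[k< T ] (λ j → f (j * p)) ≡ Σ[k< T * p ] f
  Σ-sieve p zero f = refl
  Σ-sieve p@(suc p-1) (suc T) f = begin
    Σ[k< p + T * p ] g + (f 0 + Σ[k< T ] (λ j → f (p + j * p)))
      ≡⟨ cong (_+ (f 0 + B)) (Σ-+ p (T * p) g) ⟩
    Σ[k< p ] g + Σ[k< T * p ] (λ k → g (p + k)) + (f 0 + B)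
      ≡⟨ cong₂ (λ x y → x + y + (f 0 + B)) block
           (Σ-cong (T * p) λ k → cong (f (p + k) *_) (coprimeTo-periodic p k)) ⟩
    A + C + (f 0 + B)
      ≡⟨ solve 4 (λ a b c d → a :+ b :+ (c :+ d) := c :+ a :+ (b :+ d)) refl A C (f 0) B ⟩
    Σ[k< p ] f + (C + B)
      ≡⟨ cong (Σ[k< p ] f +_) (Σ-sieve p T (λ k → f (p + k))) ⟩
    Σ[k< p ] f + Σ[k< T * p ] (λ k → f (p + k))
      ≡⟨ Σ-+ p (T * p) f ⟨
    Σ[k< p + T * p ] f ∎
    where
    open ≡-Reasoning
    g : ℕ → ℕ
    g k = f k * coprimeTo p k
    A B C : ℕ
    A = Σ[k< p-1 ] λ k → f (suc k)
    B = Σ[k< T ] λ j → f (p + j * p)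
    C = Σ[k< T * p ] λ k → f (p + k) * coprimeTo p k
    block : Σ[k< p ] g ≡ A
    block = trans (cong (_+ Σ[k< p-1 ] (λ k → g (suc k)))
        (trans (cong (f 0 *_) (coprimeTo-∣ {p} (p ∣0))) (*-zeroʳ (f 0))))
      (Σ-cong-< p-1 λ k k<p-1 →
        trans (cong (f (suc k) *_) (coprimeTo-∤ (>⇒∤ (s≤s k<p-1)))) (*-identityʳ _))

  -- Over p periods the multiples of p account for Σ f(j p) = Σ f, that is for one period. Applied
  -- once per prime this replaces the Chinese remainder theorem.
  Σ-sieve-periodic : ∀ p .{{_ : NonZero p}} T {f} → Periodic T f → (∀ j → f (j * p) ≡ f j) →
    Σ[k< p * T ] (λ k → f k * coprimeTo p k) ≡ pred p * Σ[k< T ] f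
  Σ-sieve-periodic p@(suc p-1) T {f} per scale = +-cancelʳ-≡ (Σ[k< T ] f) _ _ (begin
    Σ[k< p * T ] (λ k → f k * coprimeTo p k) + Σ[k< T ] f
      ≡⟨ cong₂ (λ n S → Σ[k< n ] (λ k → f k * coprimeTo p k) + S) (*-comm p T) (sym (Σ-cong T scale)) ⟩
    Σ[k< T * p ] (λ k → f k * coprimeTo p k) + Σ[k< T ] (λ j → f (j * p))
      ≡⟨ Σ-sieve p T f ⟩
    Σ[k< T * p ] f
      ≡⟨ cong (λ n → Σ[k< n ] f) (*-comm T p) ⟩
    Σ[k< p * T ] f
      ≡⟨ Σ-periodic p T per ⟩
    Σ[k< T ] f + p-1 * Σ[k< T ] f
      ≡⟨ +-comm (Σ[k< T ] f) _ ⟩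
    p-1 * Σ[k< T ] f + Σ[k< T ] f ∎)
    where open ≡-Reasoning

  prime-∣-prime : ∀ {p q} → Prime p → Prime q → p ∣ q → p ≡ q
  prime-∣-prime pp pq p∣q with prime⇒irreducible pq p∣q
  ... | inj₁ refl = contradiction pp ¬prime[1]
  ... | inj₂ p≡q = p≡q

  prime-∣-cancel : ∀ {ℓ k} a → Prime ℓ → Prime k → ℓ ≢ k → ℓ ∣ a * k → ℓ ∣ a
  prime-∣-cancel {k = k} a pℓ pk ℓ≢k ℓ∣ak with euclidsLemma a k pℓ ℓ∣ak
  ... | inj₁ ℓ∣a = ℓ∣a
  ... | inj₂ ℓ∣k = contradiction (prime-∣-prime pℓ pk ℓ∣k) ℓ≢k

  coprimeTo-scale : ∀ {p q} → Prime p → Prime q → p ≢ q → ∀ j → coprimeTo p (j * q) ≡ coprimeTo p j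
  coprimeTo-scale {p} {q} pp pq p≢q j = coprimeTo-⇔ {p} {j * q} {j} (prime-∣-cancel j pp pq p≢q) (∣m⇒∣m*n q)

  prime-divisor : ∀ d .{{_ : NonZero d}} → d ≢ 1 → ∃[ ℓ ] Prime ℓ × ℓ ∣ d
  prime-divisor d d≢1 with factorise d
  ... | record { factors = [] ; isFactorisation = d≡1 } = contradiction d≡1 d≢1
  ... | record { factors = ℓ ∷ ℓs ; isFactorisation = e ; factorsPrime = ℓ-prime ∷ _ } =
    ℓ , ℓ-prime , subst (ℓ ∣_) (sym e) (m∣m*n (product ℓs))

  length-filter-applyUpTo : ∀ {P : ℕ → Set} (P? : Decidable P) f n →
    length (filter P? (applyUpTo f n)) ≡ Σ[k< n ] λ k → if does (P? (f k)) then 1 else 0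
  length-filter-applyUpTo P? f zero = refl
  length-filter-applyUpTo P? f (suc n) with P? (f 0)
  ... | yes _ = cong suc (length-filter-applyUpTo P? (λ k → f (suc k)) n)
  ... | no _ = length-filter-applyUpTo P? (λ k → f (suc k)) n

  module _ {p q r : ℕ} (pp : Prime p) (pq : Prime q) (pr : Prime r)
    (p≢q : p ≢ q) (p≢r : p ≢ r) (q≢r : q ≢ r) where

    private
      instance
        p≢0 : NonZero p
        p≢0 = prime⇒nonZero pp
        q≢0 : NonZero q
        q≢0 = prime⇒nonZero pq
        r≢0 : NonZero r
        r≢0 = prime⇒nonZero pr

    χ : ℕ → ℕ
    χ k = coprimeTo p k * coprimeTo q k * coprimeTo r k

    private
      χ₂ : ℕ → ℕ
      χ₂ k = coprimeTo p k * coprimeTo q k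

      χ₂-periodic : Periodic (q * p) χ₂
      χ₂-periodic k = cong₂ _*_ (periodic-* q (coprimeTo-periodic p) k)
        (trans (cong (λ t → coprimeTo q (t + k)) (*-comm q p)) (periodic-* p (coprimeTo-periodic q) k))

    χ-periodic : Periodic (r * (q * p)) χ
    χ-periodic k = cong₂ _*_ (periodic-* r χ₂-periodic k)
      (trans (cong (λ t → coprimeTo r (t + k)) (*-comm r (q * p)))
        (periodic-* (q * p) (coprimeTo-periodic r) k))

    Σ-χ : Σ[k< r * (q * p) ] χ ≡ pred r * (pred q * pred p)
    Σ-χ = trans (Σ-sieve-periodic r (q * p) χ₂-periodic
        λ j → cong₂ _*_ (coprimeTo-scale pp pr p≢r j) (coprimeTo-scale pq pr q≢r j))
      (cong (pred r *_) (trans (Σ-sieve-periodic q p (coprimeTo-periodic p) (coprimeTo-scale pp pq p≢q))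
        -- The last sieve, by p, acts on the constant 1, of period 1.
        (cong (pred q *_) (trans (cong (λ n → Σ[k< n ] (coprimeTo p)) (sym (*-identityʳ p)))
          (trans (Σ-cong (p * 1) λ k → sym (+-identityʳ (coprimeTo p k)))
            (trans (Σ-sieve-periodic p 1 {λ _ → 1} (λ _ → refl) (λ _ → refl)) (*-identityʳ (pred p))))))))

    record PrimeDivisors (n : ℕ) : Set where
      field
        p∣n : p ∣ n
        q∣n : q ∣ n
        r∣n : r ∣ n
        only : ∀ {ℓ} → Prime ℓ → ℓ ∣ n → ℓ ≡ p ⊎ ℓ ≡ q ⊎ ℓ ≡ r

    module _ {n} .{{_ : NonZero n}} (n-divisors : PrimeDivisors n) where
      open PrimeDivisors n-divisors

      coprime⇒∤ : ∀ {ℓ k} → Prime ℓ → ℓ ∣ n → Coprime k n → ¬ (ℓ ∣ k)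
      coprime⇒∤ pℓ ℓ∣n k⊥n ℓ∣k = contradiction (subst Prime (k⊥n (ℓ∣k , ℓ∣n)) pℓ) ¬prime[1]

      ∤⇒coprime : ∀ {k} → ¬ (p ∣ k) → ¬ (q ∣ k) → ¬ (r ∣ k) → Coprime k n
      ∤⇒coprime p∤k q∤k r∤k {d} (d∣k , d∣n) with d ≟ 1
      ... | yes d≡1 = d≡1
      ... | no d≢1 with prime-divisor d {{d≢0 d d∣n}} d≢1
        where
        d≢0 : ∀ d → d ∣ n → NonZero d
        d≢0 zero 0∣n = contradiction (0∣⇒≡0 0∣n) (≢-nonZero⁻¹ n)
        d≢0 (suc _) _ = _
      ... | ℓ , pℓ , ℓ∣d with only pℓ (∣-trans ℓ∣d d∣n)
      ... | inj₁ refl = contradiction (∣-trans ℓ∣d d∣k) p∤k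
      ... | inj₂ (inj₁ refl) = contradiction (∣-trans ℓ∣d d∣k) q∤k
      ... | inj₂ (inj₂ refl) = contradiction (∣-trans ℓ∣d d∣k) r∤k

      not-coprime⇒∣ : ∀ {k} → ¬ Coprime k n → p ∣ k ⊎ q ∣ k ⊎ r ∣ k
      not-coprime⇒∣ {k} k⊥̸n with p ∣? k | q ∣? k | r ∣? k
      ... | yes p∣k | _ | _ = inj₁ p∣k
      ... | no _ | yes q∣k | _ = inj₂ (inj₁ q∣k)
      ... | no _ | no _ | yes r∣k = inj₂ (inj₂ r∣k)
      ... | no p∤k | no q∤k | no r∤k = ⊥-elim (k⊥̸n (∤⇒coprime p∤k q∤k r∤k))

      coprime-indicator : ∀ {k} (dec : Dec (Coprime k n)) → (if does dec then 1 else 0) ≡ χ k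
      coprime-indicator (yes k⊥n) = sym (cong₂ _*_ (cong₂ _*_ (coprimeTo-∤ (coprime⇒∤ pp p∣n k⊥n))
        (coprimeTo-∤ (coprime⇒∤ pq q∣n k⊥n))) (coprimeTo-∤ (coprime⇒∤ pr r∣n k⊥n)))
      coprime-indicator {k} (no k⊥̸n) with not-coprime⇒∣ k⊥̸n
      ... | inj₁ p∣k = sym (cong (λ c → c * coprimeTo q k * coprimeTo r k) (coprimeTo-∣ p∣k))
      ... | inj₂ (inj₁ q∣k) = sym (cong (_* coprimeTo r k)
        (trans (cong (coprimeTo p k *_) (coprimeTo-∣ q∣k)) (*-zeroʳ (coprimeTo p k))))
      ... | inj₂ (inj₂ r∣k) = sym (trans (cong (coprimeTo p k * coprimeTo q k *_) (coprimeTo-∣ r∣k))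
        (*-zeroʳ (coprimeTo p k * coprimeTo q k)))

      -- Coprimality to n depends only on divisibility by p, q and r, so φ n sums χ over d full
      -- periods.
      totient : ∀ {d} → n ≡ d * (p * q * r) → φ n ≡ d * (pred p * pred q * pred r)
      totient {d} n≡ = begin
        φ n
          ≡⟨ cong (λ xs → length (filter (λ k → coprime? k n) xs)) (map-upTo suc n) ⟩
        length (filter (λ k → coprime? k n) (applyUpTo suc n))
          ≡⟨ length-filter-applyUpTo (λ k → coprime? k n) suc n ⟩
        Σ[k< n ] (λ k → if does (coprime? (suc k) n) then 1 else 0)
          ≡⟨ Σ-cong n (λ k → coprime-indicator (coprime? (suc k) n)) ⟩
        Σ[k< n ] (λ k → χ (suc k))
          ≡⟨ Σ-suc n {χ} (trans (cong χ (trans n≡′ (sym (+-identityʳ _)))) (periodic-* d χ-periodic 0)) ⟩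
        Σ[k< n ] χ
          ≡⟨ cong (λ n → Σ[k< n ] χ) n≡′ ⟩
        Σ[k< d * (r * (q * p)) ] χ
          ≡⟨ Σ-periodic d (r * (q * p)) χ-periodic ⟩
        d * Σ[k< r * (q * p) ] χ
          ≡⟨ cong (d *_) (trans Σ-χ (reverse (pred p) (pred q) (pred r))) ⟩
        d * (pred p * pred q * pred r) ∎
        where
        open ≡-Reasoning
        reverse : ∀ a b c → c * (b * a) ≡ a * b * c
        reverse = solve 3 (λ a b c → c :* (b :* a) := a :* b :* c) refl
        n≡′ : n ≡ d * (r * (q * p))
        n≡′ = trans n≡ (cong (d *_) (sym (reverse p q r)))

      -- This is all that is needed of rad n: it is never identified with pqr.
      rad-divisors : PrimeDivisors (rad n)
      rad-divisors = record
        { p∣n = ∣rad pp p∣n ; q∣n = ∣rad pq q∣n ; r∣n = ∣rad pr r∣n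
        ; only = λ pℓ ℓ∣rad → only pℓ (∣product⇒∣ pℓ rad-primes ℓ∣rad) }
        where
        ∣rad : ∀ {ℓ} → Prime ℓ → ℓ ∣ n → ℓ ∣ rad n
        ∣rad pℓ ℓ∣n = ∈⇒∣product (∈-filter⁺ (λ p → prime? p ×-dec p ∣? n) (∈-upTo⁺ (s≤s (∣⇒≤ ℓ∣n))) (pℓ , ℓ∣n))
        rad-primes : All (λ ℓ → Prime ℓ × ℓ ∣ n) (filter (λ p → prime? p ×-dec p ∣? n) (upTo (suc n)))
        rad-primes = all-filter (λ p → prime? p ×-dec p ∣? n) (upTo (suc n))
        ∣product⇒∣ : ∀ {ℓ ks} → Prime ℓ → All (λ k → Prime k × k ∣ n) ks → ℓ ∣ product ks → ℓ ∣ n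
        ∣product⇒∣ pℓ [] ℓ∣1 = contradiction (subst Prime (∣1⇒≡1 ℓ∣1) pℓ) ¬prime[1]
        ∣product⇒∣ {ks = k ∷ ks} pℓ ((_ , k∣n) ∷ ks∣n) ℓ∣ with euclidsLemma k (product ks) pℓ ℓ∣
        ... | inj₁ ℓ∣k = ∣-trans ℓ∣k k∣n
        ... | inj₂ ℓ∣ks = ∣product⇒∣ pℓ ks∣n ℓ∣ks

      rad-nonZero : NonZero (rad n)
      rad-nonZero = productOfPrimes≢0 (All.map proj₁ (all-filter (λ p → prime? p ×-dec p ∣? n) (upTo (suc n))))

    -- Euclid's lemma strips one prime at a time from the cofactor.
    divisors⇒multiple : ∀ {n} → PrimeDivisors n → ∃[ d ] n ≡ d * (p * q * r)
    divisors⇒multiple D with PrimeDivisors.p∣n D | PrimeDivisors.q∣n D | PrimeDivisors.r∣n D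
    ... | divides a refl | q∣ap | r∣ap with prime-∣-cancel a pq pp (≢-sym p≢q) q∣ap
    ... | divides b refl with prime-∣-cancel b pr pq (≢-sym q≢r) (prime-∣-cancel (b * q) pr pp (≢-sym p≢r) r∣ap)
    ... | divides c refl = c , solve 4 (λ c p q r → c :* r :* q :* p := c :* (p :* q :* r)) refl c p q r

    -- `rad n` has the same prime divisors as n, so it is a multiple of p q r to which `totient`
    -- applies. A lower bound suffices because φ(rad n) stands on the larger side of the theorem.
    totient-rad-≥ : ∀ {n} .{{_ : NonZero n}} → PrimeDivisors n → pred p * pred q * pred r ≤ φ (rad n)
    totient-rad-≥ {n} D = go (divisors⇒multiple R)
      where
      instance
        rad≢0 : NonZero (rad n)
        rad≢0 = rad-nonZero D
      R : PrimeDivisors (rad n)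
      R = rad-divisors D
      go : (∃[ d ] rad n ≡ d * (p * q * r)) → pred p * pred q * pred r ≤ φ (rad n)
      go (zero , e) = contradiction e (≢-nonZero⁻¹ (rad n))
      go (suc d , e) = ≤-trans (m≤m+n _ _) (≤-reflexive (sym (totient R {suc d} e)))

    power-divisors : ∀ l s t → PrimeDivisors (p ^ suc l * q ^ suc s * r ^ suc t)
    power-divisors l s t = record
      { p∣n = ∣m⇒∣m*n _ (∣m⇒∣m*n _ (m∣m*n (p ^ l)))
      ; q∣n = ∣m⇒∣m*n _ (∣n⇒∣m*n (p ^ suc l) (m∣m*n (q ^ s)))
      ; r∣n = ∣n⇒∣m*n (p ^ suc l * q ^ suc s) (m∣m*n (r ^ t))
      ; only = only′ }
      where
      ∣power⇒≡ : ∀ {ℓ k} e → Prime ℓ → Prime k → ℓ ∣ k ^ e → ℓ ≡ k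
      ∣power⇒≡ zero pℓ pk ℓ∣1 = contradiction (subst Prime (∣1⇒≡1 ℓ∣1) pℓ) ¬prime[1]
      ∣power⇒≡ {k = k} (suc e) pℓ pk ℓ∣ with euclidsLemma k (k ^ e) pℓ ℓ∣
      ... | inj₁ ℓ∣k = prime-∣-prime pℓ pk ℓ∣k
      ... | inj₂ ℓ∣kᵉ = ∣power⇒≡ e pℓ pk ℓ∣kᵉ
      only′ : ∀ {ℓ} → Prime ℓ → ℓ ∣ p ^ suc l * q ^ suc s * r ^ suc t → ℓ ≡ p ⊎ ℓ ≡ q ⊎ ℓ ≡ r
      only′ pℓ ℓ∣ with euclidsLemma (p ^ suc l * q ^ suc s) (r ^ suc t) pℓ ℓ∣
      ... | inj₂ ℓ∣r = inj₂ (inj₂ (∣power⇒≡ (suc t) pℓ pr ℓ∣r))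
      ... | inj₁ ℓ∣pq with euclidsLemma (p ^ suc l) (q ^ suc s) pℓ ℓ∣pq
      ... | inj₁ ℓ∣p = inj₁ (∣power⇒≡ (suc l) pℓ pp ℓ∣p)
      ... | inj₂ ℓ∣q = inj₂ (inj₁ (∣power⇒≡ (suc s) pℓ pq ℓ∣q))

-- Comparison of the weights.

module WeightInequality where
  open import Data.Nat.Base
  open import Data.Nat.Properties
  open import Data.Nat.Solver using (module +-*-Solver)
  open import Relation.Binary.PropositionalEquality
  open +-*-Solver using (solve; _:=_; _:+_; _:*_; con)
  open ≤-Reasoning

  -- As p − 1 ≥ 2, q − 1 ≥ p and r − 1 ≥ q, the right-hand factor is at least (2 p q)².
  weights-≤ : ∀ {p q r d} → 3 ≤ p → p < q → q < r → 0 < d →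
    p * q * (p * 2) * (p * q * (p * 2) * r) ≤
    (pred p * pred q * pred r) * (pred p * pred q * pred r) * (d * (p * q * r))
  weights-≤ {p} {q} {r} {d} 3≤p p<q q<r 0<d = begin
    p * q * (p * 2) * (p * q * (p * 2) * r)
      ≡⟨ solve 3 (λ p q r → p :* q :* (p :* con 2) :* (p :* q :* (p :* con 2) :* r) :=
           con 4 :* (p :* p :* (p :* q)) :* (p :* q :* r)) refl p q r ⟩
    4 * (p * p * (p * q)) * (p * q * r)
      -- Replacing one p by q turns 4 p³ q into the square of 2 p q.
      ≤⟨ *-monoˡ-≤ (p * q * r) (*-monoʳ-≤ 4 (*-monoʳ-≤ (p * p) (*-monoˡ-≤ q (<⇒≤ p<q)))) ⟩
    4 * (p * p * (q * q)) * (p * q * r)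
      ≡⟨ cong (_* (p * q * r)) (solve 2 (λ p q → con 4 :* (p :* p :* (q :* q)) :=
           (con 2 :* p :* q) :* (con 2 :* p :* q)) refl p q) ⟩
    2 * p * q * (2 * p * q) * (p * q * r)
      ≤⟨ *-mono-≤ (*-mono-≤ 2pq≤ 2pq≤)
         (≤-trans (≤-reflexive (sym (*-identityˡ _))) (*-monoˡ-≤ (p * q * r) 0<d)) ⟩
    (pred p * pred q * pred r) * (pred p * pred q * pred r) * (d * (p * q * r)) ∎
    where
    2pq≤ : 2 * p * q ≤ pred p * pred q * pred r
    2pq≤ = *-mono-≤ (*-mono-≤ (pred-mono-≤ 3≤p) (pred-mono-≤ p<q)) (pred-mono-≤ q<r)

-- Ψ at the non-primitive roots.

module NonprimitiveRoots (R : CommutativeRing 0ℓ 0ℓ) where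
  open CommutativeRing R using (Carrier; _≈_; _-_; 0#; 1#; trans; sym)
  open Polynomials
  open Functionals R
  open Windows R
  open RootsOfUnity R
  open CyclotomicInverse R using (VanishesAtNonprimitive)
  open import Algebra.Properties.Semiring.Exp (CommutativeRing.semiring R) using (_^_; ^-assocʳ)
  open import Data.Nat.Base using (_*_; NonZero)
  open import Data.Nat.Divisibility using (_∣_; divides)
  open import Data.Nat.Properties using (*-assoc)
  open import Data.Nat.Solver using (module +-*-Solver)
  open import Data.Sum.Base using (_⊎_; inj₁; inj₂)
  open import Relation.Binary.PropositionalEquality as ≡ using (_≡_; refl; cong; subst)
  open +-*-Solver using (solve; _:=_; _:*_)

  open import Data.Nat.Coprimality using (Coprime)
  open import Relation.Nullary.Negation using (¬_)

  -- If p divides e, then n = d p q r divides e d r q, so η = ω^(e d) satisfies η^(rq) = 1; likewise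
  -- η^(rp) = 1 or η^(pq) = 1 if q or r divides e.
  Ψ-root : ∀ {p q r n d} .{{_ : NonZero n}} (W : Cofactors p q) → n ≡ d * (p * q * r) →
    (∀ z → z ^ n ≈ 1# → z ≈ 1# ⊎ Cancellable (1# - z)) →
    ∀ {ω} → IsPrimitive n ω → ∀ e → p ∣ e ⊎ q ∣ e ⊎ r ∣ e →
    ⟦ Ψ W r ⟧ (λ a → (ω ^ e) ^ (d * a)) ≈ 0#
  Ψ-root {p} {q} {r} {n} {d} W n≡ dec {ω} ω-primitive e h =
    trans (⟦⟧-cong (Ψ W r) λ a → sym (^-assocʳ (ω ^ e) d a)) (go h)
    where
    η : Carrier
    η = (ω ^ e) ^ d
    η-power : ∀ {k} → n ∣ e * d * k → η ^ k ≈ 1#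
    η-power {k} n∣ = trans (^-assocʳ (ω ^ e) d k) (trans (^-assocʳ ω e (d * k))
      (∣⇒power-one dec ω-primitive (subst (n ∣_) (*-assoc e d k) n∣)))
    η-dec : ∀ k → η ^ k ≈ 1# ⊎ Cancellable (⟦ Δ k ⟧ (η ^_))
    η-dec k = dec (η ^ k) (trans (^-assocʳ η k n) (η-power (divides (e * d * k) (≡.sym (*-assoc (e * d) k n)))))
    go : p ∣ e ⊎ q ∣ e ⊎ r ∣ e → ⟦ Ψ W r ⟧ (η ^_) ≈ 0#
    go (inj₁ (divides c refl)) = eval-Ψ-qr W r η η-dec (η-power (divides c (≡.trans
      (solve 5 (λ c d p q r → c :* p :* d :* (r :* q) := c :* (d :* (p :* q :* r))) refl c d p q r)
      (cong (c *_) (≡.sym n≡)))))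
    go (inj₂ (inj₁ (divides c refl))) = eval-Ψ-pr W r η η-dec (η-power (divides c (≡.trans
      (solve 5 (λ c d p q r → c :* q :* d :* (r :* p) := c :* (d :* (p :* q :* r))) refl c d p q r)
      (cong (c *_) (≡.sym n≡)))))
    go (inj₂ (inj₂ (divides c refl))) = eval-Ψ-pq W r η η-dec (η-power (divides c (≡.trans
      (solve 5 (λ c d p q r → c :* r :* d :* (p :* q) := c :* (d :* (p :* q :* r))) refl c d p q r)
      (cong (c *_) (≡.sym n≡)))))

  Ψ-vanishes : ∀ {p q r n d} .{{_ : NonZero n}} (W : Cofactors p q) → n ≡ d * (p * q * r) →
    (∀ z → z ^ n ≈ 1# → z ≈ 1# ⊎ Cancellable (1# - z)) →
    (∀ {e} → ¬ Coprime e n → p ∣ e ⊎ q ∣ e ⊎ r ∣ e) →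
    VanishesAtNonprimitive (Ψ W r) n d
  Ψ-vanishes {d = d} W n≡ dec common = record
    { vanishes = λ ω-primitive e e⊥̸n → Ψ-root {d = d} W n≡ dec ω-primitive e (common e⊥̸n) }

-- The bound for the condition number.

module ConditionNumber where
  open Polynomials
  open Complex using (ℂ-commutativeRing; pointwiseᶜ)
  open Functionals ℂ-commutativeRing
  open Windows ℂ-commutativeRing
  open RootsOfUnity ℂ-commutativeRing
  open CyclotomicInverse ℂ-commutativeRing
  open ComplexAnalysis
  open Rationals
  open Bounds
  open import Algebra.Properties.Semiring.Mult (CommutativeRing.semiring ℂ-commutativeRing)
    using () renaming (_×_ to _·_)
  open import Data.Fin.Base using (Fin; toℕ; fromℕ<)
  open import Data.Nat.Base using (ℕ; pred; _+_; _*_; _∸_; _^_; _≤_; _<_; NonZero; >-nonZero⁻¹)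
  open import Data.Nat.DivMod using (_/_)
  open import Data.Nat.Properties using (≤-trans; ≤-reflexive; *-comm; *-monoˡ-≤; *-monoʳ-≤; *-mono-≤; suc-pred)
  open import Data.Nat.Solver using (module +-*-Solver)
  open import Data.Product.Base using (_,_; proj₁)
  import Data.Rational.Base as ℚ
  import Data.Rational.Properties as ℚ
  open import Data.Sum.Base using (_⊎_)
  open import Relation.Binary.PropositionalEquality using (_≡_; refl; sym; trans; cong; cong₂; subst)
  open +-*-Solver using (solve; _:=_; _:+_; _:*_; con)

  module Reciprocal (n : ℕ) .{{_ : NonZero n}} where
    private
      instance
        n-positive : ℚ.Positive (toℚ n)
        n-positive = ℚ.positive (toℚ-pos n)
        n-nonZero : ℚ.NonZero (toℚ n)
        n-nonZero = ℚ.pos⇒nonZero (toℚ n)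

    abstract
      1/n : ℚ.ℚ
      1/n = ℚ.1/ toℚ n

      0≤1/n : ℚ.0ℚ ℚ.≤ 1/n
      0≤1/n = ℚ.<⇒≤ (ℚ.positive⁻¹ 1/n {{ℚ.1/pos⇒pos (toℚ n)}})

      1/n-inverse : 1/n ℚ.* toℚ n ≡ ℚ.1ℚ
      1/n-inverse = ℚ.*-inverseˡ (toℚ n)

    n⁻¹ : ℂ
    n⁻¹ = fromℚ 1/n +i 0ᴿ

    n⁻¹-inverse : n⁻¹ *ᶜ (n · 1ᶜ) ≈ᶜ 1ᶜ
    n⁻¹-inverse = pointwiseᶜ {n⁻¹ *ᶜ (n · 1ᶜ)} {1ᶜ}
      (λ k → trans (cong₂ (λ a b → 1/n ℚ.* a ℚ.+ ℚ.- (ℚ.0ℚ ℚ.* b)) (sre-· n k) (sim-· n k))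
        (trans (cong (ℚ._+ ℚ.0ℚ) 1/n-inverse) (ℚ.+-identityʳ ℚ.1ℚ)))
      (λ k → trans (cong₂ (λ a b → 1/n ℚ.* b ℚ.+ ℚ.0ℚ ℚ.* a) (sre-· n k) (sim-· n k))
        (trans (cong₂ ℚ._+_ (ℚ.*-zeroʳ 1/n) (ℚ.*-zeroˡ (toℚ n))) (ℚ.+-identityʳ ℚ.0ℚ)))

    1/n*-≤ : ∀ k b → k ≤ b * n → 1/n ℚ.* toℚ k ℚ.≤ toℚ b
    1/n*-≤ k b k≤bn = ℚ.≤-trans (ℚ.*-monoˡ-≤-nonNeg 1/n {{ℚ.nonNegative 0≤1/n}} (toℚ-mono k≤bn))
      (ℚ.≤-reflexive (trans (cong (1/n ℚ.*_) (trans (cong toℚ (*-comm b n)) (toℚ-* n b)))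
        (trans (sym (ℚ.*-assoc 1/n (toℚ n) (toℚ b))) (trans (cong (ℚ._* toℚ b) 1/n-inverse)
          (ℚ.*-identityˡ (toℚ b))))))

  module _ (P Q : Poly) {n d N M ρ : ℕ} .{{_ : NonZero d}} .{{_ : NonZero n}}
    (n≡ : n ≡ d * N) (φ≡ : φ n ≡ d * M) (0<φ : 0 < φ n)
    (PQ≋ : P ⊡ Q ≋ Δ N ⊡ Δ N) (degree≤ : degree P + M ≤ N)
    (weight≤ : weight P * weight Q ≤ M * M * n) (M≤ρ : M ≤ ρ)
    (P-vanishes : VanishesAtNonprimitive P n d)
    (ζ : Fin (φ n) → ℂ) (ζ-roots : ArePrimitiveRoots n ζ) where

    open ArePrimitiveRoots ζ-roots
    open Reciprocal n

    private
      dec : ∀ z → z ^ᶜ n ≈ᶜ 1ᶜ → z ≈ᶜ 1ᶜ ⊎ Cancellable (1ᶜ +ᶜ -ᶜ z)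
      dec = root-of-unity-dichotomy n (>-nonZero⁻¹ n)

      -- A primitive root comes from the list ζ itself, which is nonempty; none has to be
      -- constructed in ℂ.
      ω : ℂ
      ω = ζ (fromℕ< 0<φ)

      ω-primitive : IsPrimitive n ω
      ω-primitive = isPrimitive (fromℕ< 0<φ)

      X : Matrix (φ n) (φ n)
      X j i = entry P Q n d n⁻¹ (toℕ j) (ζ i)

    vandermonde-invertible : Invertible (vandermonde ζ)
    vandermonde-invertible = record
      { inverse = X
      ; inverseˡ = entry-inverse P Q n d n⁻¹ n≡ φ≡ PQ≋ degree≤ n⁻¹-inverse dec
          ζ isPrimitive distinct complete ω-primitive P-vanishes
      ; inverseʳ = entry-inverseʳ P Q n d n⁻¹ n≡ φ≡ PQ≋ degree≤ n⁻¹-inverse dec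
          ζ isPrimitive distinct complete ω-primitive P-vanishes }

    private
      unit-norm : ∀ i e → Bounded ℚ.1ℚ (norm² (ζ i ^ᶜ e))
      unit-norm i e = root-norm²-bounded (pred n) (subst (λ k → (ζ i ^ᶜ e) ^ᶜ k ≈ᶜ 1ᶜ) (sym (suc-pred n))
        (power-root {n} {ζ i} e (proj₁ (isPrimitive i))))

      power-bounded : ∀ i e → Boundedᶜ ℚ.1ℚ (ζ i ^ᶜ e)
      power-bounded i e = let h , h′ = norm²-bounded⇒component-bounded {ζ i ^ᶜ e} (unit-norm i e) in h ,ᶜ h′

      V-bounded : Bounded (toℚ (φ n) ℚ.* ℚ.1ℚ) ‖ vandermonde ζ ‖
      V-bounded = bounded-frobenius (vandermonde ζ) (ℚ.<⇒≤ 0<1) λ i j → unit-norm i (toℕ j)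

      -- Bounds the components of the entries of the inverse, as weight P · weight Q / n ≤ M².
      B : ℚ.ℚ
      B = toℚ (M * M)

      0≤B : ℚ.0ℚ ℚ.≤ B
      0≤B = toℚ-nonneg (M * M)

      entry-bounded : ∀ j i → Boundedᶜ (1/n ℚ.* toℚ (weight P * weight Q)) (X j i)
      entry-bounded j i = boundedᶜ-scale (toℚ-nonneg (weight P * weight Q)) 0≤1/n
        (window-boundedᶜ P Q (toℕ j / d) λ b → power-bounded i (n ∸ toℕ j + d * b))

      entry-norm : ∀ {z} → Boundedᶜ (1/n ℚ.* toℚ (weight P * weight Q)) z →
        Bounded ((B ℚ.+ B) ℚ.* (B ℚ.+ B)) (norm² z)
      entry-norm {z} (h ,ᶜ h′) = bounded-norm² {z = z} 0≤B
        (bounded-mono (1/n*-≤ (weight P * weight Q) (M * M) weight≤) h)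
        (bounded-mono (1/n*-≤ (weight P * weight Q) (M * M) weight≤) h′)

      X-bounded : Bounded (toℚ (φ n) ℚ.* (B ℚ.+ B)) ‖ X ‖
      X-bounded = bounded-frobenius X (+-nonneg 0≤B 0≤B) λ j i → entry-norm (entry-bounded j i)

      -- On the left is the product of the bounds m for ‖V‖ and 2 M² m for the norm of its inverse.
      bound-≤ : φ n * 1 * (φ n * (M * M + M * M)) ≤ 2 * ρ ^ 2 * φ n ^ 2
      bound-≤ = ≤-trans (≤-reflexive (solve 2 (λ m M → m :* con 1 :* (m :* (M :* M :+ M :* M)) :=
          con 2 :* (M :* (M :* con 1)) :* (m :* (m :* con 1))) refl (φ n) M))
        (*-monoˡ-≤ (φ n ^ 2) (*-monoʳ-≤ 2 (*-mono-≤ M≤ρ (*-monoˡ-≤ 1 M≤ρ))))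

      as-ℕ : toℚ (φ n) ℚ.* ℚ.1ℚ ℚ.* (toℚ (φ n) ℚ.* (B ℚ.+ B)) ≡ toℚ (φ n * 1 * (φ n * (M * M + M * M)))
      as-ℕ = sym (trans (toℚ-* (φ n * 1) (φ n * (M * M + M * M))) (cong₂ ℚ._*_ (toℚ-* (φ n) 1)
        (trans (toℚ-* (φ n) (M * M + M * M)) (cong (toℚ (φ n) ℚ.*_) (toℚ-+ (M * M) (M * M))))))

    condition-≤ : Cond (vandermonde ζ) vandermonde-invertible ≤ᴿ fromℕ (2 * ρ ^ 2 * φ n ^ 2)
    condition-≤ = bounded⇒≤ (bounded-mono
      (ℚ.≤-trans (ℚ.≤-reflexive as-ℕ) (toℚ-mono bound-≤))
      (bounded-* (*-nonneg (toℚ-nonneg (φ n)) (ℚ.<⇒≤ 0<1))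
        (*-nonneg (toℚ-nonneg (φ n)) (+-nonneg 0≤B 0≤B)) V-bounded X-bounded))

-- Application to n = p^l q^s r^t.

module ThreePrimes where
  open Polynomials using (Ψ; Υ; Cofactors; degree; weight; degree-Ψ+φ; weight-Ψ; weight-Υ)
  open CofactorExistence
  open TotientOfThreePrimes
  open WeightInequality
  open Complex using (ℂ-commutativeRing)
  open Functionals ℂ-commutativeRing using (Ψ-Υ)
  open NonprimitiveRoots ℂ-commutativeRing
  open CyclotomicInverse ℂ-commutativeRing using (VanishesAtNonprimitive)
  open ConditionNumber
  open ComplexAnalysis using (root-of-unity-dichotomy)

  open import Data.Fin.Base using (Fin)
  open import Data.Nat.Base
  open import Data.Nat.Coprimality as Coprime using (prime⇒coprime)
  open import Data.Nat.Divisibility using (∣-refl)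
  open import Data.Nat.Primality using (Prime; prime⇒nonZero; prime⇒nonTrivial)
  open import Data.Nat.Properties
  open import Data.Nat.Solver using (module +-*-Solver)
  open import Data.Product.Base using (Σ-syntax; _,_)
  open import Relation.Binary.PropositionalEquality using (_≡_; refl; sym; subst)
  open +-*-Solver using (solve; _:=_; _:*_)

  odd-prime⇒3≤ : ∀ {p} → OddPrime p → 3 ≤ p
  odd-prime⇒3≤ {p} (pp , 2∤p) = ≤∧≢⇒< (nonTrivial⇒n>1 p {{prime⇒nonTrivial pp}}) λ { refl → 2∤p ∣-refl }

  power-product : ∀ p q r l s t →
    p ^ suc l * q ^ suc s * r ^ suc t ≡ p ^ l * q ^ s * r ^ t * (p * q * r)
  power-product p q r l s t = solve 6 (λ p q r x y z →
    (p :* x) :* (q :* y) :* (r :* z) := x :* y :* z :* (p :* q :* r)) refl p q r (p ^ l) (q ^ s) (r ^ t)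

  powers≢0 : ∀ {p q r} → Prime p → Prime q → Prime r → ∀ l s t → NonZero (p ^ l * q ^ s * r ^ t)
  powers≢0 {p} {q} {r} pp pq pr l s t = m*n≢0 (p ^ l * q ^ s) (r ^ t)
    {{m*n≢0 (p ^ l) (q ^ s) {{m^n≢0 p l {{prime⇒nonZero pp}}}} {{m^n≢0 q s {{prime⇒nonZero pq}}}}}}
    {{m^n≢0 r t {{prime⇒nonZero pr}}}}

  module _ {p q r n : ℕ} (d : ℕ) .{{_ : NonZero d}} .{{_ : NonZero n}}
    (pp : Prime p) (pq : Prime q) (pr : Prime r)
    (3≤p : 3 ≤ p) (p<q : p < q) (q<r : q < r) (n≡ : n ≡ d * (p * q * r))
    (D : PrimeDivisors pp pq pr (<⇒≢ p<q) (<⇒≢ (<-trans p<q q<r)) (<⇒≢ q<r) n) where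

    private
      instance
        p≢0 : NonZero p
        p≢0 = prime⇒nonZero pp
        q≢0 : NonZero q
        q≢0 = prime⇒nonZero pq
        r≢0 : NonZero r
        r≢0 = prime⇒nonZero pr

      M : ℕ
      M = pred p * pred q * pred r

      1<p : 1 < p
      1<p = nonTrivial⇒n>1 p {{prime⇒nonTrivial pp}}
      1<q : 1 < q
      1<q = nonTrivial⇒n>1 q {{prime⇒nonTrivial pq}}
      1<r : 1 < r
      1<r = nonTrivial⇒n>1 r {{prime⇒nonTrivial pr}}

      φ≡ : φ n ≡ d * M
      φ≡ = totient pp pq pr _ _ _ D {d} n≡

      0<φ : 0 < φ n
      0<φ = subst (0 <_) (sym φ≡) (*-mono-≤ (>-nonZero⁻¹ d)
        (*-mono-≤ (*-mono-≤ (pred-mono-≤ 1<p) (pred-mono-≤ 1<q)) (pred-mono-≤ 1<r)))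

      M≤φrad : M ≤ φ (rad n)
      M≤φrad = totient-rad-≥ pp pq pr _ _ _ D

      module _ (W : Cofactors p q) where
        degree≤ : degree (Ψ W r) + M ≤ p * q * r
        degree≤ = subst (λ x → degree (Ψ W x) + M ≤ p * q * x) (suc-pred r)
          (degree-Ψ+φ W {pred p} {pred q} {pred r} (sym (suc-pred p)) (sym (suc-pred q)))

        weight≤ : weight (Ψ W r) * weight (Υ W r) ≤ M * M * n
        weight≤ = ≤-trans (*-mono-≤ (weight-Ψ W r) (weight-Υ W r)) (subst
          (λ k → p * q * (p * 2) * (p * q * (p * 2) * r) ≤ M * M * k) (sym n≡)
          (weights-≤ 3≤p p<q q<r (>-nonZero⁻¹ d)))

        Ψ-vanishesᶜ : VanishesAtNonprimitive (Ψ W r) n d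
        Ψ-vanishesᶜ = Ψ-vanishes W n≡ (root-of-unity-dichotomy n (>-nonZero⁻¹ n))
          (not-coprime⇒∣ pp pq pr _ _ _ D)

    condition-bound : (ζ : Fin (φ n) → ℂ) → ArePrimitiveRoots n ζ →
      Σ[ V-inv ∈ Invertible (vandermonde ζ) ]
        Cond (vandermonde ζ) V-inv ≤ᴿ fromℕ (2 * φ (rad n) ^ 2 * φ n ^ 2)
    condition-bound = bound (coprime⇒cofactors 1<p 1<q (Coprime.sym (prime⇒coprime pq p<q)))
      where
      bound : Cofactors p q → (ζ : Fin (φ n) → ℂ) → ArePrimitiveRoots n ζ → _
      bound W ζ ζ-roots =
          vandermonde-invertible (Ψ W r) (Υ W r) n≡ φ≡ 0<φ (Ψ-Υ W r) (degree≤ W) (weight≤ W) M≤φrad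
            (Ψ-vanishesᶜ W) ζ ζ-roots
        , condition-≤ (Ψ W r) (Υ W r) n≡ φ≡ 0<φ (Ψ-Υ W r) (degree≤ W) (weight≤ W) M≤φrad
            (Ψ-vanishesᶜ W) ζ ζ-roots

open import Data.Fin.Base using (Fin)
open import Data.Nat.Base using (ℕ; suc; _*_; _^_; _≤_; _<_)
open import Data.Product.Base using (Σ-syntax; _,_)

theorem4p6 :
    ∀ {p q r l s t : ℕ} →
    OddPrime p → OddPrime q → OddPrime r → p < q → q < r →
    1 ≤ l → 1 ≤ s → 1 ≤ t →
    let n = p ^ l * q ^ s * r ^ t
        m = φ n
    in
    (ζ : Fin m → ℂ) → ArePrimitiveRoots n ζ →
    Σ[ V-inv ∈ Invertible (vandermonde ζ) ]
      Cond (vandermonde ζ) V-inv ≤ᴿ fromℕ (2 * φ (rad n) ^ 2 * m ^ 2)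
-- One factor of each prime is split off, so d is the product of the powers with exponents lowered
-- by 1 and n = d p q r.
theorem4p6 {p} {q} {r} {suc l} {suc s} {suc t} op@(pp , _) (pq , _) (pr , _) p<q q<r _ _ _ =
  condition-bound (p ^ l * q ^ s * r ^ t) {{powers≢0 pp pq pr l s t}}
    {{powers≢0 pp pq pr (suc l) (suc s) (suc t)}}
    pp pq pr (odd-prime⇒3≤ op) p<q q<r (power-product p q r l s t) (power-divisors pp pq pr _ _ _ l s t)
  where
  open ThreePrimes
  open TotientOfThreePrimes using (power-divisors)
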